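{- Let $C$ and $C'$ be geodesic 5-cycles in the flip graph $\Gamma$ of $P_{n+3}$. Then $C\simeq_A C'$ (i.e. for suitable orientations of the cycles, $C$ and $C'$ represent the same element of $A_1^{n-2}(\mathcal{T}_n)^{ab}\cong H_1(X_\Gamma;\mathbb{Z})$) if and only if $L(C)=L(C')$.
   Context: $P_{n+3}$ is a convex $(n+3)$-gon with vertices labeled $1,\dots,n+3$. $\mathcal{T}_n$ is the simplicial complex on diagonals of $P_{n+3}$ whose simplices are sets of non-crossing diagonals. The flip graph $\Gamma$ has triangulations of $P_{n+3}$ as nodes and single diagonal flips as edges. $X_\Gamma$ is the 2-complex obtained from $\Gamma$ by attaching a 2-cell along every 3- and 4-cycle; the $(n-2)$-discrete fundamental group $A_1^{n-2}(\mathcal{T}_n)$ (loops of triangulations with consecutive ones equal or differing by a flip, modulo discrete homotopy) is isomorphic to $\pi_1(X_\Gamma)$, so its abelianization is $H_1(X_\Gamma;\mathbb{Z})$. A geodesic 5-cycle is the set of five triangulations containing a fixed set of $n-2$ non-crossing diagonals whose dissection of $P_{n+3}$ consists of triangles and exactly one pentagon; they form a 5-cycle in $\Gamma$. Its label $L(C)$ is the set of five vertices of that pentagon. -}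

module Defs where

open import Data.Nat as ℕ using (ℕ; zero; suc; _≤_; _<_; _∸_)
open import Data.Fin using (Fin; toℕ; fromℕ<)
import Data.Fin as Fin
open import Data.Fin.Subset using (∣_∣)
open import Data.Vec as Vec using (Vec; lookup)
import Data.Vec.Properties as VecP
open import Data.Bool as Bool using (Bool; true; false; if_then_else_; _∧_)
open import Data.Integer as ℤ using (ℤ; +_)
open import Data.List as List using (List; []; _∷_; allFin; concatMap)
open import Data.Product using (Σ; ∃; ∃-syntax; _×_; _,_)
open import Data.Sum using (_⊎_)
open import Relation.Binary.PropositionalEquality using (_≡_)
open import Relation.Nullary using (¬_; does; yes; no)
open import Function.Bundles using (_⇔_)

-- The polygon P_{n+3}: vertices labelled 0,…,n+2 (the paper's 1,…,n+3),
-- in cyclic order.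

V : ℕ → Set
V n = Fin (n ℕ.+ 3)

-- A set of (ordered) vertex pairs, i.e. a candidate set of diagonals,
-- stored as a Boolean (n+3)×(n+3) table.  Propositional equality of
-- such tables is equality of sets; it is decidable.
DSet : ℕ → Set
DSet n = Vec (Vec Bool (n ℕ.+ 3)) (n ℕ.+ 3)

entry : ∀ {n} → DSet n → V n → V n → Bool
entry S i j = lookup (lookup S i) j

_∋⟨_,_⟩ : ∀ {n} → DSet n → V n → V n → Set
S ∋⟨ i , j ⟩ = entry S i j ≡ true

IsDiag : ∀ {n} → V n → V n → Set
IsDiag {n} i j = (toℕ i ℕ.+ 2 ≤ toℕ j) × ¬ (toℕ i ≡ 0 × toℕ j ≡ n ℕ.+ 2)

-- Crossing of diagonals (i , j), (k , l) (each with smaller endpoint first).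
Crosses : ∀ {n} → V n → V n → V n → V n → Set
Crosses i j k l =
  (toℕ i < toℕ k × toℕ k < toℕ j × toℕ j < toℕ l)
  ⊎ (toℕ k < toℕ i × toℕ i < toℕ l × toℕ l < toℕ j)

NonCrossing : ∀ {n} → DSet n → Set
NonCrossing S =
  (∀ i j → S ∋⟨ i , j ⟩ → IsDiag i j)
  × (∀ i j k l → S ∋⟨ i , j ⟩ → S ∋⟨ k , l ⟩ → ¬ Crosses i j k l)

IsTriangulation : ∀ {n} → DSet n → Set
IsTriangulation S =
  NonCrossing S
  × (∀ i j → IsDiag i j → ¬ S ∋⟨ i , j ⟩ →
       ∃[ k ] ∃[ l ] (S ∋⟨ k , l ⟩ × Crosses i j k l))

_⊆D_ : ∀ {n} → DSet n → DSet n → Set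
F ⊆D T = ∀ i j → F ∋⟨ i , j ⟩ → T ∋⟨ i , j ⟩

size : ∀ {n} → DSet n → ℕ
size S = Vec.sum (Vec.map ∣_∣ S)

Flip : ∀ {n} → DSet n → DSet n → Set
Flip T T' = ∃[ i ] ∃[ j ] ∃[ k ] ∃[ l ]
  ( T ∋⟨ i , j ⟩ × ¬ T' ∋⟨ i , j ⟩ × T' ∋⟨ k , l ⟩ × ¬ T ∋⟨ k , l ⟩
  × (∀ x y → (x ≡ i × y ≡ j) ⊎ (x ≡ k × y ≡ l) ⊎ (entry T x y ≡ entry T' x y)))

IsSide : ∀ {n} → DSet n → V n → V n → Set
IsSide {n} F u v =
  (toℕ v ≡ suc (toℕ u)) ⊎ (toℕ u ≡ 0 × toℕ v ≡ n ℕ.+ 2) ⊎ F ∋⟨ u , v ⟩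

CycAdj : ℕ → ℕ → ℕ → Set
CycAdj k p q = (q ≡ suc p) ⊎ (p ≡ 0 × suc q ≡ k)

-- v : Fin k → V n (strictly increasing) is the vertex list of a face
-- (region) of the dissection by F: consecutive vertices are joined by
-- sides, and no diagonal of F joins two non-consecutive vertices
-- (i.e. no diagonal of F lies inside the convex k-gon).
IsFace : ∀ {n} → DSet n → (k : ℕ) → (Fin k → V n) → Set
IsFace F k v =
  (3 ≤ k)
  × (∀ p q → toℕ p < toℕ q → toℕ (v p) < toℕ (v q))
  × (∀ p q → toℕ p < toℕ q → CycAdj k (toℕ p) (toℕ q) → IsSide F (v p) (v q))
  × (∀ p q → toℕ p < toℕ q → ¬ CycAdj k (toℕ p) (toℕ q) → ¬ F ∋⟨ v p , v q ⟩)

SameVerts : ∀ {n k m} → (Fin k → V n) → (Fin m → V n) → Set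
SameVerts {n} v w = ∀ (x : V n) → (∃[ p ] v p ≡ x) ⇔ (∃[ q ] w q ≡ x)

-- Geodesic 5-cycles: given by a set F of n-2 non-crossing diagonals
-- whose dissection consists of triangles and exactly one pentagon.

record Geodesic5 (n : ℕ) : Set where
  field
    F        : DSet n
    F-nc     : NonCrossing F
    F-size   : size F ≡ n ∸ 2
    pent     : Fin 5 → V n
    pent-face : IsFace F 5 pent
    others   : ∀ k (v : Fin k → V n) → IsFace F k v → (k ≡ 3) ⊎ SameVerts v pent

SameLabel : ∀ {n} → Geodesic5 n → Geodesic5 n → Set
SameLabel C C' = SameVerts (Geodesic5.pent C) (Geodesic5.pent C')

csuc : ∀ {k} → Fin (suc k) → Fin (suc k)
csuc {k} p with suc (toℕ p) ℕ.<? suc k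
... | yes lt = fromℕ< lt
... | no _   = Fin.zero

-- a closed walk of length m in Γ through m distinct triangulations,
-- i.e. an m-cycle of Γ (m ≥ 1 written as suc k)
record GCycle (n k : ℕ) : Set where
  field
    w     : Fin (suc k) → DSet n
    w-tri : ∀ p → IsTriangulation (w p)
    w-inj : ∀ p q → w p ≡ w q → p ≡ q
    w-adj : ∀ p → Flip (w p) (w (csuc p))

-- 1-chains of Γ: formal ℤ-combinations of oriented edges (T , T')
Chain : ℕ → Set
Chain n = List (ℤ × DSet n × DSet n)

_≟D_ : ∀ {n} (S T : DSet n) → _
_≟D_ = VecP.≡-dec (VecP.≡-dec Bool._≟_)

coeff : ∀ {n} → Chain n → DSet n → DSet n → ℤ
coeff [] a b = + 0
coeff ((c , x , y) ∷ ch) a b =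
  (if does (x ≟D a) ∧ does (y ≟D b) then c
   else if does (x ≟D b) ∧ does (y ≟D a) then ℤ.- c
   else + 0) ℤ.+ coeff ch a b

scale : ∀ {n} → ℤ → Chain n → Chain n
scale a = List.map (λ { (c , x , y) → (a ℤ.* c , x , y) })

neg : ∀ {n} → Chain n → Chain n
neg = scale (ℤ.- (+ 1))

cycleChain : ∀ {n k} → GCycle n k → Chain n
cycleChain {k = k} C =
  List.map (λ p → (+ 1 , GCycle.w C p , GCycle.w C (csuc p))) (allFin (suc k))

-- 2-cells of X_Γ: one attached along every 3-cycle and every 4-cycle.
record TwoCell (n : ℕ) : Set where
  field
    k     : ℕ
    k-ok  : (k ≡ 2) ⊎ (k ≡ 3)      -- cycle length suc k ∈ {3,4}
    cyc   : GCycle n k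

∂₂ : ∀ {n} → List (ℤ × TwoCell n) → Chain n
∂₂ = concatMap (λ { (a , σ) → scale a (cycleChain (TwoCell.cyc σ)) })

Homologous : ∀ {n} → Chain n → Chain n → Set
Homologous {n} c c' = ∃[ β ] (∀ (x y : DSet n) →
  coeff c x y ℤ.- coeff c' x y ≡ coeff (∂₂ {n} β) x y)

-- An orientation (cyclic enumeration) of the geodesic 5-cycle C: the
-- five triangulations containing F, listed as a 5-cycle of Γ.

record Orientation {n : ℕ} (C : Geodesic5 n) : Set where
  field
    cyc  : GCycle n 4
    ⊇F   : ∀ p → Geodesic5.F C ⊆D GCycle.w cyc p
    all  : ∀ T → IsTriangulation T → Geodesic5.F C ⊆D T → ∃[ p ] GCycle.w cyc p ≡ T

orientedChain : ∀ {n} {C : Geodesic5 n} → Orientation C → Chain n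
orientedChain γ = cycleChain (Orientation.cyc γ)

-- C ≃_A C': for suitable orientations, same class in H_1(X_Γ; ℤ)
EquivA : ∀ {n} {C C' : Geodesic5 n} → Orientation C → Orientation C' → Set
EquivA γ γ' = Homologous (orientedChain γ) (orientedChain γ')
            ⊎ Homologous (orientedChain γ) (neg (orientedChain γ'))

{-# OPTIONS --safe #-}
module Submission where

-- A flip exchanges two crossing chords, the diagonals of a quadrilateral.  For a fixed pair
-- α, β of crossing chords, counting the flips α → β minus the flips β → α along a walk
-- gives a 1-cochain.  It vanishes on every 2-cell, because Γ has no 3-cycles and opposite
-- edges of a 4-cycle exchange the same two chords in opposite directions.  On a geodesic
-- 5-cycle C it is nonzero for α, β diagonals of the pentagon L(C), and it is zero unless
-- all endpoints of α and β lie in L(C).  Hence the class of ± C determines L(C).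
--
-- Conversely, if L(C) = L(C'), triangulations belonging to C and C' are joined by flips that
-- keep the sides of the common pentagon.  Performing such a flip simultaneously on the five
-- triangulations of a geodesic 5-cycle sweeps out a prism of five 4-cycles.

-- The planar steps involve at most nine vertices at a time, so each becomes a universal statement
-- about the order of finitely many elements and is decided by enumerating weak orders. They are
-- phrased by cyclic betweenness rather than by the linear order of the labels, because the pentagon
-- gets rotated. An orientation lists its five triangulations from an arbitrary start and in an
-- arbitrary direction. To compare orientations, each triangulation T having the five sides of the
-- pentagon as chords or polygon sides generates a reference cycle: T retriangulated inside the
-- pentagon by the fans at its vertices a, c, e, b, d, in this order. Every orientation is plus or
-- minus such a cycle, and the prisms join reference cycles. A flip of T inside the pentagon leaves
-- the reference cycle unchanged. The cochain cannot cancel on a 5-cycle: a pentagon has five pairs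
-- of crossing diagonals, and the five flips exchange each pair exactly once. One pair has only four
-- endpoints, so two pairs are needed to recover the label.

open import Defs
open import Data.Nat as ℕ using (ℕ; zero; suc; s≤s; z≤n)
import Data.Nat.Properties as ℕP
open import Data.Fin as Fin using (Fin; toℕ; _<_; fromℕ<)
import Data.Fin.Properties as FinP
open import Data.Fin.Patterns
open import Data.Fin.Subset using (Subset; ∣_∣)
open import Data.Bool as Bool using (Bool; true; false; if_then_else_; _∧_; _∨_)
open import Data.Integer as ℤ using (ℤ; +_)
import Data.Integer.Properties as ℤP
import Data.Integer.Tactic.RingSolver as ℤSolver
open import Data.Maybe using (Maybe; just; nothing)
open import Data.Vec as Vec using (Vec; []; _∷_)
import Data.Vec.Properties as VecP
open import Data.List using (List; []; _∷_; map; _++_; length; lookup; filter; foldr; allFin; cartesianProduct)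
import Data.List.Properties as ListP
open import Data.List.Membership.Propositional using (_∈_)
open import Data.List.Membership.Propositional.Properties using (∈-lookup; ∈-map⁻; ∈-allFin; ∈-cartesianProduct⁺)
import Data.List.Membership.DecPropositional as DecMem
open import Data.List.Relation.Unary.All as All using (All; []; _∷_)
import Data.List.Relation.Unary.All.Properties as AllP
open import Data.List.Relation.Unary.AllPairs using ([]; _∷_)
open import Data.List.Relation.Unary.Any as Any using (Any; here; there)
import Data.List.Relation.Unary.Any.Properties as AnyP
open import Data.List.Relation.Unary.Unique.Propositional using (Unique)
import Data.List.Relation.Unary.Unique.Propositional.Properties as UniqueP
open import Data.Product using (∃; ∃₂; ∃-syntax; _×_; _,_; proj₁; proj₂; swap)
import Data.Product.Properties as ΣP
open import Data.Sum as Sum using (_⊎_; inj₁; inj₂; [_,_]′)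
open import Data.Empty using (⊥; ⊥-elim)
open import Data.Unit using (⊤; tt)
open import Function using (_∘′_; case_of_)
open import Function.Bundles using (_⇔_; mk⇔; Equivalence)
open import Relation.Binary using (tri<; tri≈; tri>)
open import Relation.Binary.PropositionalEquality
open import Relation.Nullary using (¬_; Dec; does; yes; no; ¬?; _×-dec_; _⊎-dec_)
open import Relation.Nullary.Decidable using (dec-true; dec-false; decidable-stable)

-- A decision procedure for statements about the order of finitely many vertices

infix 8 _<′_ _≡′_
infixr 7 _∧′_
infixr 6 _∨′_
infixr 5 _⇒′_

data Fm : Set where
  _<′_ _≡′_     : ℕ → ℕ → Fm
  ⊥′            : Fm
  _∧′_ _∨′_ _⇒′_ : Fm → Fm → Fm

module _ {N : ℕ} where

  ⟦_⟧ : Fm → (ℕ → Fin N) → Set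
  ⟦ i <′ j ⟧ ρ = ρ i < ρ j
  ⟦ i ≡′ j ⟧ ρ = ρ i ≡ ρ j
  ⟦ ⊥′ ⟧ ρ = ⊥
  ⟦ φ ∧′ ψ ⟧ ρ = ⟦ φ ⟧ ρ × ⟦ ψ ⟧ ρ
  ⟦ φ ∨′ ψ ⟧ ρ = ⟦ φ ⟧ ρ ⊎ ⟦ ψ ⟧ ρ
  ⟦ φ ⇒′ ψ ⟧ ρ = ⟦ φ ⟧ ρ → ⟦ ψ ⟧ ρ

  -- Indices past the end repeat the last listed vertex. Taking the head separately makes this total
  -- without a default element of `Fin N`.
  env : Fin N → List (Fin N) → ℕ → Fin N
  env x xs       zero    = x
  env x []       (suc i) = x
  env x (y ∷ ys) (suc i) = env y ys i

-- A weak order on an initial segment of the variables, as its list of classes in increasing order.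
WeakOrder : Set
WeakOrder = List (List ℕ)

elem : ℕ → List ℕ → Bool
elem x []       = false
elem x (y ∷ ys) = (x ℕ.≡ᵇ y) ∨ elem x ys

occurs : ℕ → WeakOrder → Bool
occurs x []       = false
occurs x (b ∷ bs) = elem x b ∨ occurs x bs

data Cmp : Set where
  less equal greater unknown : Cmp

compare : WeakOrder → ℕ → ℕ → Cmp
compare [] x y = unknown
compare (b ∷ bs) x y with elem x b | elem y b
... | true  | true  = equal
... | true  | false = if occurs y bs then less else unknown
... | false | true  = if occurs x bs then greater else unknown
... | false | false = compare bs x y

-- Strong Kleene logic: a partially built order that already settles the formula ends its branch of
-- the search, which keeps nine variables feasible.
data Truth : Set where
  holds fails undecided : Truth

evalLt evalEq : Cmp → Truth
evalLt less = holds
evalLt equal = fails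
evalLt greater = fails
evalLt unknown = undecided
evalEq less = fails
evalEq equal = holds
evalEq greater = fails
evalEq unknown = undecided

and or imp : Truth → Truth → Truth
and fails _ = fails
and _ fails = fails
and holds holds = holds
and _ _ = undecided
or holds _ = holds
or _ holds = holds
or fails fails = fails
or _ _ = undecided
imp fails _ = holds
imp _ holds = holds
imp holds fails = fails
imp _ _ = undecided

eval : WeakOrder → Fm → Truth
eval σ (i <′ j) = evalLt (compare σ i j)
eval σ (i ≡′ j) = evalEq (compare σ i j)
eval σ ⊥′ = fails
eval σ (φ ∧′ ψ) = and (eval σ φ) (eval σ ψ)
eval σ (φ ∨′ ψ) = or (eval σ φ) (eval σ ψ)
eval σ (φ ⇒′ ψ) = imp (eval σ φ) (eval σ ψ)

insertions : ℕ → WeakOrder → List WeakOrder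
insertions x []       = ((x ∷ []) ∷ []) ∷ []
insertions x (b ∷ bs) = ((x ∷ []) ∷ b ∷ bs) ∷ ((x ∷ b) ∷ bs) ∷ map (b ∷_) (insertions x bs)

-- With fuel m, the variables x, x + 1, …, x + m − 1 remain to be placed.
valid    : Fm → ℕ → ℕ → WeakOrder → Bool
validAll : Fm → ℕ → ℕ → List WeakOrder → Bool
validAt  : Fm → ℕ → ℕ → WeakOrder → Truth → Bool
valid φ m x σ = validAt φ m x σ (eval σ φ)
validAt φ m x σ holds = true
validAt φ m x σ fails  = false
-- Running out of fuel is a failure, so too small a number of variables can only make a `refl`
-- ill-typed, never prove something false.
validAt φ zero x σ undecided = false
validAt φ (suc m) x σ undecided = validAll φ m (suc x) (insertions x σ)
validAll φ m x [] = true
validAll φ m x (σ ∷ σs) = valid φ m x σ ∧ validAll φ m x σs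

module _ {N : ℕ} (ρ : ℕ → Fin N) where

  _⊏_ : Maybe (Fin N) → Fin N → Set
  nothing ⊏ v = ⊤
  just u  ⊏ v = u < v

  data Respects : Maybe (Fin N) → WeakOrder → Set where
    []   : ∀ {lo} → Respects lo []
    cons : ∀ {lo v b bs} → lo ⊏ v → All (λ x → ρ x ≡ v) b → Respects (just v) bs → Respects lo (b ∷ bs)

  ∨-split : ∀ {p q} → p ∨ q ≡ true → p ≡ true ⊎ q ≡ true
  ∨-split {true}  _ = inj₁ refl
  ∨-split {false} e = inj₂ e

  ∧-split : ∀ {p q} → p ∧ q ≡ true → p ≡ true × q ≡ true
  ∧-split {true} e = refl , e

  ≡ᵇ⇒≡ : ∀ x y → (x ℕ.≡ᵇ y) ≡ true → x ≡ y
  ≡ᵇ⇒≡ zero zero _ = refl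
  ≡ᵇ⇒≡ (suc x) (suc y) e = cong suc (≡ᵇ⇒≡ x y e)

  elem-value : ∀ x {b v} → All (λ x → ρ x ≡ v) b → elem x b ≡ true → ρ x ≡ v
  elem-value x [] ()
  elem-value x {y ∷ _} (p ∷ ps) e with ∨-split {x ℕ.≡ᵇ y} e
  ... | inj₁ e′ = trans (cong ρ (≡ᵇ⇒≡ x _ e′)) p
  ... | inj₂ e′ = elem-value x ps e′

  occurs-above : ∀ x {u σ} → Respects (just u) σ → occurs x σ ≡ true → u < ρ x
  occurs-above x {u} (cons {b = b} u<v all rest) e with ∨-split {elem x b} e
  ... | inj₁ e′ = subst (u <_) (sym (elem-value x all e′)) u<v
  ... | inj₂ e′ = FinP.<-trans u<v (occurs-above x rest e′)

  CmpSound : ℕ → ℕ → Cmp → Set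
  CmpSound x y less = ρ x < ρ y
  CmpSound x y equal = ρ x ≡ ρ y
  CmpSound x y greater = ρ y < ρ x
  CmpSound x y unknown = ⊤

  compare-sound : ∀ {lo σ} → Respects lo σ → ∀ x y → CmpSound x y (compare σ x y)
  compare-sound [] x y = tt
  compare-sound (cons {v = v} {b} {bs} lo all rest) x y with elem x b in ex | elem y b in ey
  ... | true  | true  = trans (elem-value x all ex) (sym (elem-value y all ey))
  ... | false | false = compare-sound rest x y
  ... | true  | false with occurs y bs in oy
  ...   | true  = subst (_< ρ y) (sym (elem-value x all ex)) (occurs-above y rest oy)
  ...   | false = tt
  compare-sound (cons {v = v} {b} {bs} lo all rest) x y | false | true with occurs x bs in ox
  ...   | true  = subst (_< ρ x) (sym (elem-value y all ey)) (occurs-above x rest ox)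
  ...   | false = tt

  TruthSound : Set → Truth → Set
  TruthSound P holds   = P
  TruthSound P fails    = ¬ P
  TruthSound P undecided = ⊤

  less-sound : ∀ i j c → CmpSound i j c → TruthSound (ρ i < ρ j) (evalLt c)
  less-sound i j less s = s
  less-sound i j equal s = FinP.<-irrefl s
  less-sound i j greater s = FinP.<-asym s
  less-sound i j unknown s = tt

  equal-sound : ∀ i j c → CmpSound i j c → TruthSound (ρ i ≡ ρ j) (evalEq c)
  equal-sound i j less s = λ e → FinP.<-irrefl e s
  equal-sound i j equal s = s
  equal-sound i j greater s = λ e → FinP.<-irrefl (sym e) s
  equal-sound i j unknown s = tt

  and-sound : ∀ {P Q} s t → TruthSound P s → TruthSound Q t → TruthSound (P × Q) (and s t)
  and-sound fails t p q = λ r → p (proj₁ r)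
  and-sound holds fails p q = λ r → q (proj₂ r)
  and-sound undecided fails p q = λ r → q (proj₂ r)
  and-sound holds holds p q = p , q
  and-sound holds undecided p q = tt
  and-sound undecided holds p q = tt
  and-sound undecided undecided p q = tt

  or-sound : ∀ {P Q} s t → TruthSound P s → TruthSound Q t → TruthSound (P ⊎ Q) (or s t)
  or-sound holds t p q = inj₁ p
  or-sound fails holds p q = inj₂ q
  or-sound undecided holds p q = inj₂ q
  or-sound fails fails p q = λ { (inj₁ x) → p x ; (inj₂ y) → q y }
  or-sound fails undecided p q = tt
  or-sound undecided fails p q = tt
  or-sound undecided undecided p q = tt

  imp-sound : ∀ {P Q} s t → TruthSound P s → TruthSound Q t → TruthSound (P → Q) (imp s t)
  imp-sound fails t p q = λ x → ⊥-elim (p x)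
  imp-sound holds holds p q = λ _ → q
  imp-sound undecided holds p q = λ _ → q
  imp-sound holds fails p q = λ f → q (f p)
  imp-sound holds undecided p q = tt
  imp-sound undecided fails p q = tt
  imp-sound undecided undecided p q = tt

  eval-sound : ∀ {lo σ} → Respects lo σ → ∀ φ → TruthSound (⟦ φ ⟧ ρ) (eval σ φ)
  eval-sound r (i <′ j) = less-sound i j _ (compare-sound r i j)
  eval-sound r (i ≡′ j) = equal-sound i j _ (compare-sound r i j)
  eval-sound r ⊥′ = λ ()
  eval-sound r (φ ∧′ ψ) = and-sound _ _ (eval-sound r φ) (eval-sound r ψ)
  eval-sound r (φ ∨′ ψ) = or-sound _ _ (eval-sound r φ) (eval-sound r ψ)
  eval-sound r (φ ⇒′ ψ) = imp-sound _ _ (eval-sound r φ) (eval-sound r ψ)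

  -- The value of the new variable is compared with one class after another. The lower bound carried
  -- by `Respects` certifies that it fits into the gap before the class where the comparison stops.
  insertions-complete : ∀ x {lo σ} → Respects lo σ → lo ⊏ ρ x → Any (Respects lo) (insertions x σ)
  insertions-complete x [] lo = here (cons lo (refl ∷ []) [])
  insertions-complete x (cons {v = v} lo⊏v all rest) lo with FinP.<-cmp (ρ x) v
  ... | tri< x<v _ _ = here (cons lo (refl ∷ []) (cons x<v all rest))
  ... | tri≈ _ x≡v _ = there (here (cons lo⊏v (x≡v ∷ all) rest))
  ... | tri> _ _ v<x = there (there (AnyP.map⁺ (Any.map (cons lo⊏v all) (insertions-complete x rest v<x))))

  valid-sound    : ∀ φ m x σ → Respects nothing σ → valid φ m x σ ≡ true → ⟦ φ ⟧ ρ
  validAll-sound : ∀ φ m x σs → Any (Respects nothing) σs → validAll φ m x σs ≡ true → ⟦ φ ⟧ ρ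
  validAt-sound  : ∀ φ m x σ t → TruthSound (⟦ φ ⟧ ρ) t → Respects nothing σ → validAt φ m x σ t ≡ true → ⟦ φ ⟧ ρ
  valid-sound φ m x σ r e = validAt-sound φ m x σ (eval σ φ) (eval-sound r φ) r e
  validAt-sound φ m x σ holds s r e = s
  validAt-sound φ (suc m) x σ undecided s r e =
    validAll-sound φ m (suc x) (insertions x σ) (insertions-complete x r tt) e
  validAll-sound φ m x (σ ∷ σs) (here r) e = valid-sound φ m x σ r (proj₁ (∧-split {valid φ m x σ} e))
  validAll-sound φ m x (σ ∷ σs) (there r) e = validAll-sound φ m x σs r (proj₂ (∧-split {valid φ m x σ} e))

opaque
  -- Opaque, since with-abstraction would otherwise unfold the search behind the proofs it returns.
  solve : ∀ φ m → valid φ m 0 [] ≡ true → ∀ {N} (x : Fin N) xs → ⟦ φ ⟧ (env x xs)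
  solve φ m e x xs = valid-sound (env x xs) φ m 0 [] [] e

-- Cyclic order and crossing chords

module _ {N : ℕ} where
  -- Going around the polygon from a, one meets c strictly before b.
  B : Fin N → Fin N → Fin N → Set
  B a c b = (a < c × c < b) ⊎ (c < b × b < a) ⊎ (b < a × a < c)

  -- The chords ab and cd cross.
  X : Fin N → Fin N → Fin N → Fin N → Set
  X a b c d = (B a c b × B b d a) ⊎ (B a d b × B b c a)

  -- Three triples sharing the vertex a already fix the cyclic order of five points. Unlike a chain
  -- of inequalities, the condition survives rotation of the pentagon.
  Cyc5 : (a b c d e : Fin N) → Set
  Cyc5 a b c d e = B a b c × B a c d × B a d e

-- Syntactic mirror of `B`, as are the following of `X`, `Cyc5` and `In`: `⟦_⟧` unfolds them
-- definitionally to the originals, so a call of `solve` has the wanted type without conversion.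
B′ : ℕ → ℕ → ℕ → Fm
B′ a c b = (a <′ c ∧′ c <′ b) ∨′ (c <′ b ∧′ b <′ a) ∨′ (b <′ a ∧′ a <′ c)

X′ : ℕ → ℕ → ℕ → ℕ → Fm
X′ a b c d = (B′ a c b ∧′ B′ b d a) ∨′ (B′ a d b ∧′ B′ b c a)

Cyc5′ : (a b c d e : ℕ) → Fm
Cyc5′ a b c d e = B′ a b c ∧′ B′ a c d ∧′ B′ a d e

In : ∀ {N} (a b c d e x : Fin N) → Set
In a b c d e x = x ≡ a ⊎ x ≡ b ⊎ x ≡ c ⊎ x ≡ d ⊎ x ≡ e

In′ : (a b c d e x : ℕ) → Fm
In′ a b c d e x = x ≡′ a ∨′ x ≡′ b ∨′ x ≡′ c ∨′ x ≡′ d ∨′ x ≡′ e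

-- Chords and triangulations

does⇒ : ∀ {A : Set} (d : Dec A) → does d ≡ true → A
does⇒ (yes a) _ = a

module _ {N : ℕ} where

  opaque
    B? : (a c b : Fin N) → Dec (B a c b)
    B? a c b = (a Fin.<? c ×-dec c Fin.<? b) ⊎-dec (c Fin.<? b ×-dec b Fin.<? a) ⊎-dec (b Fin.<? a ×-dec a Fin.<? c)

    X? : (a b c d : Fin N) → Dec (X a b c d)
    X? a b c d = (B? a c b ×-dec B? b d a) ⊎-dec (B? a d b ×-dec B? b c a)

  X-sym : ∀ {a b c d : Fin N} → X a b c d → X c d a b
  X-sym {a} {b} {c} {d} = solve (X′ 0 1 2 3 ⇒′ X′ 2 3 0 1) 4 refl a (b ∷ c ∷ d ∷ [])

  X-swapʳ : ∀ {a b c d : Fin N} → X a b c d → X a b d c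
  X-swapʳ = Sum.swap

  X-swapˡ : ∀ {a b c d : Fin N} → X a b c d → X b a c d
  X-swapˡ = Sum.map swap swap ∘′ Sum.swap

  SameChord : (x y a c : Fin N) → Set
  SameChord x y a c = (x ≡ a × y ≡ c) ⊎ (x ≡ c × y ≡ a)

  opaque
    SameChord? : ∀ x y a c → Dec (SameChord x y a c)
    SameChord? x y a c = (x Fin.≟ a ×-dec y Fin.≟ c) ⊎-dec (x Fin.≟ c ×-dec y Fin.≟ a)

  SameChord-refl : ∀ {x y} → SameChord x y x y
  SameChord-refl = inj₁ (refl , refl)

  SameChord-swapˡ : ∀ {x y a c} → SameChord x y a c → SameChord y x a c
  SameChord-swapˡ = Sum.swap ∘′ Sum.map swap swap

  SameChord-swapʳ : ∀ {x y a c} → SameChord x y a c → SameChord x y c a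
  SameChord-swapʳ = Sum.swap

  SameChord-sym : ∀ {x y a c} → SameChord x y a c → SameChord a c x y
  SameChord-sym (inj₁ (refl , refl)) = inj₁ (refl , refl)
  SameChord-sym (inj₂ (refl , refl)) = inj₂ (refl , refl)

  SameChord-trans : ∀ {x y a c u v} → SameChord x y a c → SameChord a c u v → SameChord x y u v
  SameChord-trans (inj₁ (refl , refl)) s = s
  SameChord-trans (inj₂ (refl , refl)) s = SameChord-swapˡ s

  X-SameChord : ∀ {x y a c u v} → SameChord x y a c → X a c u v → X x y u v
  X-SameChord (inj₁ (refl , refl)) s = s
  X-SameChord {x} {y} (inj₂ (refl , refl)) s = X-swapˡ {y} {x} s

  X-irrefl : ∀ {x y a c} → SameChord x y a c → ¬ X x y a c
  X-irrefl {x} {y} (inj₁ (refl , refl)) = solve (X′ 0 1 0 1 ⇒′ ⊥′) 2 refl x (y ∷ [])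
  X-irrefl {x} {y} (inj₂ (refl , refl)) = solve (X′ 0 1 1 0 ⇒′ ⊥′) 2 refl x (y ∷ [])

  -- The sides of the polygon; Adj x x also holds.
  Adj : Fin N → Fin N → Set
  Adj x y = (∀ k → ¬ B x k y) ⊎ (∀ k → ¬ B y k x)

  opaque
    Adj? : ∀ x y → Dec (Adj x y)
    Adj? x y = FinP.all? (λ k → ¬? (B? x k y)) ⊎-dec FinP.all? (λ k → ¬? (B? y k x))

  Adj-sym : ∀ {x y} → Adj x y → Adj y x
  Adj-sym = Sum.swap

  Adj-refl : ∀ {x} → Adj x x
  Adj-refl {x} = inj₁ λ k → solve (B′ 0 1 0 ⇒′ ⊥′) 2 refl x (k ∷ [])

  Adj-¬X : ∀ {x y k l} → Adj x y → ¬ X x y k l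
  Adj-¬X {k = k} {l} (inj₁ f) (inj₁ (p , q)) = f k p
  Adj-¬X {k = k} {l} (inj₁ f) (inj₂ (p , q)) = f l p
  Adj-¬X {k = k} {l} (inj₂ f) (inj₁ (p , q)) = f l q
  Adj-¬X {k = k} {l} (inj₂ f) (inj₂ (p , q)) = f k q

X-≢ : ∀ {N} {x y k l : Fin N} → X x y k l → ¬ Adj x y
X-≢ cr ad = Adj-¬X ad cr

module _ {n : ℕ} where

  private
    top : ∀ (k : V n) → ¬ (n ℕ.+ 2 ℕ.< toℕ k)
    top k lt = ℕP.<-irrefl refl (ℕP.<-≤-trans lt (ℕP.≤-pred (ℕP.≤-trans (FinP.toℕ<n k) (ℕP.≤-reflexive (ℕP.+-suc n 2)))))

  side-empty : ∀ {x y : V n} → toℕ y ≡ suc (toℕ x) → ∀ k → ¬ B x k y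
  side-empty {x} {y} e = λ
    { k (inj₁ (p , q)) → ℕP.<⇒≱ p (ℕP.≤-pred (ℕP.≤-trans q (ℕP.≤-reflexive e)))
    ; k (inj₂ (inj₁ (_ , q))) → ℕP.<-asym q x<y
    ; k (inj₂ (inj₂ (q , _))) → ℕP.<-asym q x<y }
    where x<y : x < y
          x<y = ℕP.≤-reflexive (sym e)

  base-empty : ∀ {x y : V n} → toℕ x ≡ 0 → toℕ y ≡ n ℕ.+ 2 → ∀ k → ¬ B y k x
  base-empty {x} {y} e e′ = λ
    { k (inj₁ (_ , q)) → ℕP.n≮0 (subst (toℕ k ℕ.<_) e q)
    ; k (inj₂ (inj₁ (q , _))) → ℕP.n≮0 (subst (toℕ k ℕ.<_) e q)
    ; k (inj₂ (inj₂ (_ , q))) → top k (subst (ℕ._< toℕ k) e′ q) }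

  side-Adj : ∀ {x y : V n} → toℕ y ≡ suc (toℕ x) → Adj x y
  side-Adj e = inj₁ (side-empty e)

  base-Adj : ∀ {x y : V n} → toℕ x ≡ 0 → toℕ y ≡ n ℕ.+ 2 → Adj x y
  base-Adj e e′ = inj₂ (base-empty e e′)

  ¬Adj⇒IsDiag : ∀ {x y : V n} → x < y → ¬ Adj x y → IsDiag x y
  ¬Adj⇒IsDiag {x} {y} x<y na = gap , λ { (p , q) → na (base-Adj p q) }
    where
    gap : toℕ x ℕ.+ 2 ℕ.≤ toℕ y
    gap with toℕ x ℕ.+ 2 ℕ.≤? toℕ y
    ... | yes p = p
    ... | no ¬p = ⊥-elim (na (side-Adj (ℕP.≤-antisym
           (ℕP.≤-pred (subst (toℕ y ℕ.<_) (ℕP.+-comm (toℕ x) 2) (ℕP.≰⇒> ¬p))) x<y)))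

  between⇒¬Adj : ∀ {x y k l : V n} → B x k y → B y l x → ¬ Adj x y
  between⇒¬Adj p q (inj₁ f) = f _ p
  between⇒¬Adj p q (inj₂ f) = f _ q

  IsDiag⇒< : ∀ {x y : V n} → IsDiag x y → x < y
  IsDiag⇒< {x} {y} (p , _) = ℕP.<-≤-trans (ℕP.m<m+n (toℕ x) (s≤s z≤n)) p

  after : ∀ (x : V n) → toℕ x ℕ.< n ℕ.+ 2 → ∃ λ (k : V n) → toℕ k ≡ suc (toℕ x)
  after x lt = fromℕ< lt′ , FinP.toℕ-fromℕ< lt′
    where lt′ : suc (toℕ x) ℕ.< n ℕ.+ 3
          lt′ = subst (suc (suc (toℕ x)) ℕ.≤_) (sym (ℕP.+-suc n 2)) (s≤s lt)

  first : ∃ λ (k : V n) → toℕ k ≡ 0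
  first = fromℕ< lt′ , FinP.toℕ-fromℕ< lt′
    where lt′ : 0 ℕ.< n ℕ.+ 3
          lt′ = ℕP.≤-trans (s≤s z≤n) (ℕP.m≤n+m 3 n)

  below-top : ∀ {x y : V n} → x < y → toℕ x ℕ.< n ℕ.+ 2
  below-top {x} {y} x<y = ℕP.<-≤-trans x<y (ℕP.≮⇒≥ (top y))

  -- Wrapping around at the last vertex provides a polygon side leaving any vertex, from which the
  -- search for neighbours starts.
  successor : ∀ (x : V n) → ∃ λ s → ¬ s ≡ x × (∀ k → ¬ B x k s)
  successor x with toℕ x ℕ.<? n ℕ.+ 2
  ... | yes lt = let s , e = after x lt in s , (λ q → ℕP.1+n≢n (trans (sym e) (cong toℕ q))) , side-empty e
  ... | no ¬lt = let s , e = first in s , (λ q → x≢0 (trans (cong toℕ (sym q)) e)) , base-empty e x≡top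
    where
    x≡top : toℕ x ≡ n ℕ.+ 2
    x≡top = ℕP.≤-antisym (ℕP.≮⇒≥ (top x)) (ℕP.≮⇒≥ ¬lt)
    x≢0 : ¬ toℕ x ≡ 0
    x≢0 e = ℕP.m+1+n≢0 n (trans (sym x≡top) e)

  IsDiag⇒¬Adj : ∀ {x y : V n} → IsDiag x y → ¬ Adj x y
  IsDiag⇒¬Adj {x} {y} d@(p , q) with after x (below-top {x} {y} x<y) | toℕ x ℕ.≟ 0
    where x<y = IsDiag⇒< {x} {y} d
  ... | k , ek | no x≢0 = between⇒¬Adj {k = k} {proj₁ first}
          (inj₁ (ℕP.≤-reflexive (sym ek) , subst (ℕ._≤ toℕ y) (trans (ℕP.+-comm (toℕ x) 2) (cong suc (sym ek))) p))
          (inj₂ (inj₁ (subst (ℕ._< toℕ x) (sym (proj₂ first)) (ℕP.n≢0⇒n>0 x≢0) , IsDiag⇒< {x} {y} d)))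
  ... | k , ek | yes x≡0 with after y (ℕP.≤∧≢⇒< (ℕP.≮⇒≥ (top y)) (λ e → q (x≡0 , e)))
  ...   | l , el = between⇒¬Adj {k = k} {l}
          (inj₁ (ℕP.≤-reflexive (sym ek) , subst (ℕ._≤ toℕ y) (trans (ℕP.+-comm (toℕ x) 2) (cong suc (sym ek))) p))
          (inj₂ (inj₂ (IsDiag⇒< {x} {y} d , ℕP.≤-reflexive (sym el))))

  ¬Adj⇒≢ : ∀ {x y : V n} → ¬ Adj x y → ¬ x ≡ y
  ¬Adj⇒≢ na refl = na Adj-refl

  -- Polygon sides count as chords and the order of the endpoints is forgotten, so triangles,
  -- quadrilaterals and pentagons need no case distinction between sides and diagonals.
  E : DSet n → V n → V n → Set
  E T x y = Adj x y ⊎ T ∋⟨ x , y ⟩ ⊎ T ∋⟨ y , x ⟩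

  opaque
    E? : ∀ T x y → Dec (E T x y)
    E? T x y = Adj? x y ⊎-dec (entry T x y Bool.≟ true) ⊎-dec (entry T y x Bool.≟ true)

  E-sym : ∀ T {x y} → E T x y → E T y x
  E-sym T = Sum.map Adj-sym Sum.swap

  E-SameChord : ∀ T {x y a c} → SameChord x y a c → E T a c → E T x y
  E-SameChord T (inj₁ (refl , refl)) p = p
  E-SameChord T (inj₂ (refl , refl)) p = E-sym T p

  -- The rotation-invariant form of `IsTriangulation`. Only `diag` still mentions the storage
  -- convention; it is what makes the table recoverable from `E`.
  record Tri (T : DSet n) : Set where
    field
      nc   : ∀ {x y k l} → E T x y → E T k l → ¬ X x y k l
      mx   : ∀ {x y} → ¬ E T x y → ∃₂ λ k l → E T k l × X x y k l
      diag : ∀ {x y} → T ∋⟨ x , y ⟩ → x < y × ¬ Adj x y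
  open Tri

  Crosses⇒X : ∀ {i j k l : V n} → Crosses i j k l → X i j k l
  Crosses⇒X {i} {j} {k} {l} = solve (((0 <′ 2 ∧′ 2 <′ 1 ∧′ 1 <′ 3) ∨′ (2 <′ 0 ∧′ 0 <′ 3 ∧′ 3 <′ 1)) ⇒′ X′ 0 1 2 3) 4 refl i (j ∷ k ∷ l ∷ [])

  X⇒Crosses : ∀ {i j k l : V n} → i < j → k < l → X i j k l → Crosses i j k l
  X⇒Crosses {i} {j} {k} {l} = solve (0 <′ 1 ⇒′ 2 <′ 3 ⇒′ X′ 0 1 2 3 ⇒′
    ((0 <′ 2 ∧′ 2 <′ 1 ∧′ 1 <′ 3) ∨′ (2 <′ 0 ∧′ 0 <′ 3 ∧′ 3 <′ 1))) 4 refl i (j ∷ k ∷ l ∷ [])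

  sorted : ∀ {x y : V n} → ¬ x ≡ y → ∃₂ λ i j → SameChord i j x y × i < j
  sorted {x} {y} ne with FinP.<-cmp x y
  ... | tri< p _ _ = x , y , inj₁ (refl , refl) , p
  ... | tri≈ _ p _ = ⊥-elim (ne p)
  ... | tri> _ _ p = y , x , inj₂ (refl , refl) , p

  Adj-SameChord : ∀ {x y a c : V n} → SameChord x y a c → Adj a c → Adj x y
  Adj-SameChord (inj₁ (refl , refl)) p = p
  Adj-SameChord (inj₂ (refl , refl)) p = Adj-sym p

  toTri : ∀ {T : DSet n} → IsTriangulation T → Tri T
  toTri {T} ((dg , ncr) , mxm) = record { nc = nc′ ; mx = mx′ ; diag = dg′ }
    where
    dg′ : ∀ {x y} → T ∋⟨ x , y ⟩ → x < y × ¬ Adj x y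
    dg′ {x} {y} t = IsDiag⇒< {x} {y} (dg x y t) , IsDiag⇒¬Adj {x} {y} (dg x y t)
    ncT : ∀ {x y k l} → T ∋⟨ x , y ⟩ → T ∋⟨ k , l ⟩ → ¬ X x y k l
    ncT t u cr = ncr _ _ _ _ t u (X⇒Crosses (proj₁ (dg′ t)) (proj₁ (dg′ u)) cr)
    nc₁ : ∀ {x y k l} → T ∋⟨ x , y ⟩ → E T k l → ¬ X x y k l
    nc₁ {x} {y} {k} {l} t (inj₁ a) cr = Adj-¬X a (X-sym {a = x} {y} {k} {l} cr)
    nc₁ t (inj₂ (inj₁ u)) cr = ncT t u cr
    nc₁ {x} {y} {k} {l} t (inj₂ (inj₂ u)) cr = ncT t u (X-swapʳ {a = x} {y} {k} {l} cr)
    nc′ : ∀ {x y k l} → E T x y → E T k l → ¬ X x y k l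
    nc′ (inj₁ a) u cr = Adj-¬X a cr
    nc′ (inj₂ (inj₁ t)) u cr = nc₁ t u cr
    nc′ {x} {y} {k} {l} (inj₂ (inj₂ t)) u cr = nc₁ t u (X-swapˡ {a = x} {y} {k} {l} cr)
    mx′ : ∀ {x y} → ¬ E T x y → ∃₂ λ k l → E T k l × X x y k l
    mx′ {x} {y} ne with sorted {x} {y} (¬Adj⇒≢ (ne ∘′ inj₁))
    ... | i , j , s , i<j with mxm i j (¬Adj⇒IsDiag {i} {j} i<j (ne ∘′ inj₁ ∘′ Adj-SameChord (SameChord-sym s)))
                                 (λ t → ne (E-SameChord T (SameChord-sym s) (inj₂ (inj₁ t))))
    ...   | k , l , t , cr = k , l , inj₂ (inj₁ t) , X-SameChord (SameChord-sym s) (Crosses⇒X cr)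

  fromTri : ∀ {T : DSet n} → Tri T → IsTriangulation T
  fromTri {T} tr = (dg , λ i j k l t u cr → nc tr (inj₂ (inj₁ t)) (inj₂ (inj₁ u)) (Crosses⇒X {i} {j} {k} {l} cr)) , mxm
    where
    dg : ∀ i j → T ∋⟨ i , j ⟩ → IsDiag i j
    dg i j t = ¬Adj⇒IsDiag {i} {j} (proj₁ (diag tr t)) (proj₂ (diag tr t))
    mxm : ∀ i j → IsDiag i j → ¬ T ∋⟨ i , j ⟩ → ∃[ k ] ∃[ l ] (T ∋⟨ k , l ⟩ × Crosses i j k l)
    mxm i j d nt with mx tr {i} {j} (λ { (inj₁ a) → IsDiag⇒¬Adj {i} {j} d a
                                       ; (inj₂ (inj₁ t)) → nt t
                                       ; (inj₂ (inj₂ t)) → ℕP.<-asym (proj₁ (diag tr t)) (IsDiag⇒< {i} {j} d) })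
    ... | k , l , inj₁ a , cr = ⊥-elim (Adj-¬X a (X-sym {a = i} {j} {k} {l} cr))
    ... | k , l , inj₂ (inj₁ t) , cr = k , l , t , X⇒Crosses (IsDiag⇒< {i} {j} d) (proj₁ (diag tr t)) cr
    ... | k , l , inj₂ (inj₂ t) , cr = l , k , t ,
            X⇒Crosses (IsDiag⇒< {i} {j} d) (proj₁ (diag tr t)) (X-swapʳ {a = i} {j} {k} {l} cr)

  ≡true-ext : ∀ {p q : Bool} → (p ≡ true → q ≡ true) → (q ≡ true → p ≡ true) → p ≡ q
  ≡true-ext {true}  f g = sym (f refl)
  ≡true-ext {false} {true}  f g = g refl
  ≡true-ext {false} {false} f g = refl

  DSet-ext : ∀ {S T : DSet n} → (∀ x y → entry S x y ≡ entry T x y) → S ≡ T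
  DSet-ext {S} {T} f = trans (sym (VecP.tabulate∘lookup S)) (trans (VecP.tabulate-cong row) (VecP.tabulate∘lookup T))
    where
    row : ∀ x → Vec.lookup S x ≡ Vec.lookup T x
    row x = trans (sym (VecP.tabulate∘lookup (Vec.lookup S x)))
              (trans (VecP.tabulate-cong (f x)) (VecP.tabulate∘lookup (Vec.lookup T x)))

  E⇒∋ : ∀ {T : DSet n} → Tri T → ∀ {x y} → x < y → ¬ Adj x y → E T x y → T ∋⟨ x , y ⟩
  E⇒∋ tr lt na (inj₁ a) = ⊥-elim (na a)
  E⇒∋ tr lt na (inj₂ (inj₁ t)) = t
  E⇒∋ tr lt na (inj₂ (inj₂ t)) = ⊥-elim (ℕP.<-asym lt (proj₁ (diag tr t)))

  ∋-mono : ∀ {S T : DSet n} → Tri S → Tri T → ∀ {x y} → (E S x y → E T x y) → S ∋⟨ x , y ⟩ → T ∋⟨ x , y ⟩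
  ∋-mono s t f m = E⇒∋ t (proj₁ (diag s m)) (proj₂ (diag s m)) (f (inj₂ (inj₁ m)))

  Tri-ext : ∀ {S T : DSet n} → Tri S → Tri T → (∀ {x y} → E S x y → E T x y) → (∀ {x y} → E T x y → E S x y) → S ≡ T
  Tri-ext s t f g = DSet-ext λ x y → ≡true-ext (∋-mono s t f) (∋-mono t s g)

  -- `E` of the table gives back `P`, so a new triangulation can be specified by a symmetric
  -- relation containing the polygon sides, and the table is never inspected again.
  module Make (P : V n → V n → Set) (P? : ∀ x y → Dec (P x y))
              (P-sym : ∀ {x y} → P x y → P y x) (Adj⇒P : ∀ {x y} → Adj x y → P x y) where

    Q? : ∀ x y → Dec (x < y × ¬ Adj x y × P x y)
    Q? x y = (x Fin.<? y) ×-dec ¬? (Adj? x y) ×-dec P? x y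

    table : DSet n
    table = Vec.tabulate λ x → Vec.tabulate λ y → does (Q? x y)

    table-entry : ∀ x y → entry table x y ≡ does (Q? x y)
    table-entry x y = trans (cong (λ r → Vec.lookup r y) (VecP.lookup∘tabulate _ x)) (VecP.lookup∘tabulate _ y)

    table⁻ : ∀ {x y} → table ∋⟨ x , y ⟩ → x < y × ¬ Adj x y × P x y
    table⁻ {x} {y} t = does⇒ (Q? x y) (trans (sym (table-entry x y)) t)

    E⇒P : ∀ {x y} → E table x y → P x y
    E⇒P (inj₁ a) = Adj⇒P a
    E⇒P (inj₂ (inj₁ t)) = proj₂ (proj₂ (table⁻ t))
    E⇒P (inj₂ (inj₂ t)) = P-sym (proj₂ (proj₂ (table⁻ t)))

    P⇒E : ∀ {x y} → P x y → E table x y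
    P⇒E {x} {y} p with Adj? x y
    ... | yes a = inj₁ a
    ... | no na with FinP.<-cmp x y
    ...   | tri< lt _ _ = inj₂ (inj₁ (trans (table-entry x y) (dec-true (Q? x y) (lt , na , p))))
    ...   | tri≈ _ refl _ = inj₁ Adj-refl
    ...   | tri> _ _ lt = inj₂ (inj₂ (trans (table-entry y x) (dec-true (Q? y x) (lt , na ∘′ Adj-sym , P-sym p))))

    table-Tri : (∀ {x y k l} → P x y → P k l → ¬ X x y k l) →
                (∀ {x y} → ¬ P x y → ∃₂ λ k l → P k l × X x y k l) → Tri table
    table-Tri nc′ mx′ = record
      { nc = λ p q → nc′ (E⇒P p) (E⇒P q)
      ; mx = λ np → let k , l , p , cr = mx′ (λ p → np (P⇒E p)) in k , l , P⇒E p , cr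
      ; diag = λ t → proj₁ (table⁻ t) , proj₁ (proj₂ (table⁻ t)) }

  -- `Flip` in terms of `E`. That the exchanged chords cross is not part of `Flip`; it is recorded
  -- here because nearly every later argument rests on it.
  record FlipE (T T′ : DSet n) (e₁ e₂ f₁ f₂ : V n) : Set where
    field
      cross : X e₁ e₂ f₁ f₂
      old   : E T e₁ e₂
      new   : E T′ f₁ f₂
      keep  : ∀ {x y} → E T x y → SameChord x y e₁ e₂ ⊎ E T′ x y
      back  : ∀ {x y} → E T′ x y → SameChord x y f₁ f₂ ⊎ E T x y
  open FlipE

  FlipE-rev : ∀ {T T′ : DSet n} {e₁ e₂ f₁ f₂ : V n} → FlipE T T′ e₁ e₂ f₁ f₂ → FlipE T′ T f₁ f₂ e₁ e₂
  FlipE-rev {e₁ = e₁} {e₂} {f₁} {f₂} f = record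
    { cross = X-sym {a = e₁} {e₂} {f₁} {f₂} (cross f) ; old = new f ; new = old f ; keep = back f ; back = keep f }

  FlipE-swap : ∀ {T T′ : DSet n} {e₁ e₂ f₁ f₂ : V n} → FlipE T T′ e₁ e₂ f₁ f₂ → FlipE T T′ e₁ e₂ f₂ f₁
  FlipE-swap {T′ = T′} {e₁} {e₂} {f₁} {f₂} f = record
    { cross = X-swapʳ {a = e₁} {e₂} {f₁} {f₂} (cross f) ; old = old f ; new = E-sym T′ (new f)
    ; keep = keep f ; back = Sum.map₁ SameChord-swapʳ ∘′ back f }

  FlipE-old : ∀ {T T′ : DSet n} {e₁ e₂ f₁ f₂ a c : V n} → SameChord a c e₁ e₂ → FlipE T T′ e₁ e₂ f₁ f₂ → FlipE T T′ a c f₁ f₂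
  FlipE-old {T} s f = record
    { cross = X-SameChord s (cross f) ; old = E-SameChord T s (old f) ; new = new f
    ; keep = Sum.map₁ (λ u → SameChord-trans u (SameChord-sym s)) ∘′ keep f ; back = back f }

  FlipE⇒ : ∀ {T T′ : DSet n} {e₁ e₂ f₁ f₂ : V n} → Tri T → Tri T′ → FlipE T T′ e₁ e₂ f₁ f₂ → Flip T T′
  FlipE⇒ {T} {T′} {e₁} {e₂} {f₁} {f₂} t t′ fl
    with sorted {e₁} {e₂} (¬Adj⇒≢ (X-≢ (cross fl))) | sorted {f₁} {f₂} (¬Adj⇒≢ (X-≢ (cross (FlipE-rev fl))))
  ... | i , j , s , i<j | k , l , u , k<l =
    i , j , k , l , E⇒∋ t i<j (X-≢ (cross fl) ∘′ Adj-SameChord (SameChord-sym s)) (E-SameChord T s (old fl))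
    , (λ m → nc t′ (E-SameChord T′ (SameChord-sym s) (inj₂ (inj₁ m))) (new fl) (cross fl))
    , E⇒∋ t′ k<l (X-≢ (cross (FlipE-rev fl)) ∘′ Adj-SameChord (SameChord-sym u)) (E-SameChord T′ u (new fl))
    , (λ m → nc t (E-SameChord T (SameChord-sym u) (inj₂ (inj₁ m))) (old fl) (cross (FlipE-rev fl)))
    , same
    where
    ordered : ∀ {x y a c a′ c′ : V n} → x < y → a < c → SameChord x y a′ c′ → SameChord a c a′ c′ → x ≡ a × y ≡ c
    ordered x<y a<c p q with SameChord-trans p (SameChord-sym q)
    ... | inj₁ r = r
    ... | inj₂ (refl , refl) = ⊥-elim (ℕP.<-asym x<y a<c)
    same : ∀ x y → (x ≡ i × y ≡ j) ⊎ (x ≡ k × y ≡ l) ⊎ (entry T x y ≡ entry T′ x y)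
    same x y with (x Fin.≟ i) ×-dec (y Fin.≟ j) | (x Fin.≟ k) ×-dec (y Fin.≟ l)
    ... | yes p | _ = inj₁ p
    ... | no _ | yes q = inj₂ (inj₁ q)
    ... | no ¬p | no ¬q = inj₂ (inj₂ (≡true-ext
            (λ m → ∋-mono t t′ (λ m′ → [ (λ p → ⊥-elim (¬p (ordered (proj₁ (diag t m)) i<j p s))) , (λ z → z) ]′ (keep fl m′)) m)
            (λ m → ∋-mono t′ t (λ m′ → [ (λ p → ⊥-elim (¬q (ordered (proj₁ (diag t′ m)) k<l p u))) , (λ z → z) ]′ (back fl m′)) m)))

  ⇒FlipE : ∀ {T T′ : DSet n} → Tri T → Tri T′ → Flip T T′ → ∃₂ λ e₁ e₂ → ∃₂ λ f₁ f₂ → FlipE T T′ e₁ e₂ f₁ f₂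
  ⇒FlipE {T} {T′} t t′ (i , j , k , l , m , m′ , u , u′ , same) = i , j , k , l , record
    { cross = cr ; old = inj₂ (inj₁ m) ; new = inj₂ (inj₁ u) ; keep = keep′ ; back = back′ }
    where
    kp : ∀ {x y} → T ∋⟨ x , y ⟩ → (x ≡ i × y ≡ j) ⊎ T′ ∋⟨ x , y ⟩
    kp {x} {y} z with same x y
    ... | inj₁ p = inj₁ p
    ... | inj₂ (inj₁ (refl , refl)) = ⊥-elim (u′ z)
    ... | inj₂ (inj₂ e) = inj₂ (trans (sym e) z)
    bk : ∀ {x y} → T′ ∋⟨ x , y ⟩ → (x ≡ k × y ≡ l) ⊎ T ∋⟨ x , y ⟩
    bk {x} {y} z with same x y
    ... | inj₁ (refl , refl) = ⊥-elim (m′ z)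
    ... | inj₂ (inj₁ p) = inj₁ p
    ... | inj₂ (inj₂ e) = inj₂ (trans e z)
    keep′ : ∀ {x y} → E T x y → SameChord x y i j ⊎ E T′ x y
    keep′ (inj₁ a) = inj₂ (inj₁ a)
    keep′ (inj₂ (inj₁ z)) = Sum.map inj₁ (inj₂ ∘′ inj₁) (kp z)
    keep′ (inj₂ (inj₂ z)) = Sum.map (inj₂ ∘′ swap) (inj₂ ∘′ inj₂) (kp z)
    back′ : ∀ {x y} → E T′ x y → SameChord x y k l ⊎ E T x y
    back′ (inj₁ a) = inj₂ (inj₁ a)
    back′ (inj₂ (inj₁ z)) = Sum.map inj₁ (inj₂ ∘′ inj₁) (bk z)
    back′ (inj₂ (inj₂ z)) = Sum.map (inj₂ ∘′ swap) (inj₂ ∘′ inj₂) (bk z)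
    ¬Eij : ¬ E T′ i j
    ¬Eij (inj₁ a) = proj₂ (diag t m) a
    ¬Eij (inj₂ (inj₁ z)) = m′ z
    ¬Eij (inj₂ (inj₂ z)) = ℕP.<-asym (proj₁ (diag t m)) (proj₁ (diag t′ z))
    cr : X i j k l
    -- By maximality of T′ some chord of it crosses the removed one. Every chord of T′ other than
    -- the new one was already in T, where the removed chord is uncrossed.
    cr with mx t′ ¬Eij
    ... | a , b , z , c with back′ z
    ...   | inj₁ s = X-sym {a = k} {l} {i} {j} (X-SameChord (SameChord-sym s) (X-sym {a = i} {j} {a} {b} c))
    ...   | inj₂ z′ = ⊥-elim (nc t (inj₂ (inj₁ m)) z′ c)

-- The cochain counting exchanges of two crossing chords

module _ {n : ℕ} where
  open Tri
  open FlipE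

  -- A chord of T crossing ab′ would cross ac or b′d′, which is impossible.  So ab′ lies in T,
  -- hence in T₀, although it crosses bd when b′ comes after b.
  private
    no-later : ∀ {T T₀ T₂ : DSet n} {a c b d b′ d′ : V n} → Tri T → Tri T₀ → Tri T₂ →
      FlipE T T₀ a c b d → FlipE T T₂ a c b′ d′ →
      B a b c → B c d a → B a b′ c → B c d′ a → ¬ B a b b′
    no-later {T} {T₀} {T₂} {a} {c} {b} {d} {b′} {d′} t t₀ t₂ f₀ f₂ abc cda ab′c cd′a abb′
      with E? T a b′
    ... | yes p = nc t₀ ([ (λ s → ⊥-elim (not-ac s)) , (λ z → z) ]′ (keep f₀ p)) (new f₀) crosses-bd
      where
      not-ac : ¬ SameChord a b′ a c
      not-ac = solve (B′ 0 2 1 ⇒′ (((0 ≡′ 0 ∧′ 2 ≡′ 1) ∨′ (0 ≡′ 1 ∧′ 2 ≡′ 0)) ⇒′ ⊥′)) 3 refl a (c ∷ b′ ∷ []) ab′c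
      crosses-bd : X a b′ b d
      crosses-bd = solve (B′ 0 1 2 ⇒′ B′ 2 3 0 ⇒′ B′ 0 4 2 ⇒′ B′ 0 1 4 ⇒′ X′ 0 4 1 3) 5 refl a (b ∷ c ∷ d ∷ b′ ∷ []) abc cda ab′c abb′
    ... | no ¬p with mx t ¬p
    ...   | k , l , q , cr = off-ac (λ s → nc-SameChord s) q
      where
      nc-SameChord : ¬ SameChord k l a c
      nc-SameChord = solve (X′ 0 2 3 4 ⇒′ (((3 ≡′ 0 ∧′ 4 ≡′ 1) ∨′ (3 ≡′ 1 ∧′ 4 ≡′ 0)) ⇒′ ⊥′)) 5 refl a (c ∷ b′ ∷ k ∷ l ∷ []) cr
      off-ac : ¬ SameChord k l a c → E T k l → ⊥
      off-ac ns q with keep f₂ q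
      ... | inj₁ s = ns s
      ... | inj₂ q₂ = solve (B′ 0 1 2 ⇒′ B′ 2 3 0 ⇒′ X′ 0 1 4 5 ⇒′ (X′ 4 5 0 2 ⇒′ ⊥′) ⇒′ (X′ 4 5 1 3 ⇒′ ⊥′) ⇒′ ⊥′) 6 refl
                        a (b′ ∷ c ∷ d′ ∷ k ∷ l ∷ []) ab′c cd′a cr (nc t q (old f₀)) (nc t₂ q₂ (new f₂))

    -- Were the chords different, b′d′ would be absent from T₀, and by maximality crossed there; the
    -- crossing chord can only be bd. As bd and b′d′ cross, one of b, b′ comes strictly later on the
    -- arc from a to c, which `no-later` forbids.
    same-oriented : ∀ {T T₀ T₂ : DSet n} {a c b d b′ d′ : V n} → Tri T → Tri T₀ → Tri T₂ →
      FlipE T T₀ a c b d → FlipE T T₂ a c b′ d′ →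
      B a b c → B c d a → B a b′ c → B c d′ a → SameChord b d b′ d′
    same-oriented {T} {T₀} {T₂} {a} {c} {b} {d} {b′} {d′} t t₀ t₂ f₀ f₂ abc cda ab′c cd′a =
      decidable-stable (SameChord? b d b′ d′) λ ns →
      let ¬g : ¬ E T₀ b′ d′
          ¬g z = [ (λ s → ns (SameChord-sym s)) , (λ z′ → nc t (old f₂) z′ (cross f₂)) ]′ (back f₀ z)
          k , l , z , cr = mx t₀ ¬g
          kl≡f : SameChord k l b d
          kl≡f = [ (λ s → s) , (λ z′ → ⊥-elim (
                   [ (λ s → nc t₀ (E-SameChord T₀ (SameChord-sym s) z) (new f₀) (cross f₀))
                   , (λ z₂ → nc t₂ (new f₂) z₂ cr) ]′ (keep f₂ z′))) ]′ (back f₀ z)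
          gf : X b d b′ d′
          gf = X-SameChord (SameChord-sym kl≡f) (X-sym {a = b′} {d′} {k} {l} cr)
      in [ no-later t t₀ t₂ f₀ f₂ abc cda ab′c cd′a , no-later t t₂ t₀ f₂ f₀ ab′c cd′a abc cda ]′
         (solve (B′ 0 1 2 ⇒′ B′ 2 3 0 ⇒′ B′ 0 4 2 ⇒′ B′ 2 5 0 ⇒′ X′ 1 3 4 5 ⇒′ (B′ 0 1 4 ∨′ B′ 0 4 1)) 6 refl
           a (b ∷ c ∷ d ∷ b′ ∷ d′ ∷ []) abc cda ab′c cd′a gf)

  -- The removed chord determines its replacement. The four cases only name the endpoints of both
  -- replacements so that they cross ac from the same side.
  flip-unique : ∀ {T T₀ T₂ : DSet n} {a c a′ c′ b d b′ d′ : V n} → Tri T → Tri T₀ → Tri T₂ →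
    FlipE T T₀ a c b d → FlipE T T₂ a′ c′ b′ d′ → SameChord a c a′ c′ → SameChord b d b′ d′
  flip-unique t t₀ t₂ f₀ f₂′ s with FlipE-old s f₂′
  ... | f₂ with cross f₀ | cross f₂
  ... | inj₁ (p , q) | inj₁ (p′ , q′) = same-oriented t t₀ t₂ f₀ f₂ p q p′ q′
  ... | inj₁ (p , q) | inj₂ (p′ , q′) = SameChord-swapʳ (same-oriented t t₀ t₂ f₀ (FlipE-swap f₂) p q p′ q′)
  ... | inj₂ (p , q) | inj₁ (p′ , q′) = SameChord-swapˡ (same-oriented t t₀ t₂ (FlipE-swap f₀) f₂ p q p′ q′)
  ... | inj₂ (p , q) | inj₂ (p′ , q′) = SameChord-swapˡ (SameChord-swapʳ (same-oriented t t₀ t₂ (FlipE-swap f₀) (FlipE-swap f₂) p q p′ q′))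

  -- If the second flip removed what the first inserted, then seen from T₁ both neighbours would
  -- arise by removing the same chord, and `flip-unique` would identify them.
  no-backtrack : ∀ {T₀ T₁ T₂ : DSet n} {e₁ e₂ f₁ f₂ g₁ g₂ h₁ h₂ : V n} → Tri T₀ → Tri T₁ → Tri T₂ → ¬ T₀ ≡ T₂ →
    FlipE T₀ T₁ e₁ e₂ f₁ f₂ → FlipE T₁ T₂ g₁ g₂ h₁ h₂ → ¬ SameChord f₁ f₂ g₁ g₂
  no-backtrack {T₀} {T₁} {T₂} {e₁} {e₂} {f₁} {f₂} {g₁} {g₂} {h₁} {h₂} t₀ t₁ t₂ ne F G s = ne (Tri-ext t₀ t₂ to from)
    where
    eh : SameChord e₁ e₂ h₁ h₂
    eh = flip-unique t₁ t₀ t₂ (FlipE-rev F) G s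
    to : ∀ {x y} → E T₀ x y → E T₂ x y
    to p with keep F p
    ... | inj₁ u = E-SameChord T₂ (SameChord-trans u eh) (new G)
    ... | inj₂ p₁ with keep G p₁
    ...   | inj₁ u = ⊥-elim (nc t₀ (old F) (E-SameChord T₀ (SameChord-sym (SameChord-trans u (SameChord-sym s))) p) (cross F))
    ...   | inj₂ p₂ = p₂
    from : ∀ {x y} → E T₂ x y → E T₀ x y
    from p with back G p
    ... | inj₁ u = E-SameChord T₀ (SameChord-trans u (SameChord-sym eh)) (old F)
    ... | inj₂ p₁ with back F p₁
    ...   | inj₁ u = ⊥-elim (nc t₂ (E-SameChord T₂ (SameChord-sym (SameChord-trans u s)) p) (new G) (cross G))
    ...   | inj₂ p₀ = p₀

  SomeFlip : DSet n → DSet n → Set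
  SomeFlip T T′ = ∃₂ λ e₁ e₂ → ∃₂ λ f₁ f₂ → FlipE T T′ e₁ e₂ f₁ f₂

  -- The chord inserted by the first flip survives the second, and the chord it removed must be in
  -- T₂ already, since otherwise the third flip and the first would backtrack. These two chords
  -- cross in T₂.
  no-triangle : ∀ {T₀ T₁ T₂ : DSet n} → Tri T₀ → Tri T₁ → Tri T₂ → ¬ T₀ ≡ T₂ → ¬ T₂ ≡ T₁ →
    SomeFlip T₀ T₁ → SomeFlip T₁ T₂ → SomeFlip T₂ T₀ → ⊥
  no-triangle {T₀} t₀ t₁ t₂ ne ne′ (e₁ , e₂ , f₁ , f₂ , F) (g₁ , g₂ , h₁ , h₂ , G) (i₁ , i₂ , j₁ , j₂ , H)
    with keep G (new F)
  ... | inj₁ s = no-backtrack t₀ t₁ t₂ ne F G s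
  ... | inj₂ f∈T₂ with back H (old F)
  ...   | inj₁ s = no-backtrack t₂ t₀ t₁ ne′ H F (SameChord-sym s)
  ...   | inj₂ e∈T₂ = nc t₂ e∈T₂ f∈T₂ (cross F)

  -- The chord f inserted by the first flip cannot be removed by the second. If the third spared it
  -- too, it would meet in T₃ the chord e that the first flip removes, which is there because the
  -- fourth flip cannot insert it; but e and f cross.
  square-opposite : ∀ {T₀ T₁ T₂ T₃ : DSet n} {e₁ e₂ f₁ f₂ g₁ g₂ h₁ h₂ i₁ i₂ j₁ j₂ k₁ k₂ l₁ l₂ : V n} →
    Tri T₀ → Tri T₁ → Tri T₂ → Tri T₃ → ¬ T₀ ≡ T₂ → ¬ T₃ ≡ T₁ →
    FlipE T₀ T₁ e₁ e₂ f₁ f₂ → FlipE T₁ T₂ g₁ g₂ h₁ h₂ → FlipE T₂ T₃ i₁ i₂ j₁ j₂ → FlipE T₃ T₀ k₁ k₂ l₁ l₂ →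
    SameChord f₁ f₂ i₁ i₂
  square-opposite t₀ t₁ t₂ t₃ ne ne′ F G H K with keep G (new F)
  ... | inj₁ s = ⊥-elim (no-backtrack t₀ t₁ t₂ ne F G s)
  ... | inj₂ f∈T₂ with keep H f∈T₂
  ...   | inj₁ s = s
  ...   | inj₂ f∈T₃ with back K (old F)
  ...     | inj₁ s = ⊥-elim (no-backtrack t₃ t₀ t₁ ne′ K F (SameChord-sym s))
  ...     | inj₂ e∈T₃ = ⊥-elim (nc t₃ e∈T₃ f∈T₃ (cross F))

-- Pairing antisymmetric functions of edges with chains

⟪_⟫ : ∀ {A : Set} → Dec A → ℤ
⟪ d ⟫ = if does d then + 1 else + 0

⟪⟫-cong : ∀ {A A′ : Set} (d : Dec A) (d′ : Dec A′) → (A → A′) → (A′ → A) → ⟪ d ⟫ ≡ ⟪ d′ ⟫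
⟪⟫-cong (yes a) (yes b) f g = refl
⟪⟫-cong (yes a) (no b) f g = ⊥-elim (b (f a))
⟪⟫-cong (no a) (yes b) f g = ⊥-elim (a (g b))
⟪⟫-cong (no a) (no b) f g = refl

⟪⟫-true : ∀ {A : Set} (d : Dec A) → A → ⟪ d ⟫ ≡ + 1
⟪⟫-true d a = cong (λ b → if b then + 1 else + 0) (dec-true d a)

⟪⟫-false : ∀ {A : Set} (d : Dec A) → ¬ A → ⟪ d ⟫ ≡ + 0
⟪⟫-false d a = cong (λ b → if b then + 1 else + 0) (dec-false d a)

pairing : ∀ {n} → (DSet n → DSet n → ℤ) → Chain n → ℤ
pairing φ [] = + 0
pairing φ ((c , x , y) ∷ ch) = c ℤ.* φ x y ℤ.+ pairing φ ch

pairing-++ : ∀ {n} φ (c d : Chain n) → pairing φ (c ++ d) ≡ pairing φ c ℤ.+ pairing φ d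
pairing-++ φ [] d = sym (ℤP.+-identityˡ _)
pairing-++ φ ((c , x , y) ∷ ch) d = trans (cong (ℤ._+_ (c ℤ.* φ x y)) (pairing-++ φ ch d)) (sym (ℤP.+-assoc (c ℤ.* φ x y) _ _))

pairing-scale : ∀ {n} φ a (c : Chain n) → pairing φ (scale a c) ≡ a ℤ.* pairing φ c
pairing-scale φ a [] = sym (ℤP.*-zeroʳ a)
pairing-scale φ a ((c , x , y) ∷ ch) = trans (cong₂ ℤ._+_ (ℤP.*-assoc a c (φ x y)) (pairing-scale φ a ch))
  (sym (ℤP.*-distribˡ-+ a (c ℤ.* φ x y) _))

edge : ∀ {n} (x y a b : DSet n) → ℤ → ℤ
edge x y a b c = if does (x ≟D a) ∧ does (y ≟D b) then c
                 else if does (x ≟D b) ∧ does (y ≟D a) then ℤ.- c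
                 else + 0

coeff-++ : ∀ {n} (c d : Chain n) a b → coeff (c ++ d) a b ≡ coeff c a b ℤ.+ coeff d a b
coeff-++ [] d a b = sym (ℤP.+-identityˡ _)
coeff-++ ((c , x , y) ∷ ch) d a b = trans (cong (ℤ._+_ (edge x y a b c)) (coeff-++ ch d a b)) (sym (ℤP.+-assoc (edge x y a b c) _ _))

edge-scale : ∀ {n} (x y a b : DSet n) k c → edge x y a b (k ℤ.* c) ≡ k ℤ.* edge x y a b c
edge-scale x y a b k c with does (x ≟D a) ∧ does (y ≟D b) | does (x ≟D b) ∧ does (y ≟D a)
... | true | _ = refl
... | false | true = ℤP.neg-distribʳ-* k c
... | false | false = sym (ℤP.*-zeroʳ k)

coeff-scale : ∀ {n} k (c : Chain n) a b → coeff (scale k c) a b ≡ k ℤ.* coeff c a b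
coeff-scale k [] a b = sym (ℤP.*-zeroʳ k)
coeff-scale k ((c , x , y) ∷ ch) a b = trans (cong₂ ℤ._+_ (edge-scale x y a b k c) (coeff-scale k ch a b))
  (sym (ℤP.*-distribˡ-+ k (edge x y a b c) _))

module _ {n : ℕ} (φ : DSet n → DSet n → ℤ) (φ-anti : ∀ x y → φ y x ≡ ℤ.- φ x y) where

  private
    SameEdge : (u v x y : DSet n) → Set
    SameEdge u v x y = (u ≡ x × v ≡ y) ⊎ (u ≡ y × v ≡ x)

    sameEdge? : ∀ u v x y → Dec (SameEdge u v x y)
    sameEdge? u v x y = (u ≟D x ×-dec v ≟D y) ⊎-dec (u ≟D y ×-dec v ≟D x)

    remove : (x y : DSet n) → Chain n → Chain n
    remove x y [] = []
    remove x y ((c , u , v) ∷ ch) with sameEdge? u v x y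
    ... | yes _ = remove x y ch
    ... | no  _ = (c , u , v) ∷ remove x y ch

    edge-no : ∀ u v x y c → ¬ SameEdge u v x y → edge u v x y c ≡ + 0
    edge-no u v x y c ne with u ≟D x | v ≟D y | u ≟D y | v ≟D x
    ... | yes p | yes q | _ | _ = ⊥-elim (ne (inj₁ (p , q)))
    ... | yes p | no q | yes r | yes s = ⊥-elim (ne (inj₂ (r , s)))
    ... | yes p | no q | yes r | no s = refl
    ... | yes p | no q | no r | _ = refl
    ... | no p | _ | yes r | yes s = ⊥-elim (ne (inj₂ (r , s)))
    ... | no p | _ | yes r | no s = refl
    ... | no p | _ | no r | _ = refl

    neg-φ : ∀ x y c → ℤ.- c ℤ.* φ x y ≡ c ℤ.* φ y x
    neg-φ x y c = trans (sym (ℤP.neg-distribˡ-* c (φ x y)))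
      (trans (ℤP.neg-distribʳ-* c (φ x y)) (cong (ℤ._*_ c) (sym (φ-anti x y))))

    edge-φ : ∀ u v x y c → SameEdge u v x y → edge u v x y c ℤ.* φ x y ≡ c ℤ.* φ u v
    edge-φ u v x y c s with u ≟D x | v ≟D y | u ≟D y | v ≟D x
    ... | yes refl | yes refl | _ | _ = refl
    ... | no p | _ | yes refl | yes refl = neg-φ x y c
    ... | yes _ | no p | yes refl | yes refl = neg-φ x y c
    edge-φ u v x y c (inj₁ (p , q)) | no ¬p | _ | no _ | _ = ⊥-elim (¬p p)
    edge-φ u v x y c (inj₁ (p , q)) | no ¬p | _ | yes _ | no _ = ⊥-elim (¬p p)
    edge-φ u v x y c (inj₁ (p , q)) | yes _ | no ¬q | no _ | _ = ⊥-elim (¬q q)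
    edge-φ u v x y c (inj₁ (p , q)) | yes _ | no ¬q | yes _ | no _ = ⊥-elim (¬q q)
    edge-φ u v x y c (inj₂ (p , q)) | no _ | _ | no ¬p | _ = ⊥-elim (¬p p)
    edge-φ u v x y c (inj₂ (p , q)) | no _ | _ | yes _ | no ¬q = ⊥-elim (¬q q)
    edge-φ u v x y c (inj₂ (p , q)) | yes _ | no _ | no ¬p | _ = ⊥-elim (¬p p)
    edge-φ u v x y c (inj₂ (p , q)) | yes _ | no _ | yes _ | no ¬q = ⊥-elim (¬q q)

    remove-length : ∀ x y ch → length (remove x y ch) ℕ.≤ length ch
    remove-length x y [] = z≤n
    remove-length x y ((c , u , v) ∷ ch) with sameEdge? u v x y
    ... | yes _ = ℕP.m≤n⇒m≤1+n (remove-length x y ch)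
    ... | no  _ = s≤s (remove-length x y ch)

    remove-pairing : ∀ x y ch → pairing φ ch ≡ coeff ch x y ℤ.* φ x y ℤ.+ pairing φ (remove x y ch)
    remove-pairing x y [] = refl
    remove-pairing x y ((c , u , v) ∷ ch) with sameEdge? u v x y
    ... | yes s = trans (cong₂ ℤ._+_ (sym (edge-φ u v x y c s)) (remove-pairing x y ch))
           (trans (sym (ℤP.+-assoc (edge u v x y c ℤ.* φ x y) _ _))
             (cong (ℤ._+ pairing φ (remove x y ch)) (sym (ℤP.*-distribʳ-+ (φ x y) (edge u v x y c) (coeff ch x y)))))
    ... | no ¬s = trans (cong (ℤ._+_ (c ℤ.* φ u v)) (remove-pairing x y ch)) (trans (swap₃ (c ℤ.* φ u v) (coeff ch x y ℤ.* φ x y) (pairing φ (remove x y ch)))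
          (cong (λ z → z ℤ.* φ x y ℤ.+ (c ℤ.* φ u v ℤ.+ pairing φ (remove x y ch)))
            (sym (trans (cong (ℤ._+ coeff ch x y) (edge-no u v x y c ¬s)) (ℤP.+-identityˡ (coeff ch x y))))))
      where swap₃ : ∀ a b c → a ℤ.+ (b ℤ.+ c) ≡ b ℤ.+ (a ℤ.+ c)
            swap₃ = ℤSolver.solve-∀

    remove-same : ∀ x y a b ch → SameEdge a b x y → coeff (remove x y ch) a b ≡ + 0
    remove-same x y a b [] s = refl
    remove-same x y a b ((c , u , v) ∷ ch) s with sameEdge? u v x y
    ... | yes _ = remove-same x y a b ch s
    ... | no ¬p = trans (cong₂ ℤ._+_ (edge-no u v a b c (λ p → ¬p (comp p s))) (remove-same x y a b ch s)) refl
      where comp : SameEdge u v a b → SameEdge a b x y → SameEdge u v x y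
            comp (inj₁ (refl , refl)) r = r
            comp (inj₂ (refl , refl)) (inj₁ (refl , refl)) = inj₂ (refl , refl)
            comp (inj₂ (refl , refl)) (inj₂ (refl , refl)) = inj₁ (refl , refl)

    remove-other : ∀ x y a b ch → ¬ SameEdge a b x y → coeff (remove x y ch) a b ≡ coeff ch a b
    remove-other x y a b [] s = refl
    remove-other x y a b ((c , u , v) ∷ ch) ¬s with sameEdge? u v x y
    ... | no ¬p = cong (ℤ._+_ (edge u v a b c)) (remove-other x y a b ch ¬s)
    ... | yes p = trans (remove-other x y a b ch ¬s)
          (sym (trans (cong (ℤ._+ coeff ch a b) (edge-no u v a b c (λ q → ¬s (comp p q)))) (ℤP.+-identityˡ _)))
      where comp : SameEdge u v x y → SameEdge u v a b → SameEdge a b x y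
            comp r (inj₁ (refl , refl)) = r
            comp (inj₁ (refl , refl)) (inj₂ (refl , refl)) = inj₂ (refl , refl)
            comp (inj₂ (refl , refl)) (inj₂ (refl , refl)) = inj₁ (refl , refl)

    -- Homology compares coefficients, whereas `pairing` reads the list. Each round strips every
    -- occurrence of the leading edge in either direction; by antisymmetry these contribute its
    -- coefficient times φ, hence 0, and the list gets shorter.
    pairing-zero′ : ∀ m ch → length ch ℕ.≤ m → (∀ a b → coeff ch a b ≡ + 0) → pairing φ ch ≡ + 0
    pairing-zero′ m [] _ _ = refl
    pairing-zero′ (suc m) ch@((c , x , y) ∷ r) (s≤s le) z = trans (remove-pairing x y ch)
      (trans (cong (λ w → w ℤ.* φ x y ℤ.+ pairing φ (remove x y ch)) (z x y))
        (trans (ℤP.+-identityˡ _) (pairing-zero′ m (remove x y ch) (ℕP.≤-trans shorter le) zero′)))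
      where
      shorter : length (remove x y ch) ℕ.≤ length r
      shorter with sameEdge? x y x y
      ... | yes _ = remove-length x y r
      ... | no ¬p = ⊥-elim (¬p (inj₁ (refl , refl)))
      zero′ : ∀ a b → coeff (remove x y ch) a b ≡ + 0
      zero′ a b with sameEdge? a b x y
      ... | yes s = remove-same x y a b ch s
      ... | no ¬s = trans (remove-other x y a b ch ¬s) (z a b)

  pairing-zero : ∀ ch → (∀ a b → coeff ch a b ≡ + 0) → pairing φ ch ≡ + 0
  pairing-zero ch = pairing-zero′ (length ch) ch ℕP.≤-refl

  pairing-linear : ∀ k c c′ → (∀ a b → coeff c a b ≡ k ℤ.* coeff c′ a b) → pairing φ c ≡ k ℤ.* pairing φ c′
  pairing-linear k c c′ h = ℤP.i-j≡0⇒i≡j _ _ (trans (sym (trans (pairing-++ φ c _)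
      (cong (ℤ._+_ (pairing φ c)) (trans (pairing-scale φ (ℤ.- k) c′) (sym (ℤP.neg-distribˡ-* k _))))))
      (pairing-zero (c ++ scale (ℤ.- k) c′) λ a b → trans (coeff-++ c _ a b)
        (trans (cong₂ ℤ._+_ (h a b) (trans (coeff-scale (ℤ.- k) c′ a b) (sym (ℤP.neg-distribˡ-* k (coeff c′ a b)))))
          (ℤP.+-inverseʳ (k ℤ.* coeff c′ a b)))))

  pairing-homologous : (∀ β → pairing φ (∂₂ β) ≡ + 0) → ∀ {c c′} → Homologous c c′ → pairing φ c ≡ pairing φ c′
  pairing-homologous vanish {c} {c′} (β , h) = ℤP.i-j≡0⇒i≡j _ _
    (trans (sym (trans (pairing-++ φ c (neg c′)) (cong (ℤ._+_ (pairing φ c)) (trans (pairing-scale φ (ℤ.- (+ 1)) c′) (ℤP.-1*i≡-i (pairing φ c′))))))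
      (trans (pairing-linear (+ 1) (c ++ neg c′) (∂₂ β) λ a b → trans (coeff-++ c _ a b)
         (trans (cong (ℤ._+_ (coeff c a b)) (trans (coeff-scale (ℤ.- (+ 1)) c′ a b) (ℤP.-1*i≡-i (coeff c′ a b)))) (trans (h a b) (sym (ℤP.*-identityˡ _)))))
       (trans (ℤP.*-identityˡ _) (vanish β))))

module _ {n : ℕ} (α₁ α₂ β₁ β₂ : V n) (αβ : X α₁ α₂ β₁ β₂) where
  open Tri
  open FlipE

  -- Testing membership is enough: as α and β cross, a flip with α before it and β after it must
  -- exchange exactly these two (`via-flip`).
  swaps : DSet n → DSet n → ℤ
  swaps T T′ = ⟪ E? T α₁ α₂ ×-dec E? T′ β₁ β₂ ⟫ ℤ.- ⟪ E? T β₁ β₂ ×-dec E? T′ α₁ α₂ ⟫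

  swaps-anti : ∀ T T′ → swaps T′ T ≡ ℤ.- swaps T T′
  swaps-anti T T′ = trans (cong₂ ℤ._-_ (⟪⟫-cong (E? T′ α₁ α₂ ×-dec E? T β₁ β₂) (E? T β₁ β₂ ×-dec E? T′ α₁ α₂) swap swap)
      (⟪⟫-cong (E? T′ β₁ β₂ ×-dec E? T α₁ α₂) (E? T α₁ α₂ ×-dec E? T′ β₁ β₂) swap swap))
      (flip ⟪ E? T β₁ β₂ ×-dec E? T′ α₁ α₂ ⟫ ⟪ E? T α₁ α₂ ×-dec E? T′ β₁ β₂ ⟫)
    where flip : ∀ a b → a ℤ.- b ≡ ℤ.- (b ℤ.- a)
          flip = ℤSolver.solve-∀

  private
    via-flip : ∀ {T T′ : DSet n} {e₁ e₂ f₁ f₂ γ₁ γ₂ δ₁ δ₂ : V n} → Tri T → Tri T′ → FlipE T T′ e₁ e₂ f₁ f₂ → X γ₁ γ₂ δ₁ δ₂ →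
      E T γ₁ γ₂ × E T′ δ₁ δ₂ → SameChord γ₁ γ₂ e₁ e₂ × SameChord δ₁ δ₂ f₁ f₂
    via-flip t t′ F cr (p , q) = [ (λ s → s) , (λ p′ → ⊥-elim (nc t′ p′ q cr)) ]′ (keep F p)
                              , [ (λ s → s) , (λ q′ → ⊥-elim (nc t p q′ cr)) ]′ (back F q)

    reversed : ∀ {T₀ T₁ T₂ T₃ : DSet n} {e₁ e₂ f₁ f₂ g₁ g₂ h₁ h₂ γ₁ γ₂ δ₁ δ₂ : V n} → Tri T₀ → Tri T₁ →
      FlipE T₀ T₁ e₁ e₂ f₁ f₂ → FlipE T₂ T₃ g₁ g₂ h₁ h₂ → SameChord f₁ f₂ g₁ g₂ → SameChord h₁ h₂ e₁ e₂ → X γ₁ γ₂ δ₁ δ₂ →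
      E T₀ γ₁ γ₂ × E T₁ δ₁ δ₂ → E T₂ δ₁ δ₂ × E T₃ γ₁ γ₂
    reversed {T₂ = T₂} {T₃} t₀ t₁ F G fg he cr pq with via-flip t₀ t₁ F cr pq
    ... | s , u = E-SameChord T₂ (SameChord-trans u fg) (old G) , E-SameChord T₃ (SameChord-trans s (SameChord-sym he)) (new G)

    βα : X β₁ β₂ α₁ α₂
    βα = X-sym {a = α₁} {α₂} {β₁} {β₂} αβ

    opposite : ∀ {T₀ T₁ T₂ T₃ : DSet n} {e₁ e₂ f₁ f₂ g₁ g₂ h₁ h₂ : V n} → Tri T₀ → Tri T₁ → Tri T₂ → Tri T₃ →
      FlipE T₀ T₁ e₁ e₂ f₁ f₂ → FlipE T₂ T₃ g₁ g₂ h₁ h₂ → SameChord f₁ f₂ g₁ g₂ → SameChord h₁ h₂ e₁ e₂ →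
      swaps T₂ T₃ ≡ ℤ.- swaps T₀ T₁
    opposite {T₀} {T₁} {T₂} {T₃} t₀ t₁ t₂ t₃ F G fg he = trans (cong₂ ℤ._-_
        (⟪⟫-cong (E? T₂ α₁ α₂ ×-dec E? T₃ β₁ β₂) (E? T₀ β₁ β₂ ×-dec E? T₁ α₁ α₂)
          (reversed t₂ t₃ G F he fg αβ) (reversed t₀ t₁ F G fg he βα))
        (⟪⟫-cong (E? T₂ β₁ β₂ ×-dec E? T₃ α₁ α₂) (E? T₀ α₁ α₂ ×-dec E? T₁ β₁ β₂)
          (reversed t₂ t₃ G F he fg βα) (reversed t₀ t₁ F G fg he αβ)))
        (flip ⟪ E? T₀ β₁ β₂ ×-dec E? T₁ α₁ α₂ ⟫ ⟪ E? T₀ α₁ α₂ ×-dec E? T₁ β₁ β₂ ⟫)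
      where flip : ∀ a b → a ℤ.- b ≡ ℤ.- (b ℤ.- a)
            flip = ℤSolver.solve-∀

  swaps-square : ∀ {T₀ T₁ T₂ T₃ : DSet n} → Tri T₀ → Tri T₁ → Tri T₂ → Tri T₃ → ¬ T₀ ≡ T₂ → ¬ T₃ ≡ T₁ →
    SomeFlip T₀ T₁ → SomeFlip T₁ T₂ → SomeFlip T₂ T₃ → SomeFlip T₃ T₀ →
    + 1 ℤ.* swaps T₀ T₁ ℤ.+ (+ 1 ℤ.* swaps T₁ T₂ ℤ.+ (+ 1 ℤ.* swaps T₂ T₃ ℤ.+ (+ 1 ℤ.* swaps T₃ T₀ ℤ.+ + 0))) ≡ + 0
  swaps-square {T₀} {T₁} {T₂} {T₃} t₀ t₁ t₂ t₃ ne₀₂ ne₃₁ (_ , _ , _ , _ , F) (_ , _ , _ , _ , G) (_ , _ , _ , _ , H) (_ , _ , _ , _ , K) =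
    trans (cong₂ (λ u v → + 1 ℤ.* swaps T₀ T₁ ℤ.+ (+ 1 ℤ.* swaps T₁ T₂ ℤ.+ (+ 1 ℤ.* u ℤ.+ (+ 1 ℤ.* v ℤ.+ + 0))))
            (opposite t₀ t₁ t₂ t₃ F H (square-opposite t₀ t₁ t₂ t₃ ne₀₂ ne₃₁ F G H K)
                      (square-opposite t₂ t₃ t₀ t₁ (λ e → ne₀₂ (sym e)) (λ e → ne₃₁ (sym e)) H K F G))
            (opposite t₁ t₂ t₃ t₀ G K (square-opposite t₁ t₂ t₃ t₀ (λ e → ne₃₁ (sym e)) ne₀₂ G H K F)
                      (square-opposite t₃ t₀ t₁ t₂ ne₃₁ (λ e → ne₀₂ (sym e)) K F G H)))
          (cancel (swaps T₀ T₁) (swaps T₁ T₂))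
    where
    cancel : ∀ a b → + 1 ℤ.* a ℤ.+ (+ 1 ℤ.* b ℤ.+ (+ 1 ℤ.* ℤ.- a ℤ.+ (+ 1 ℤ.* ℤ.- b ℤ.+ + 0))) ≡ + 0
    cancel = ℤSolver.solve-∀

  swaps-cell : ∀ (σ : TwoCell n) → pairing swaps (cycleChain (TwoCell.cyc σ)) ≡ + 0
  swaps-cell record { k = _ ; k-ok = inj₁ refl ; cyc = record { w = w ; w-tri = tr ; w-inj = inj ; w-adj = adj } } =
    ⊥-elim (no-triangle (t 0F) (t 1F) (t 2F) (λ e → case inj 0F 2F e of λ ()) (λ e → case inj 2F 1F e of λ ())
      (⇒FlipE (t 0F) (t 1F) (adj 0F)) (⇒FlipE (t 1F) (t 2F) (adj 1F)) (⇒FlipE (t 2F) (t 0F) (adj 2F)))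
    where
    t : ∀ p → Tri (w p)
    t p = toTri (tr p)
  swaps-cell record { k = _ ; k-ok = inj₂ refl ; cyc = record { w = w ; w-tri = tr ; w-inj = inj ; w-adj = adj } } =
    swaps-square (t 0F) (t 1F) (t 2F) (t 3F) (λ e → case inj 0F 2F e of λ ()) (λ e → case inj 3F 1F e of λ ())
      (⇒FlipE (t 0F) (t 1F) (adj 0F)) (⇒FlipE (t 1F) (t 2F) (adj 1F))
      (⇒FlipE (t 2F) (t 3F) (adj 2F)) (⇒FlipE (t 3F) (t 0F) (adj 3F))
    where
    t : ∀ p → Tri (w p)
    t p = toTri (tr p)

  swaps-∂₂ : ∀ β → pairing swaps (∂₂ β) ≡ + 0
  swaps-∂₂ [] = refl
  swaps-∂₂ ((a , σ) ∷ β) = trans (pairing-++ swaps (scale a (cycleChain (TwoCell.cyc σ))) (∂₂ β))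
    (cong₂ ℤ._+_ (trans (pairing-scale swaps a (cycleChain (TwoCell.cyc σ))) (trans (cong (ℤ._*_ a) (swaps-cell σ)) (ℤP.*-zeroʳ a))) (swaps-∂₂ β))

-- Flip connectivity

module _ {A : Set} {P Q : A → Set} (P? : ∀ x → Dec (P x)) (Q? : ∀ x → Dec (Q x)) (P⇒Q : ∀ {x} → P x → Q x) where

  count-≤ : ∀ xs → length (filter P? xs) ℕ.≤ length (filter Q? xs)
  count-≤ [] = z≤n
  count-≤ (x ∷ xs) with P? x | Q? x
  ... | yes p | yes q = s≤s (count-≤ xs)
  ... | yes p | no ¬q = ⊥-elim (¬q (P⇒Q p))
  ... | no ¬p | yes q = ℕP.m≤n⇒m≤1+n (count-≤ xs)
  ... | no ¬p | no ¬q = count-≤ xs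

  -- Gives the strict decrease of the termination measures behind `last-before`, `reach` and
  -- `connect`.
  count-< : ∀ {x xs} → x ∈ xs → Q x → ¬ P x → length (filter P? xs) ℕ.< length (filter Q? xs)
  count-< {x} {y ∷ xs} m q ¬p with P? y | Q? y
  count-< (here refl) q ¬p | yes p | _ = ⊥-elim (¬p p)
  count-< (here refl) q ¬p | no _ | no ¬q = ⊥-elim (¬q q)
  count-< {xs = _ ∷ xs} (here refl) q ¬p | no _ | yes _ = s≤s (count-≤ xs)
  count-< (there m) q ¬p | yes _ | yes _ = s≤s (count-< m q ¬p)
  count-< (there m) q ¬p | yes p | no ¬q = ⊥-elim (¬q (P⇒Q p))
  count-< (there m) q ¬p | no _ | yes _ = ℕP.m<n⇒m<1+n (count-< m q ¬p)
  count-< (there m) q ¬p | no _ | no _ = count-< m q ¬p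

pairs : ∀ N → List (Fin N × Fin N)
pairs N = cartesianProduct (allFin N) (allFin N)

∈-pairs : ∀ {N} (x y : Fin N) → (x , y) ∈ pairs N
∈-pairs x y = ∈-cartesianProduct⁺ (∈-allFin x) (∈-allFin y)

module _ {N : ℕ} {Q : Fin N → Set} (Q? : ∀ x → Dec (Q x)) (a b : Fin N) where

  last-before : ∀ p → B a p b → Q p → ∃ λ p → B a p b × Q p × (∀ k → B p k b → ¬ Q k)
  last-before p₀ = go _ p₀ ℕP.≤-refl
    where
    go : ∀ m p → length (filter (λ k → B? p k b) (allFin N)) ℕ.≤ m → B a p b → Q p →
         ∃ λ p → B a p b × Q p × (∀ k → B p k b → ¬ Q k)
    go m p le apb q with FinP.any? (λ k → B? p k b ×-dec Q? k)
    ... | no ¬e = p , apb , q , λ k pkb qk → ¬e (k , pkb , qk)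
    ... | yes (k , pkb , qk) with ℕP.<-≤-trans fewer le
      where
      fewer : length (filter (λ x → B? k x b) (allFin N)) ℕ.< length (filter (λ x → B? p x b) (allFin N))
      fewer = count-< (λ x → B? k x b) (λ x → B? p x b)
        (λ {x} → solve (B′ 0 1 2 ⇒′ B′ 1 3 2 ⇒′ B′ 0 3 2) 4 refl p (k ∷ b ∷ x ∷ []) pkb)
        (∈-allFin k) pkb (solve (B′ 0 0 1 ⇒′ ⊥′) 2 refl k (b ∷ []))
    go (suc m) p le apb q | yes (k , pkb , qk) | s≤s le′ =
      go m k le′ (solve (B′ 0 1 3 ⇒′ B′ 1 2 3 ⇒′ B′ 0 2 3) 4 refl a (p ∷ k ∷ b ∷ []) apb pkb) qk

B-rotate : ∀ {N} {a b c : Fin N} → B a b c → B b c a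
B-rotate {a = a} {b} {c} = solve (B′ 0 1 2 ⇒′ B′ 1 2 0) 3 refl a (b ∷ c ∷ [])

X⇒B : ∀ {N} {a b k l : Fin N} → X a b k l → ∃ λ c → B a c b
X⇒B {k = k} (inj₁ (p , _)) = k , p
X⇒B {l = l} (inj₂ (p , _)) = l , p

module _ {n : ℕ} where
  open Tri
  open FlipE

  opaque
    last-neighbour : ∀ {T : DSet n} {a b k} → B a k b → ∃ λ p → B a p b × E T a p × (∀ k → B p k b → ¬ E T a k)
    last-neighbour {T} {a} {b} {k} akb with successor a
    -- The search starts at the successor s of a. It is joined to a by a polygon side, and it comes
    -- before b because some vertex k lies between a and b.
    ... | s , s≢a , empty = last-before {Q = E T a} (E? T a) a b s
      (solve (B′ 0 2 1 ⇒′ (3 ≡′ 0 ⇒′ ⊥′) ⇒′ (B′ 0 2 3 ⇒′ ⊥′) ⇒′ (B′ 0 1 3 ⇒′ ⊥′) ⇒′ B′ 0 3 1) 4 refl a (b ∷ k ∷ s ∷ [])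
        akb s≢a (empty k) (empty b)) (inj₁ (inj₁ empty))

    -- With r the last neighbour of p before q, suppose rq were missing. A chord crossing rq but
    -- neither pq nor pr has to start at p and end between r and q, contrary to the choice of r.
    apex : ∀ {T : DSet n} → Tri T → ∀ {p q k} → E T p q → B p k q → ∃ λ r → B p r q × E T p r × E T r q
    apex {T} t {p} {q} {k₀} pq pkq with last-neighbour {T} {p} {q} {k₀} pkq
    ... | r , prq , pr , maxr = r , prq , pr , decidable-stable (E? T r q) λ ¬rq →
      let k , l , kl , cr = mx t ¬rq in
      [ (λ { (refl , rlq) → maxr l rlq kl }) , (λ { (refl , rkq) → maxr k rkq (E-sym T kl) }) ]′
      (solve (B′ 0 2 1 ⇒′ X′ 2 1 3 4 ⇒′ (X′ 0 1 3 4 ⇒′ ⊥′) ⇒′ (X′ 0 2 3 4 ⇒′ ⊥′) ⇒′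
          ((3 ≡′ 0 ∧′ B′ 2 4 1) ∨′ (4 ≡′ 0 ∧′ B′ 2 3 1))) 5 refl p (q ∷ r ∷ k ∷ l ∷ [])
        prq cr (nc t pq kl) (nc t pr kl))

  module _ {T : DSet n} (t : Tri T) {a b c d : V n} (abc : B a b c) (cda : B c d a)
           (ab : E T a b) (bc : E T b c) (cd : E T c d) (da : E T d a) (ac : E T a c) where

    private
      P : V n → V n → Set
      P x y = SameChord x y b d ⊎ (E T x y × ¬ SameChord x y a c)

      P? : ∀ x y → Dec (P x y)
      P? x y = SameChord? x y b d ⊎-dec (E? T x y ×-dec ¬? (SameChord? x y a c))

      P-sym : ∀ {x y} → P x y → P y x
      P-sym = Sum.map SameChord-swapˡ (λ (p , ¬s) → E-sym T p , ¬s ∘′ SameChord-swapˡ)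

      ac-bd : X a c b d
      ac-bd = inj₁ (abc , cda)

      open Make P P? P-sym (λ ad → inj₂ (inj₁ ad , λ s → X-≢ ac-bd (Adj-SameChord (SameChord-sym s) ad)))

      -- A chord crossing bd enters the quadrilateral; as it crosses none of the four sides, it must
      -- run from corner to corner.
      bd-nc : ∀ {x y} → E T x y → X x y b d → SameChord x y a c
      bd-nc {x} {y} xy cr = solve (B′ 0 1 2 ⇒′ B′ 2 3 0 ⇒′ X′ 4 5 1 3 ⇒′ (X′ 4 5 0 1 ⇒′ ⊥′) ⇒′ (X′ 4 5 1 2 ⇒′ ⊥′) ⇒′
          (X′ 4 5 2 3 ⇒′ ⊥′) ⇒′ (X′ 4 5 3 0 ⇒′ ⊥′) ⇒′ ((4 ≡′ 0 ∧′ 5 ≡′ 2) ∨′ (4 ≡′ 2 ∧′ 5 ≡′ 0))) 6 refl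
          a (b ∷ c ∷ d ∷ x ∷ y ∷ []) abc cda cr (nc t xy ab) (nc t xy bc) (nc t xy cd) (nc t xy da)

      P-nc : ∀ {x y k l} → P x y → P k l → ¬ X x y k l
      P-nc {x} {y} {k} {l} (inj₁ s) (inj₁ u) cr = X-irrefl (SameChord-trans s (SameChord-sym u)) cr
      P-nc {x} {y} {k} {l} (inj₁ s) (inj₂ (z , ¬u)) cr =
        ¬u (bd-nc z (X-sym {a = b} {d} {k} {l} (X-SameChord (SameChord-sym s) cr)))
      P-nc {x} {y} {k} {l} (inj₂ (z , ¬u)) (inj₁ s) cr =
        ¬u (bd-nc z (X-sym {a = b} {d} {x} {y} (X-SameChord (SameChord-sym s) (X-sym {a = x} {y} {k} {l} cr))))
      P-nc (inj₂ (z , _)) (inj₂ (z′ , _)) cr = nc t z z′ cr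

      off : ∀ {x y : V n} → x ≡ b ⊎ x ≡ d → ¬ SameChord x y a c
      off {x} {y} = solve (B′ 0 1 2 ⇒′ B′ 2 3 0 ⇒′ (4 ≡′ 1 ∨′ 4 ≡′ 3) ⇒′ ((4 ≡′ 0 ∧′ 5 ≡′ 2) ∨′ (4 ≡′ 2 ∧′ 5 ≡′ 0)) ⇒′ ⊥′)
        6 refl a (b ∷ c ∷ d ∷ x ∷ y ∷ []) abc cda

      P-mx : ∀ {x y} → ¬ P x y → ∃₂ λ k l → P k l × X x y k l
      P-mx {x} {y} ¬p with SameChord? x y a c
      ... | yes s = b , d , inj₁ SameChord-refl , X-SameChord s ac-bd
      ... | no ¬s with mx t (λ z → ¬p (inj₂ (z , ¬s)))
      ...   | k , l , z , cr with SameChord? k l a c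
      ...     | no ¬u = k , l , inj₂ (z , ¬u) , cr
      -- The crossing chord found is ac, which is about to disappear. A substitute exists: xy meets
      -- the interior of the quadrilateral and is not bd, so it crosses bd or leaves through a side.
      ...     | yes u = pick (solve (B′ 0 1 2 ⇒′ B′ 2 3 0 ⇒′ X′ 4 5 0 2 ⇒′
                 ((((4 ≡′ 1 ∧′ 5 ≡′ 3) ∨′ (4 ≡′ 3 ∧′ 5 ≡′ 1))) ⇒′ ⊥′) ⇒′
                 (X′ 4 5 1 3 ∨′ X′ 4 5 1 0 ∨′ X′ 4 5 1 2 ∨′ X′ 4 5 3 2 ∨′ X′ 4 5 3 0)) 6 refl
                 a (b ∷ c ∷ d ∷ x ∷ y ∷ []) abc cda (X-sym {a = a} {c} {x} {y} (X-SameChord (SameChord-sym u) (X-sym {a = x} {y} {k} {l} cr)))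
                 (λ s → ¬p (inj₁ s)))
        where
        pick : X x y b d ⊎ X x y b a ⊎ X x y b c ⊎ X x y d c ⊎ X x y d a → ∃₂ λ k l → P k l × X x y k l
        pick (inj₁ w) = b , d , inj₁ SameChord-refl , w
        pick (inj₂ (inj₁ w)) = b , a , inj₂ (E-sym T ab , off (inj₁ refl)) , w
        pick (inj₂ (inj₂ (inj₁ w))) = b , c , inj₂ (bc , off (inj₁ refl)) , w
        pick (inj₂ (inj₂ (inj₂ (inj₁ w)))) = d , c , inj₂ (E-sym T cd , off (inj₂ refl)) , w
        pick (inj₂ (inj₂ (inj₂ (inj₂ w)))) = d , a , inj₂ (da , off (inj₂ refl)) , w

    opaque
      quadrilateral-flip : ∃ λ T′ → Tri T′ × FlipE T T′ a c b d
      quadrilateral-flip = table , table-Tri P-nc P-mx , record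
        { cross = ac-bd ; old = ac ; new = P⇒E (inj₁ SameChord-refl)
        ; keep = λ {x} {y} z → case SameChord? x y a c of λ { (yes s) → inj₁ s ; (no ¬s) → inj₂ (P⇒E (inj₂ (z , ¬s))) }
        ; back = λ z → Sum.map₂ proj₁ (E⇒P z) }

  opaque
    -- The triangle of T at a through which the segment ab leaves a has its third side pq crossing ab;
    -- flipping pq produces a chord at a, which does not cross ab.
    flip-towards : ∀ {T : DSet n} → Tri T → ∀ {a b} → ¬ E T a b →
      ∃ λ T′ → Tri T′ × ∃₂ λ p q → ∃ λ r → X p q a b × FlipE T T′ p q r a
    flip-towards {T} t {a} {b} ¬ab with mx t ¬ab
    ... | k , l , _ , cr with X⇒B {a = a} {b} {k} {l} cr
    ... | k′ , akb with last-neighbour {T} {a} {b} {k′} akb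
    ... | p , apb , ap , maxp with apex t {p} {a} {b} (E-sym T ap) (B-rotate apb)
    -- The apex q of the triangle on pa is a neighbour of a beyond p. By the choice of p it is not
    -- before b, and it is not b since ab is missing, so pq separates a from b.
    ... | q , pqa , pq , qa = flip-pq (solve (B′ 0 1 2 ⇒′ B′ 1 3 0 ⇒′ (B′ 1 3 2 ⇒′ ⊥′) ⇒′ (3 ≡′ 2 ⇒′ ⊥′) ⇒′ B′ 2 3 0) 4 refl
            a (p ∷ b ∷ q ∷ []) apb pqa (λ pqb → maxp q pqb (E-sym T qa)) (λ { refl → ¬ab (E-sym T qa) }))
      where
      flip-pq : B b q a → ∃ λ T′ → Tri T′ × ∃₂ λ p q → ∃ λ r → X p q a b × FlipE T T′ p q r a
      flip-pq bqa with apex t {p} {q} {b} pq (solve (B′ 0 1 2 ⇒′ B′ 2 3 0 ⇒′ B′ 1 2 3) 4 refl a (p ∷ b ∷ q ∷ []) apb bqa)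
      ... | r , prq , pr , rq with quadrilateral-flip t prq (B-rotate pqa) pr rq qa ap pq
      ...   | T′ , t′ , f = T′ , t′ , p , q , r , solve (B′ 0 1 2 ⇒′ B′ 2 3 0 ⇒′ X′ 1 3 0 2) 4 refl a (p ∷ b ∷ q ∷ []) apb bqa , f

  -- K holds the chords that no step may destroy; with the sides of the pentagon in K, it stays
  -- inscribed all along the path.
  data Path (K : V n → V n → Set) : DSet n → DSet n → Set where
    stop : ∀ {T} → Path K T T
    step : ∀ {T S T′} → Tri S → SomeFlip T S → (∀ {x y} → K x y → E S x y) → Path K S T′ → Path K T T′

  Path-++ : ∀ {K : V n → V n → Set} {T S T′} → Path K T S → Path K S T′ → Path K T T′
  Path-++ stop q = q
  Path-++ (step s f k p) q = step s f k (Path-++ p q)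

  Path-weaken : ∀ {K K′ : V n → V n → Set} → (∀ {x y} → K′ x y → K x y) → ∀ {T T′} → Path K T T′ → Path K′ T T′
  Path-weaken h stop = stop
  Path-weaken h (step s f k p) = step s f (k ∘′ h) (Path-weaken h p)

  private
    CrossesAt? : ∀ T (a b : V n) (e : V n × V n) → Dec (E T (proj₁ e) (proj₂ e) × X (proj₁ e) (proj₂ e) a b)
    CrossesAt? T a b (x , y) = E? T x y ×-dec X? x y a b

    Missing? : ∀ T T′ (e : V n × V n) → Dec (E T′ (proj₁ e) (proj₂ e) × ¬ E T (proj₁ e) (proj₂ e))
    Missing? T T′ (x , y) = E? T′ x y ×-dec ¬? (E? T x y)

  private opaque
    crossings : DSet n → V n → V n → ℕ
    crossings T a b = length (filter (CrossesAt? T a b) (pairs (n ℕ.+ 3)))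

    -- The new chord ends at a and so cannot cross ab, while the removed one did.
    fewer-crossings : ∀ {S T : DSet n} {a b p q r : V n} → Tri S → X p q a b → FlipE T S p q r a →
      crossings S a b ℕ.< crossings T a b
    fewer-crossings {S} {T} {a} {b} {p} {q} {r} s cr f = count-< (CrossesAt? S a b) (CrossesAt? T a b)
      (λ (z , c) → [ (λ u → ⊥-elim (ra-ab u c)) , (λ z′ → z′ , c) ]′ (back f z))
      (∈-pairs p q) (old f , cr) (λ (z , _) → nc s z (new f) (cross f))
      where
      ra-ab : ∀ {x y} → SameChord x y r a → ¬ X x y a b
      ra-ab u c = solve (X′ 0 1 1 2 ⇒′ ⊥′) 3 refl r (a ∷ b ∷ []) (X-SameChord (SameChord-sym u) c)

  opaque
    -- Repeats `flip-towards`. Each chord flipped away crosses ab, so the chords of K are spared.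
    reach : ∀ (K : V n → V n → Set) {a b : V n} m {T} → Tri T → crossings T a b ℕ.≤ m →
      (∀ {x y} → K x y → ¬ X x y a b) → (∀ {x y} → K x y → E T x y) →
      ∃ λ T′ → Tri T′ × E T′ a b × (∀ {x y} → K x y → E T′ x y) × Path K T T′
    reach K {a} {b} m {T} t le K-nc K⊆T with E? T a b
    ... | yes ab = T , t , ab , K⊆T , stop
    ... | no ¬ab with flip-towards t {a} {b} ¬ab
    reach K {a} {b} zero {T} t le K-nc K⊆T | no ¬ab | S , s , p , q , r , cr , f =
      ⊥-elim (ℕP.n≮0 (ℕP.<-≤-trans (fewer-crossings {S} {T} {a} {b} {p} {q} {r} s cr f) le))
    reach K {a} {b} (suc m) {T} t le K-nc K⊆T | no ¬ab | S , s , p , q , r , cr , f =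
      extend (reach K {a} {b} m {S} s (ℕP.≤-pred (ℕP.<-≤-trans (fewer-crossings {S} {T} {a} {b} {p} {q} {r} s cr f) le)) K-nc K⊆S)
      where
      K⊆S : ∀ {x y} → K x y → E S x y
      K⊆S k = [ (λ u → ⊥-elim (K-nc k (X-SameChord u cr))) , (λ z → z) ]′ (keep f (K⊆T k))
      extend : (∃ λ T′ → Tri T′ × E T′ a b × (∀ {x y} → K x y → E T′ x y) × Path K S T′) →
               ∃ λ T′ → Tri T′ × E T′ a b × (∀ {x y} → K x y → E T′ x y) × Path K T T′
      extend (T′ , t′ , ab , K⊆T′ , path) = T′ , t′ , ab , K⊆T′ , step s (p , q , r , a , f) K⊆S path

  private
    missing? : ∀ T T′ → Dec (∃₂ λ (a b : V n) → E T′ a b × ¬ E T a b)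
    missing? T T′ = FinP.any? λ a → FinP.any? λ b → Missing? T T′ (a , b)

    no-missing : ∀ {T T′ : DSet n} → Tri T → Tri T′ → (∀ {x y} → E T′ x y → E T x y) → T ≡ T′
    no-missing {T} {T′} t t′ incl = Tri-ext t t′ (λ {x} {y} z → decidable-stable (E? T′ x y) λ ¬z →
      let k , l , w , c = mx t′ ¬z in nc t z (incl w) c) incl

    opaque
      missing : DSet n → DSet n → ℕ
      missing T T′ = length (filter (Missing? T T′) (pairs (n ℕ.+ 3)))

      fewer-missing : ∀ {S T T′ : DSet n} {a b : V n} → (∀ {x y} → E T x y × E T′ x y → E S x y) →
        E S a b → E T′ a b → ¬ E T a b → missing S T′ ℕ.< missing T T′
      fewer-missing {S} {T} {T′} {a} {b} K⊆S ab z ¬z = count-< (Missing? S T′) (Missing? T T′)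
        (λ (w , ¬w) → w , λ w′ → ¬w (K⊆S (w′ , w))) (∈-pairs a b) (z , ¬z) (λ (_ , ¬w) → ¬w ab)

    -- Inserts the missing chords of T′ one at a time. Chords common to T and T′ cross no chord of
    -- T′, hence stay throughout, and each insertion leaves fewer chords missing.
    connect : ∀ m {T T′ : DSet n} → Tri T → Tri T′ → missing T T′ ℕ.≤ m → Path (λ x y → E T x y × E T′ x y) T T′
    connect m {T} {T′} t t′ le with missing? T T′
    ... | no ¬e with no-missing t t′ (λ {x} {y} z → decidable-stable (E? T x y) λ ¬z → ¬e (x , y , z , ¬z))
    ...   | refl = stop
    connect m {T} {T′} t t′ le | yes (a , b , z , ¬z)
      with reach (λ x y → E T x y × E T′ x y) {a} {b} (crossings T a b) t ℕP.≤-refl (λ (_ , w) → nc t′ w z) proj₁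
    connect zero {T} {T′} t t′ le | yes (a , b , z , ¬z) | S , s , ab , K⊆S , path =
      ⊥-elim (ℕP.n≮0 (ℕP.<-≤-trans (fewer-missing {S} {T} {T′} {a} {b} K⊆S ab z ¬z) le))
    connect (suc m) {T} {T′} t t′ le | yes (a , b , z , ¬z) | S , s , ab , K⊆S , path =
      Path-++ path (Path-weaken (λ k → K⊆S k , proj₂ k)
        (connect m s t′ (ℕP.≤-pred (ℕP.<-≤-trans (fewer-missing {S} {T} {T′} {a} {b} K⊆S ab z ¬z) le))))

  connected : ∀ {T T′ : DSet n} → Tri T → Tri T′ → Path (λ x y → E T x y × E T′ x y) T T′
  connected t t′ = connect _ t t′ ℕP.≤-refl

-- The number of pairwise non-crossing diagonals

lookup-injective : ∀ {A : Set} {xs : List A} → Unique xs → ∀ {i j} → lookup xs i ≡ lookup xs j → i ≡ j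
lookup-injective (_ ∷ _) {Fin.zero} {Fin.zero} _ = refl
lookup-injective {xs = _ ∷ xs} (p ∷ _) {Fin.zero} {Fin.suc j} e = ⊥-elim (All.lookup p (∈-lookup {xs = xs} j) e)
lookup-injective {xs = _ ∷ xs} (p ∷ _) {Fin.suc i} {Fin.zero} e = ⊥-elim (All.lookup p (∈-lookup {xs = xs} i) (sym e))
lookup-injective (_ ∷ u) {Fin.suc i} {Fin.suc j} e = cong Fin.suc (lookup-injective u e)

module _ {n : ℕ} where

  private
    Chord : Set
    Chord = V n × V n
    open DecMem (ΣP.≡-dec (Fin._≟_ {n ℕ.+ 3}) (Fin._≟_ {n ℕ.+ 3})) using (_∈?_)

  module _ (M : List Chord) (unique : Unique M)
           (wide : ∀ {i j} → (i , j) ∈ M → toℕ i ℕ.+ 2 ℕ.≤ toℕ j)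
           (nc : ∀ {i j k l} → (i , j) ∈ M → (k , l) ∈ M → ¬ X i j k l) where

    private
      -- Sending (i , j) to the largest l < j with l = i + 1 or (i , l) in M is injective when M is
      -- non-crossing, and it misses the two extreme vertices.
      Q : V n → V n → Set
      Q i l = toℕ l ≡ suc (toℕ i) ⊎ (i , l) ∈ M

      Peak : V n → V n → V n → Set
      Peak i j l = i < l × l < j × Q i l × (∀ k → B l k j → ¬ Q i k)

      peak : ∀ {i j} → (i , j) ∈ M → ∃ (Peak i j)
      peak {i} {j} m =
        let i<j : i < j
            i<j = ℕP.<-≤-trans (ℕP.m<m+n (toℕ i) (s≤s z≤n)) (wide m)
            s , e = after i (below-top {x = i} {j} i<j)
            l , ilj , q , last = last-before {Q = Q i} (λ k → (toℕ k ℕ.≟ suc (toℕ i)) ⊎-dec ((i , k) ∈? M)) i j s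
              (inj₁ (ℕP.≤-reflexive (sym e) , subst (ℕ._≤ toℕ j) (trans (ℕP.+-comm (toℕ i) 2) (cong suc (sym e))) (wide m)))
              (inj₁ e)
            i<l , l<j = solve (0 <′ 1 ⇒′ B′ 0 2 1 ⇒′ (0 <′ 2 ∧′ 2 <′ 1)) 3 refl i (j ∷ l ∷ []) i<j ilj
        in l , i<l , l<j , q , last

      -- If i < i′ had the same image l, then i′ would lie strictly between i and l: impossible when
      -- l = i + 1, and otherwise (i , l) crosses (i′ , j′).
      left-end : ∀ {i j i′ j′ l} → (i′ , j′) ∈ M → Peak i j l → Peak i′ j′ l → ¬ i < i′
      left-end m (_ , _ , inj₁ e , _) (i′<l , _) i<i′ =
        ℕP.<⇒≱ i<i′ (ℕP.≤-pred (subst (suc _ ℕ.≤_) e i′<l))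
      left-end m (_ , _ , inj₂ il , _) (i′<l , l<j′ , _) i<i′ = nc il m (Crosses⇒X (inj₁ (i<i′ , i′<l , l<j′)))

      -- For j < j′ the vertex j would itself be a larger candidate for the image of (i , j′).
      right-end : ∀ {i j j′ l} → (i , j) ∈ M → Peak i j l → Peak i j′ l → ¬ j < j′
      right-end m (_ , l<j , _) (_ , _ , _ , last) j<j′ = last _ (inj₁ (l<j , j<j′)) (inj₂ m)

      peak-injective : ∀ {i j i′ j′ l} → (i , j) ∈ M → (i′ , j′) ∈ M → Peak i j l → Peak i′ j′ l → (i , j) ≡ (i′ , j′)
      peak-injective {i} {j} {i′} {j′} m m′ p p′ with FinP.<-cmp i i′
      ... | tri< lt _ _ = ⊥-elim (left-end m′ p p′ lt)
      ... | tri> _ _ gt = ⊥-elim (left-end m p′ p gt)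
      ... | tri≈ _ refl _ with FinP.<-cmp j j′
      ...   | tri< lt _ _ = ⊥-elim (right-end m p p′ lt)
      ...   | tri> _ _ gt = ⊥-elim (right-end m′ p′ p gt)
      ...   | tri≈ _ refl _ = refl

      lo hi : V n
      lo = proj₁ (first {n})
      hi = Fin.fromℕ< {n ℕ.+ 2} (subst (n ℕ.+ 2 ℕ.<_) (sym (ℕP.+-suc n 2)) ℕP.≤-refl)

      lo≡ : toℕ lo ≡ 0
      lo≡ = proj₂ (first {n})
      hi≡ : toℕ hi ≡ n ℕ.+ 2
      hi≡ = FinP.toℕ-fromℕ< _

      peakAt : ∀ (p : Fin (length M)) → ∃ (Peak (proj₁ (lookup M p)) (proj₂ (lookup M p)))
      peakAt p = peak (∈-lookup {xs = M} p)

      image : Fin (2 ℕ.+ length M) → V n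
      image Fin.zero = lo
      image (Fin.suc Fin.zero) = hi
      image (Fin.suc (Fin.suc p)) = proj₁ (peakAt p)

      peak≢lo : ∀ p → ¬ lo ≡ proj₁ (peakAt p)
      peak≢lo p e = ℕP.n≮0 (subst (toℕ (proj₁ (lookup M p)) ℕ.<_) (trans (cong toℕ (sym e)) lo≡) (proj₁ (proj₂ (peakAt p))))

      peak≢hi : ∀ p → ¬ hi ≡ proj₁ (peakAt p)
      peak≢hi p e = ℕP.<-irrefl refl (subst (ℕ._< n ℕ.+ 2) (trans (cong toℕ (sym e)) hi≡)
        (below-top {x = proj₁ (peakAt p)} {proj₂ (lookup M p)} (proj₁ (proj₂ (proj₂ (peakAt p))))))

      lo≢hi : ¬ lo ≡ hi
      lo≢hi e = ℕP.m+1+n≢0 n (trans (sym hi≡) (trans (cong toℕ (sym e)) lo≡))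

      image-injective : ∀ {p q} → image p ≡ image q → p ≡ q
      image-injective {Fin.zero} {Fin.zero} e = refl
      image-injective {Fin.zero} {Fin.suc Fin.zero} e = ⊥-elim (lo≢hi e)
      image-injective {Fin.zero} {Fin.suc (Fin.suc q)} e = ⊥-elim (peak≢lo q e)
      image-injective {Fin.suc Fin.zero} {Fin.zero} e = ⊥-elim (lo≢hi (sym e))
      image-injective {Fin.suc Fin.zero} {Fin.suc Fin.zero} e = refl
      image-injective {Fin.suc Fin.zero} {Fin.suc (Fin.suc q)} e = ⊥-elim (peak≢hi q e)
      image-injective {Fin.suc (Fin.suc p)} {Fin.zero} e = ⊥-elim (peak≢lo p (sym e))
      image-injective {Fin.suc (Fin.suc p)} {Fin.suc Fin.zero} e = ⊥-elim (peak≢hi p (sym e))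
      image-injective {Fin.suc (Fin.suc p)} {Fin.suc (Fin.suc q)} e =
        cong (λ z → Fin.suc (Fin.suc z)) (lookup-injective unique (peak-injective (∈-lookup {xs = M} p) (∈-lookup {xs = M} q)
          (proj₂ (peakAt p)) (subst (Peak _ _) (sym e) (proj₂ (peakAt q)))))

    laminar-bound : 2 ℕ.+ length M ℕ.≤ n ℕ.+ 3
    laminar-bound = FinP.injective⇒≤ {f = image} image-injective

  -- The polygon side from the first to the last vertex is adjoined to L. It crosses nothing and its
  -- labels are at least 2 apart, so `laminar-bound` gives 2 + (1 + |L|) ≤ n + 3, the sharp bound.
  noncrossing-bound : ∀ (L : List Chord) → Unique L → (∀ {i j} → (i , j) ∈ L → i < j × ¬ Adj i j) →
    (∀ {i j k l} → (i , j) ∈ L → (k , l) ∈ L → ¬ X i j k l) → length L ℕ.≤ n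
  noncrossing-bound L unique dg nc = ℕP.+-cancelˡ-≤ 3 _ _ (subst (3 ℕ.+ length L ℕ.≤_) (ℕP.+-comm n 3)
    (laminar-bound (base ∷ L) (All.tabulate (λ m e → base∉ (subst (_∈ L) (sym e) m)) ∷ unique) wide nc′))
    where
    base : Chord
    base = proj₁ (first {n}) , Fin.fromℕ< {n ℕ.+ 2} (subst (n ℕ.+ 2 ℕ.<_) (sym (ℕP.+-suc n 2)) ℕP.≤-refl)
    base-adj : Adj (proj₁ base) (proj₂ base)
    base-adj = base-Adj (proj₂ (first {n})) (FinP.toℕ-fromℕ< _)
    base∉ : ¬ base ∈ L
    base∉ m = proj₂ (dg m) base-adj
    wide : ∀ {i j} → (i , j) ∈ base ∷ L → toℕ i ℕ.+ 2 ℕ.≤ toℕ j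
    wide (here refl) = subst₂ (λ u v → u ℕ.+ 2 ℕ.≤ v) (sym (proj₂ (first {n}))) (sym (FinP.toℕ-fromℕ< _)) (ℕP.m≤n+m 2 n)
    wide {i} {j} (there m) = proj₁ (¬Adj⇒IsDiag {x = i} {j} (proj₁ (dg m)) (proj₂ (dg m)))
    nc′ : ∀ {i j k l} → (i , j) ∈ base ∷ L → (k , l) ∈ base ∷ L → ¬ X i j k l
    nc′ (here refl) _ cr = Adj-¬X base-adj cr
    nc′ {i} {j} {k} {l} (there _) (here refl) cr = Adj-¬X base-adj (X-sym {a = i} {j} {k} {l} cr)
    nc′ (there m) (there m′) cr = nc m m′ cr

indices : ∀ {m} → Subset m → List (Fin m)
indices [] = []
indices (true ∷ p) = Fin.zero ∷ map Fin.suc (indices p)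
indices (false ∷ p) = map Fin.suc (indices p)

indices-length : ∀ {m} (p : Subset m) → length (indices p) ≡ ∣ p ∣
indices-length [] = refl
indices-length (true ∷ p) = cong suc (trans (ListP.length-map Fin.suc (indices p)) (indices-length p))
indices-length (false ∷ p) = trans (ListP.length-map Fin.suc (indices p)) (indices-length p)

indices-unique : ∀ {m} (p : Subset m) → Unique (indices p)
indices-unique [] = []
indices-unique (true ∷ p) = AllP.map⁺ (All.tabulate (λ _ ())) ∷ UniqueP.map⁺ FinP.suc-injective (indices-unique p)
indices-unique (false ∷ p) = UniqueP.map⁺ FinP.suc-injective (indices-unique p)

indices-true : ∀ {m} (p : Subset m) → All (λ i → Vec.lookup p i ≡ true) (indices p)
indices-true [] = []
indices-true (true ∷ p) = refl ∷ AllP.map⁺ (indices-true p)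
indices-true (false ∷ p) = AllP.map⁺ (indices-true p)

firstRow : ∀ {k m} → Fin m → Fin (suc k) × Fin m
firstRow j = Fin.zero , j

shiftRow : ∀ {k m} → Fin k × Fin m → Fin (suc k) × Fin m
shiftRow (i , j) = Fin.suc i , j

-- Turns `size`, a sum of row counts, into the length of a duplicate-free list of chords to which
-- the bound applies.
positions : ∀ {k m} → Vec (Subset m) k → List (Fin k × Fin m)
positions [] = []
positions (r ∷ rs) = map firstRow (indices r) ++ map shiftRow (positions rs)

positions-length : ∀ {k m} (rs : Vec (Subset m) k) → length (positions rs) ≡ Vec.sum (Vec.map ∣_∣ rs)
positions-length [] = refl
positions-length (r ∷ rs) = trans (ListP.length-++ (map firstRow (indices r)) {map shiftRow (positions rs)})
  (cong₂ ℕ._+_ (trans (ListP.length-map firstRow (indices r)) (indices-length r))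
               (trans (ListP.length-map shiftRow (positions rs)) (positions-length rs)))

positions-unique : ∀ {k m} (rs : Vec (Subset m) k) → Unique (positions rs)
positions-unique [] = []
positions-unique (r ∷ rs) = UniqueP.++⁺ (UniqueP.map⁺ (λ { refl → refl }) (indices-unique r))
  (UniqueP.map⁺ (λ { {_ , _} {_ , _} refl → refl }) (positions-unique rs))
  (λ (u , v) → case ∈-map⁻ firstRow u , ∈-map⁻ shiftRow v of λ { ((_ , _ , refl) , (_ , _ , ())) })

positions-true : ∀ {k m} (rs : Vec (Subset m) k) → All (λ (i , j) → Vec.lookup (Vec.lookup rs i) j ≡ true) (positions rs)
positions-true [] = []
positions-true (r ∷ rs) = AllP.++⁺ (AllP.map⁺ (indices-true r)) (AllP.map⁺ (positions-true rs))

-- Retriangulating a pentagon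

-- A chord that meets the interior of the pentagon can leave it only across a side or at a vertex.
inside : ∀ {N} (a b c d e k l x y : Fin N) → Cyc5 a b c d e → In a b c d e k → In a b c d e l → X x y k l →
  ¬ X x y a b → ¬ X x y b c → ¬ X x y c d → ¬ X x y d e → ¬ X x y e a →
  In a b c d e x × In a b c d e y
inside a b c d e k l x y = solve (Cyc5′ 0 1 2 3 4 ⇒′ In′ 0 1 2 3 4 5 ⇒′ In′ 0 1 2 3 4 6 ⇒′ X′ 7 8 5 6 ⇒′
  (X′ 7 8 0 1 ⇒′ ⊥′) ⇒′ (X′ 7 8 1 2 ⇒′ ⊥′) ⇒′ (X′ 7 8 2 3 ⇒′ ⊥′) ⇒′ (X′ 7 8 3 4 ⇒′ ⊥′) ⇒′ (X′ 7 8 4 0 ⇒′ ⊥′) ⇒′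
  In′ 0 1 2 3 4 7 ∧′ In′ 0 1 2 3 4 8) 9 refl a (b ∷ c ∷ d ∷ e ∷ k ∷ l ∷ x ∷ y ∷ [])

record Pentagon (n : ℕ) : Set where
  constructor pentagon
  field a b c d e : V n

-- Advancing by two vertices: the fans at consecutive pentagons of this orbit differ by one flip.
next : ∀ {n} → Pentagon n → Pentagon n
next (pentagon a b c d e) = pentagon c d e a b

module _ {n : ℕ} where
  open Tri
  open FlipE

  _∈ᵖ_ : V n → Pentagon n → Set
  x ∈ᵖ p = In a b c d e x where open Pentagon p

  ∈ᵖ? : ∀ x p → Dec (x ∈ᵖ p)
  ∈ᵖ? x p = (x Fin.≟ a) ⊎-dec (x Fin.≟ b) ⊎-dec (x Fin.≟ c) ⊎-dec (x Fin.≟ d) ⊎-dec (x Fin.≟ e)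
    where open Pentagon p

  pattern isA = inj₁ refl
  pattern isB = inj₂ (inj₁ refl)
  pattern isC = inj₂ (inj₂ (inj₁ refl))
  pattern isD = inj₂ (inj₂ (inj₂ (inj₁ refl)))
  pattern isE = inj₂ (inj₂ (inj₂ (inj₂ refl)))

  ∈-next : ∀ {x} p → x ∈ᵖ p → x ∈ᵖ next p
  ∈-next p isA = isD
  ∈-next p isB = isE
  ∈-next p isC = isA
  ∈-next p isD = isB
  ∈-next p isE = isC

  ∈-next⁻ : ∀ {x} p → x ∈ᵖ next p → x ∈ᵖ p
  ∈-next⁻ p isA = isC
  ∈-next⁻ p isB = isD
  ∈-next⁻ p isC = isE
  ∈-next⁻ p isD = isA
  ∈-next⁻ p isE = isB

  module _ (T : DSet n) (p : Pentagon n) where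
    open Pentagon p

    record Inscribed : Set where
      field
        cyc : Cyc5 a b c d e
        ab : E T a b
        bc : E T b c
        cd : E T c d
        de : E T d e
        ea : E T e a

    -- Old diagonals of the pentagon are discarded because they cross ac or ad unless they belong to
    -- the fan. Hence nothing has to be known about how T triangulates the pentagon.
    InFan : V n → V n → Set
    InFan x y = (E T x y ⊎ (x ∈ᵖ p × y ∈ᵖ p)) × ¬ X x y a c × ¬ X x y a d

    InFan? : ∀ x y → Dec (InFan x y)
    InFan? x y = (E? T x y ⊎-dec (∈ᵖ? x p ×-dec ∈ᵖ? y p)) ×-dec ¬? (X? x y a c) ×-dec ¬? (X? x y a d)

    InFan-sym : ∀ {x y} → InFan x y → InFan y x
    InFan-sym {x} {y} (z , u , v) =
      Sum.map (E-sym T) swap z , u ∘′ X-swapˡ {a = y} {x} {a} {c} , v ∘′ X-swapˡ {a = y} {x} {a} {d}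

    Adj⇒InFan : ∀ {x y} → Adj x y → InFan x y
    Adj⇒InFan ad = inj₁ (inj₁ ad) , Adj-¬X ad , Adj-¬X ad

    private module FanMake = Make InFan InFan? InFan-sym Adj⇒InFan

    opaque
      -- The chords of T outside p, with p retriangulated by the two diagonals at its first vertex.
      Fan : DSet n
      Fan = FanMake.table

      ∈Fan : ∀ {x y} → InFan x y → E Fan x y
      ∈Fan = FanMake.P⇒E

      ∈Fan⁻ : ∀ {x y} → E Fan x y → InFan x y
      ∈Fan⁻ = FanMake.E⇒P

      InFan⇒Tri : (∀ {x y k l} → InFan x y → InFan k l → ¬ X x y k l) →
                  (∀ {x y} → ¬ InFan x y → ∃₂ λ k l → InFan k l × X x y k l) → Tri Fan
      InFan⇒Tri = FanMake.table-Tri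

  open Inscribed

  Inscribed-next : ∀ {T : DSet n} {p} → Inscribed T p → Inscribed T (next p)
  Inscribed-next {p = pentagon a b c d e} i = record
    { cyc = solve (Cyc5′ 0 1 2 3 4 ⇒′ Cyc5′ 2 3 4 0 1) 5 refl a (b ∷ c ∷ d ∷ e ∷ []) (cyc i)
    ; ab = cd i ; bc = de i ; cd = ea i ; de = ab i ; ea = bc i }

  module _ {T : DSet n} (t : Tri T) (p : Pentagon n) (i : Inscribed T p) where
    open Pentagon p

    inside-T : ∀ {x y k l} → E T x y → k ∈ᵖ p → l ∈ᵖ p → X x y k l → x ∈ᵖ p × y ∈ᵖ p
    inside-T {x} {y} {k} {l} z ik il cr = inside a b c d e k l x y (cyc i) ik il cr
      (nc t z (ab i)) (nc t z (bc i)) (nc t z (cd i)) (nc t z (de i)) (nc t z (ea i))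

    both-in : ∀ {x y k l} → x ∈ᵖ p → y ∈ᵖ p → k ∈ᵖ p → l ∈ᵖ p →
      ¬ X x y a c → ¬ X x y a d → ¬ X k l a c → ¬ X k l a d → ¬ X x y k l
    both-in {x} {y} {k} {l} = solve (Cyc5′ 0 1 2 3 4 ⇒′ In′ 0 1 2 3 4 5 ⇒′ In′ 0 1 2 3 4 6 ⇒′ In′ 0 1 2 3 4 7 ⇒′ In′ 0 1 2 3 4 8 ⇒′
      (X′ 5 6 0 2 ⇒′ ⊥′) ⇒′ (X′ 5 6 0 3 ⇒′ ⊥′) ⇒′ (X′ 7 8 0 2 ⇒′ ⊥′) ⇒′ (X′ 7 8 0 3 ⇒′ ⊥′) ⇒′ X′ 5 6 7 8 ⇒′ ⊥′) 9 refl
      a (b ∷ c ∷ d ∷ e ∷ x ∷ y ∷ k ∷ l ∷ []) (cyc i)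

    InFan-nc : ∀ {x y k l} → InFan T p x y → InFan T p k l → ¬ X x y k l
    InFan-nc (inj₁ z , _) (inj₁ w , _) cr = nc t z w cr
    InFan-nc (inj₁ z , u , v) (inj₂ (ik , il) , u′ , v′) cr = let ix , iy = inside-T z ik il cr in
      both-in ix iy ik il u v u′ v′ cr
    InFan-nc {x} {y} {k} {l} (inj₂ (ix , iy) , u , v) (inj₁ w , u′ , v′) cr =
      let ik , il = inside-T w ix iy (X-sym {a = x} {y} {k} {l} cr) in both-in ix iy ik il u v u′ v′ cr
    InFan-nc (inj₂ (ix , iy) , u , v) (inj₂ (ik , il) , u′ , v′) cr = both-in ix iy ik il u v u′ v′ cr

    private
      sides-clear : (¬ X a b a c × ¬ X a b a d) × (¬ X b c a c × ¬ X b c a d) × (¬ X c d a c × ¬ X c d a d)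
                  × (¬ X d e a c × ¬ X d e a d) × (¬ X e a a c × ¬ X e a a d)
      sides-clear = solve (Cyc5′ 0 1 2 3 4 ⇒′
        ((X′ 0 1 0 2 ⇒′ ⊥′) ∧′ (X′ 0 1 0 3 ⇒′ ⊥′)) ∧′ ((X′ 1 2 0 2 ⇒′ ⊥′) ∧′ (X′ 1 2 0 3 ⇒′ ⊥′)) ∧′ ((X′ 2 3 0 2 ⇒′ ⊥′) ∧′ (X′ 2 3 0 3 ⇒′ ⊥′))
        ∧′ ((X′ 3 4 0 2 ⇒′ ⊥′) ∧′ (X′ 3 4 0 3 ⇒′ ⊥′)) ∧′ ((X′ 4 0 0 2 ⇒′ ⊥′) ∧′ (X′ 4 0 0 3 ⇒′ ⊥′))) 5 refl
        a (b ∷ c ∷ d ∷ e ∷ []) (cyc i)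

    ac∈Fan : InFan T p a c
    ac∈Fan = inj₂ (isA , isC) , X-irrefl SameChord-refl , solve (X′ 0 1 0 2 ⇒′ ⊥′) 3 refl a (c ∷ d ∷ [])

    ad∈Fan : InFan T p a d
    ad∈Fan = inj₂ (isA , isD) , solve (X′ 0 1 0 2 ⇒′ ⊥′) 3 refl a (d ∷ c ∷ []) , X-irrefl SameChord-refl

    -- The delicate case is a crossing chord kl of T that the fan has lost: it crosses ac or ad, so
    -- it is a diagonal of p. Then xy crosses a side of p, which is in the fan, or both its ends lie
    -- in p and it would be in the fan itself.
    InFan-mx : ∀ {x y} → ¬ InFan T p x y → ∃₂ λ k l → InFan T p k l × X x y k l
    InFan-mx {x} {y} ¬f with X? x y a c | X? x y a d
    ... | yes u | _ = a , c , ac∈Fan , u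
    ... | no _ | yes v = a , d , ad∈Fan , v
    ... | no ¬u | no ¬v with mx t (λ z → ¬f (inj₁ z , ¬u , ¬v))
    ...   | k , l , w , cr with InFan? T p k l
    ...     | yes f = k , l , f , cr
    ...     | no ¬g with X? x y a b | X? x y b c | X? x y c d | X? x y d e | X? x y e a
    ...       | yes q | _ | _ | _ | _ = a , b , (inj₁ (ab i) , proj₁ sides-clear) , q
    ...       | no _ | yes q | _ | _ | _ = b , c , (inj₁ (bc i) , proj₁ (proj₂ sides-clear)) , q
    ...       | no _ | no _ | yes q | _ | _ = c , d , (inj₁ (cd i) , proj₁ (proj₂ (proj₂ sides-clear))) , q
    ...       | no _ | no _ | no _ | yes q | _ = d , e , (inj₁ (de i) , proj₁ (proj₂ (proj₂ (proj₂ sides-clear)))) , q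
    ...       | no _ | no _ | no _ | no _ | yes q = e , a , (inj₁ (ea i) , proj₂ (proj₂ (proj₂ (proj₂ sides-clear)))) , q
    ...       | no q₁ | no q₂ | no q₃ | no q₄ | no q₅ = ⊥-elim (¬f (inj₂ (both kl∈) , ¬u , ¬v))
      where
      kl∈ : k ∈ᵖ p × l ∈ᵖ p
      kl∈ with X? k l a c | X? k l a d
      ... | yes r | _ = inside-T w isA isC r
      ... | no _ | yes r = inside-T w isA isD r
      ... | no r | no s = ⊥-elim (¬g (inj₁ w , r , s))
      both : k ∈ᵖ p × l ∈ᵖ p → x ∈ᵖ p × y ∈ᵖ p
      both (ik , il) = inside a b c d e k l x y (cyc i) ik il cr q₁ q₂ q₃ q₄ q₅

    Fan-Tri : Tri (Fan T p)
    Fan-Tri = InFan⇒Tri T p InFan-nc InFan-mx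

  module _ {T : DSet n} (t : Tri T) (p : Pentagon n) (i : Inscribed T p) where
    open Pentagon p

    private
      i′ = Inscribed-next i

      in-p : ∀ {x y k l} → E T x y ⊎ (x ∈ᵖ p × y ∈ᵖ p) → k ∈ᵖ p → l ∈ᵖ p → X x y k l → x ∈ᵖ p × y ∈ᵖ p
      in-p (inj₁ z) ik il cr = inside-T t p i z ik il cr
      in-p (inj₂ xy) ik il cr = xy

      keep-fan : ∀ {x y} → InFan T p x y → SameChord x y a d ⊎ InFan T (next p) x y
      keep-fan {x} {y} (z , u , v) with X? x y c e
      ... | no w = inj₂ (Sum.map₂ (λ (ix , iy) → ∈-next p ix , ∈-next p iy) z , w , u ∘′ X-swapʳ {a = x} {y} {c} {a})
      ... | yes w = let ix , iy = in-p z isC isE w in inj₁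
          (solve (Cyc5′ 0 1 2 3 4 ⇒′ In′ 0 1 2 3 4 5 ⇒′ In′ 0 1 2 3 4 6 ⇒′ (X′ 5 6 0 2 ⇒′ ⊥′) ⇒′ (X′ 5 6 0 3 ⇒′ ⊥′) ⇒′
             X′ 5 6 2 4 ⇒′ ((5 ≡′ 0 ∧′ 6 ≡′ 3) ∨′ (5 ≡′ 3 ∧′ 6 ≡′ 0))) 7 refl a (b ∷ c ∷ d ∷ e ∷ x ∷ y ∷ []) (cyc i) ix iy u v w)

      back-fan : ∀ {x y} → InFan T (next p) x y → SameChord x y c e ⊎ InFan T p x y
      back-fan {x} {y} (z′ , u , v) with X? x y a d
      ... | no w = inj₂ (z , v ∘′ X-swapʳ {a = x} {y} {a} {c} , w)
        where z = Sum.map₂ (λ (ix , iy) → ∈-next⁻ p ix , ∈-next⁻ p iy) z′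
      ... | yes w = let ix , iy = in-p (Sum.map₂ (λ (ix , iy) → ∈-next⁻ p ix , ∈-next⁻ p iy) z′) isA isD w in inj₁
          (solve (Cyc5′ 0 1 2 3 4 ⇒′ In′ 0 1 2 3 4 5 ⇒′ In′ 0 1 2 3 4 6 ⇒′ (X′ 5 6 2 4 ⇒′ ⊥′) ⇒′ (X′ 5 6 2 0 ⇒′ ⊥′) ⇒′
             X′ 5 6 0 3 ⇒′ ((5 ≡′ 2 ∧′ 6 ≡′ 4) ∨′ (5 ≡′ 4 ∧′ 6 ≡′ 2))) 7 refl a (b ∷ c ∷ d ∷ e ∷ x ∷ y ∷ []) (cyc i) ix iy u v w)

    -- The fan at a consists of ac and ad, the fan at c of ce and ca: one diagonal is shared and the
    -- other exchanged.
    Fan-flip : FlipE (Fan T p) (Fan T (next p)) a d c e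
    Fan-flip = record
      { cross = solve (Cyc5′ 0 1 2 3 4 ⇒′ X′ 0 3 2 4) 5 refl a (b ∷ c ∷ d ∷ e ∷ []) (cyc i)
      ; old = ∈Fan T p (ad∈Fan t p i)
      ; new = ∈Fan T (next p) (ac∈Fan t (next p) i′)
      ; keep = λ z → Sum.map₂ (∈Fan T (next p)) (keep-fan (∈Fan⁻ T p z))
      ; back = λ z → Sum.map₂ (∈Fan T p) (back-fan (∈Fan⁻ T (next p) z)) }

    -- The fan at e, with eb and ec, destroys both ac and ad, whereas one flip removes a single
    -- chord.
    Fan-no-flip : ¬ SomeFlip (Fan T p) (Fan T (next (next p)))
    Fan-no-flip (_ , _ , _ , _ , f) =
      case SameChord-trans (removed (keep f (∈Fan T p (ac∈Fan t p i))) ac-eb (proj₁ ec∈)) (SameChord-sym (removed (keep f (∈Fan T p (ad∈Fan t p i))) ad-ec (proj₂ ec∈))) of λ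
        { (inj₁ (_ , refl)) → solve (Cyc5′ 0 1 2 2 3 ⇒′ ⊥′) 4 refl a (b ∷ c ∷ e ∷ []) (cyc i)
        ; (inj₂ (refl , refl)) → solve (Cyc5′ 0 1 0 0 2 ⇒′ ⊥′) 3 refl a (b ∷ e ∷ []) (cyc i) }
      where
      ac-eb : X a c e b
      ac-eb = solve (Cyc5′ 0 1 2 3 4 ⇒′ X′ 0 2 4 1) 5 refl a (b ∷ c ∷ d ∷ e ∷ []) (cyc i)
      ad-ec : X a d e c
      ad-ec = solve (Cyc5′ 0 1 2 3 4 ⇒′ X′ 0 3 4 2) 5 refl a (b ∷ c ∷ d ∷ e ∷ []) (cyc i)
      p″ = next (next p)
      i″ = Inscribed-next i′
      ec∈ : E (Fan T p″) e b × E (Fan T p″) e c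
      ec∈ = ∈Fan T p″ (ac∈Fan t p″ i″) , ∈Fan T p″ (ad∈Fan t p″ i″)
      removed : ∀ {x y k l u v} → SameChord x y u v ⊎ E (Fan T p″) x y → X x y k l → E (Fan T p″) k l → SameChord x y u v
      removed (inj₁ s) _ _ = s
      removed (inj₂ z) cr w = ⊥-elim (nc (Fan-Tri t p″ i″) z w cr)

  no-loop : ∀ {T : DSet n} → Tri T → ¬ SomeFlip T T
  no-loop t (_ , _ , _ , _ , f) = nc t (old f) (new f) (cross f)

  SomeFlip-sym : ∀ {S T : DSet n} → SomeFlip S T → SomeFlip T S
  SomeFlip-sym (_ , _ , _ , _ , f) = _ , _ , _ , _ , FlipE-rev f

  module _ {S S′ : DSet n} {e₁ e₂ f₁ f₂ : V n} (s : Tri S) (s′ : Tri S′) (f : FlipE S S′ e₁ e₂ f₁ f₂)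
           (p : Pentagon n) (i : Inscribed S p) (i′ : Inscribed S′ p) where
    open Pentagon p

    -- The new chord crosses the old one, a diagonal of p, so it is a diagonal of p as well. S and
    -- S′ then differ only where `Fan` overwrites them.
    Fan-same : e₁ ∈ᵖ p → e₂ ∈ᵖ p → Fan S p ≡ Fan S′ p
    Fan-same ie₁ ie₂ = Tri-ext (Fan-Tri s p i) (Fan-Tri s′ p i′)
      (λ z → let w , uv = ∈Fan⁻ S p z in ∈Fan S′ p ([ to , inj₂ ]′ w , uv))
      (λ z → let w , uv = ∈Fan⁻ S′ p z in ∈Fan S p ([ from , inj₂ ]′ w , uv))
      where
      in-SameChord : ∀ {x y u v} → u ∈ᵖ p → v ∈ᵖ p → SameChord x y u v → x ∈ᵖ p × y ∈ᵖ p
      in-SameChord iu iv (inj₁ (refl , refl)) = iu , iv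
      in-SameChord iu iv (inj₂ (refl , refl)) = iv , iu
      f∈ : f₁ ∈ᵖ p × f₂ ∈ᵖ p
      f∈ = inside-T s′ p i′ (new f) ie₁ ie₂ (X-sym {a = e₁} {e₂} {f₁} {f₂} (cross f))
      to : ∀ {x y} → E S x y → E S′ x y ⊎ (x ∈ᵖ p × y ∈ᵖ p)
      to z = Sum.swap (Sum.map₁ (in-SameChord ie₁ ie₂) (keep f z))
      from : ∀ {x y} → E S′ x y → E S x y ⊎ (x ∈ᵖ p × y ∈ᵖ p)
      from z = Sum.swap (Sum.map₁ (in-SameChord (proj₁ f∈) (proj₂ f∈)) (back f z))

    -- A chord of S crossing ac or ad would have both ends in p, so the exchanged chord survives in
    -- the fan. The new chord cannot join vertices of p either, since the old one crosses it.
    Fan-step : ¬ (e₁ ∈ᵖ p × e₂ ∈ᵖ p) → FlipE (Fan S p) (Fan S′ p) e₁ e₂ f₁ f₂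
    Fan-step ¬e∈ = record
      { cross = cross f
      ; old = ∈Fan S p (inj₁ (old f) , ¬e∈ ∘′ inside-T s p i (old f) isA isC , ¬e∈ ∘′ inside-T s p i (old f) isA isD)
      ; new = ∈Fan S′ p (inj₁ (new f) , ¬f∈ ∘′ inside-T s′ p i′ (new f) isA isC , ¬f∈ ∘′ inside-T s′ p i′ (new f) isA isD)
      ; keep = λ z → case ∈Fan⁻ S p z of λ
          { (inj₁ w , uv) → Sum.map₂ (λ w′ → ∈Fan S′ p (inj₁ w′ , uv)) (keep f w)
          ; (inj₂ w , uv) → inj₂ (∈Fan S′ p (inj₂ w , uv)) }
      ; back = λ z → case ∈Fan⁻ S′ p z of λ
          { (inj₁ w , uv) → Sum.map₂ (λ w′ → ∈Fan S p (inj₁ w′ , uv)) (back f w)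
          ; (inj₂ w , uv) → inj₂ (∈Fan S p (inj₂ w , uv)) } }
      where
      ¬f∈ : ¬ (f₁ ∈ᵖ p × f₂ ∈ᵖ p)
      ¬f∈ (if₁ , if₂) = ¬e∈ (inside-T s p i (old f) if₁ if₂ (cross f))

  nextⁿ : ℕ → Pentagon n → Pentagon n
  nextⁿ zero p = p
  nextⁿ (suc k) p = nextⁿ k (next p)

  orbit : DSet n → Pentagon n → Fin 5 → DSet n
  orbit T p k = Fan T (nextⁿ (toℕ k) p)

  Inscribed-nextⁿ : ∀ k {T : DSet n} {p} → Inscribed T p → Inscribed T (nextⁿ k p)
  Inscribed-nextⁿ zero i = i
  Inscribed-nextⁿ (suc k) i = Inscribed-nextⁿ k (Inscribed-next i)

  ∈-nextⁿ : ∀ k {x p} → x ∈ᵖ p → x ∈ᵖ nextⁿ k p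
  ∈-nextⁿ zero ix = ix
  ∈-nextⁿ (suc k) {p = p} ix = ∈-nextⁿ k (∈-next p ix)

  ∈-nextⁿ⁻ : ∀ k {x p} → x ∈ᵖ nextⁿ k p → x ∈ᵖ p
  ∈-nextⁿ⁻ zero ix = ix
  ∈-nextⁿ⁻ (suc k) {p = p} ix = ∈-next⁻ p (∈-nextⁿ⁻ k ix)

  module _ {T : DSet n} (t : Tri T) (p : Pentagon n) (i : Inscribed T p) where

    orbit-Tri : ∀ k → Tri (orbit T p k)
    orbit-Tri k = Fan-Tri t _ (Inscribed-nextⁿ (toℕ k) i)

    orbit-flip : ∀ k → SomeFlip (orbit T p k) (orbit T p (csuc k))
    orbit-flip 0F = _ , _ , _ , _ , Fan-flip t _ i
    orbit-flip 1F = _ , _ , _ , _ , Fan-flip t _ (Inscribed-nextⁿ 1 i)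
    orbit-flip 2F = _ , _ , _ , _ , Fan-flip t _ (Inscribed-nextⁿ 2 i)
    orbit-flip 3F = _ , _ , _ , _ , Fan-flip t _ (Inscribed-nextⁿ 3 i)
    orbit-flip 4F = _ , _ , _ , _ , Fan-flip t _ (Inscribed-nextⁿ 4 i)

    orbit-no-flip : ∀ k → ¬ SomeFlip (orbit T p k) (orbit T p (csuc (csuc k)))
    orbit-no-flip 0F = Fan-no-flip t _ i
    orbit-no-flip 1F = Fan-no-flip t _ (Inscribed-nextⁿ 1 i)
    orbit-no-flip 2F = Fan-no-flip t _ (Inscribed-nextⁿ 2 i)
    orbit-no-flip 3F = Fan-no-flip t _ (Inscribed-nextⁿ 3 i)
    orbit-no-flip 4F = Fan-no-flip t _ (Inscribed-nextⁿ 4 i)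

    -- The orbit is an induced 5-cycle of Γ, so any other enumeration of it as a cycle must follow
    -- it.
    orbit-adjacent : ∀ k l → SomeFlip (orbit T p k) (orbit T p l) → l ≡ csuc k ⊎ k ≡ csuc l
    orbit-adjacent k l f with trichotomy k l
      where
      trichotomy : ∀ (k l : Fin 5) → (l ≡ csuc k ⊎ k ≡ csuc l) ⊎ k ≡ l ⊎ l ≡ csuc (csuc k) ⊎ k ≡ csuc (csuc l)
      trichotomy 0F 0F = inj₂ (inj₁ refl)
      trichotomy 0F 1F = inj₁ (inj₁ refl)
      trichotomy 0F 2F = inj₂ (inj₂ (inj₁ refl))
      trichotomy 0F 3F = inj₂ (inj₂ (inj₂ refl))
      trichotomy 0F 4F = inj₁ (inj₂ refl)
      trichotomy 1F 0F = inj₁ (inj₂ refl)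
      trichotomy 1F 1F = inj₂ (inj₁ refl)
      trichotomy 1F 2F = inj₁ (inj₁ refl)
      trichotomy 1F 3F = inj₂ (inj₂ (inj₁ refl))
      trichotomy 1F 4F = inj₂ (inj₂ (inj₂ refl))
      trichotomy 2F 0F = inj₂ (inj₂ (inj₂ refl))
      trichotomy 2F 1F = inj₁ (inj₂ refl)
      trichotomy 2F 2F = inj₂ (inj₁ refl)
      trichotomy 2F 3F = inj₁ (inj₁ refl)
      trichotomy 2F 4F = inj₂ (inj₂ (inj₁ refl))
      trichotomy 3F 0F = inj₂ (inj₂ (inj₁ refl))
      trichotomy 3F 1F = inj₂ (inj₂ (inj₂ refl))
      trichotomy 3F 2F = inj₁ (inj₂ refl)
      trichotomy 3F 3F = inj₂ (inj₁ refl)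
      trichotomy 3F 4F = inj₁ (inj₁ refl)
      trichotomy 4F 0F = inj₁ (inj₁ refl)
      trichotomy 4F 1F = inj₂ (inj₂ (inj₁ refl))
      trichotomy 4F 2F = inj₂ (inj₂ (inj₂ refl))
      trichotomy 4F 3F = inj₁ (inj₂ refl)
      trichotomy 4F 4F = inj₂ (inj₁ refl)
    ... | inj₁ r = r
    ... | inj₂ (inj₁ refl) = ⊥-elim (no-loop (orbit-Tri k) f)
    ... | inj₂ (inj₂ (inj₁ refl)) = ⊥-elim (orbit-no-flip k f)
    ... | inj₂ (inj₂ (inj₂ refl)) = ⊥-elim (orbit-no-flip l (SomeFlip-sym f))

-- The triangulations of a geodesic 5-cycle

module _ {n : ℕ} where
  open Tri
  open FlipE
  open Inscribed

  label : Geodesic5 n → Pentagon n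
  label C = pentagon (v 0F) (v 1F) (v 2F) (v 3F) (v 4F)
    where v = Geodesic5.pent C

  E-mono : ∀ (F T : DSet n) → F ⊆D T → ∀ {x y} → E F x y → E T x y
  E-mono F T F⊆T = Sum.map₂ (Sum.map (F⊆T _ _) (F⊆T _ _))

  side⇒E : ∀ (F T : DSet n) → F ⊆D T → ∀ {u v} → IsSide F u v → E T u v
  side⇒E F T F⊆T (inj₁ e) = inj₁ (side-Adj e)
  side⇒E F T F⊆T (inj₂ (inj₁ (e , e′))) = inj₁ (base-Adj e e′)
  side⇒E F T F⊆T (inj₂ (inj₂ m)) = inj₂ (inj₁ (F⊆T _ _ m))

  module _ (C : Geodesic5 n) {T : DSet n} (t : Tri T) (F⊆T : Geodesic5.F C ⊆D T) where
    open Geodesic5 C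
    open Pentagon (label C)

    private
      v<v : ∀ p q → toℕ p ℕ.< toℕ q → pent p < pent q
      v<v = proj₁ (proj₂ pent-face)

      sides = proj₁ (proj₂ (proj₂ pent-face))
      inner = proj₂ (proj₂ (proj₂ pent-face))

      increasing : a < b × b < c × c < d × d < e
      increasing = v<v 0F 1F (s≤s z≤n) , v<v 1F 2F (s≤s (s≤s z≤n)) , v<v 2F 3F (s≤s (s≤s (s≤s z≤n)))
                 , v<v 3F 4F (s≤s (s≤s (s≤s (s≤s z≤n))))

      Inc′ : Fm
      Inc′ = 0 <′ 1 ∧′ 1 <′ 2 ∧′ 2 <′ 3 ∧′ 3 <′ 4

    inscribed : Inscribed T (label C)
    inscribed = record
      { cyc = solve (Inc′ ⇒′ Cyc5′ 0 1 2 3 4) 5 refl a (b ∷ c ∷ d ∷ e ∷ []) increasing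
      ; ab = side⇒E F T F⊆T (sides 0F 1F (s≤s z≤n) (inj₁ refl))
      ; bc = side⇒E F T F⊆T (sides 1F 2F (s≤s (s≤s z≤n)) (inj₁ refl))
      ; cd = side⇒E F T F⊆T (sides 2F 3F (s≤s (s≤s (s≤s z≤n))) (inj₁ refl))
      ; de = side⇒E F T F⊆T (sides 3F 4F (s≤s (s≤s (s≤s (s≤s z≤n)))) (inj₁ refl))
      ; ea = E-sym T (side⇒E F T F⊆T (sides 0F 4F (s≤s z≤n) (inj₂ (refl , refl)))) }

    private
      F∌ac : ¬ F ∋⟨ a , c ⟩
      F∌ac = inner 0F 2F (s≤s z≤n) λ { (inj₁ ()) ; (inj₂ (_ , ())) }
      F∌ad : ¬ F ∋⟨ a , d ⟩
      F∌ad = inner 0F 3F (s≤s z≤n) λ { (inj₁ ()) ; (inj₂ (_ , ())) }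
      F∌bd : ¬ F ∋⟨ b , d ⟩
      F∌bd = inner 1F 3F (s≤s (s≤s z≤n)) λ { (inj₁ ()) ; (inj₂ (() , _)) }
      F∌be : ¬ F ∋⟨ b , e ⟩
      F∌be = inner 1F 4F (s≤s (s≤s z≤n)) λ { (inj₁ ()) ; (inj₂ (() , _)) }
      F∌ce : ¬ F ∋⟨ c , e ⟩
      F∌ce = inner 2F 4F (s≤s (s≤s (s≤s z≤n))) λ { (inj₁ ()) ; (inj₂ (() , _)) }

      -- A chord of F crossing ac or ad would be a diagonal of the pentagon, and the face condition
      -- keeps all five of these out of F.
      F⇒InFan : ∀ {k l} → F ∋⟨ k , l ⟩ → InFan T (label C) k l
      F⇒InFan {k} {l} m = inj₁ kl , ¬ac , ¬ad
        where
        kl : E T k l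
        kl = inj₂ (inj₁ (F⊆T k l m))
        k<l : k < l
        k<l = proj₁ (diag t (F⊆T k l m))
        ¬ac : ¬ X k l a c
        ¬ac cr = let ik , il = inside-T t (label C) inscribed kl isA isC cr in
          case solve (Inc′ ⇒′ 5 <′ 6 ⇒′ In′ 0 1 2 3 4 5 ⇒′ In′ 0 1 2 3 4 6 ⇒′ X′ 5 6 0 2 ⇒′
                 ((5 ≡′ 1 ∧′ 6 ≡′ 3) ∨′ (5 ≡′ 1 ∧′ 6 ≡′ 4))) 7 refl a (b ∷ c ∷ d ∷ e ∷ k ∷ l ∷ []) increasing k<l ik il cr of λ
            { (inj₁ (refl , refl)) → F∌bd m ; (inj₂ (refl , refl)) → F∌be m }
        ¬ad : ¬ X k l a d
        ¬ad cr = let ik , il = inside-T t (label C) inscribed kl isA isD cr in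
          case solve (Inc′ ⇒′ 5 <′ 6 ⇒′ In′ 0 1 2 3 4 5 ⇒′ In′ 0 1 2 3 4 6 ⇒′ X′ 5 6 0 3 ⇒′
                 ((5 ≡′ 1 ∧′ 6 ≡′ 4) ∨′ (5 ≡′ 2 ∧′ 6 ≡′ 4))) 7 refl a (b ∷ c ∷ d ∷ e ∷ k ∷ l ∷ []) increasing k<l ik il cr of λ
            { (inj₁ (refl , refl)) → F∌be m ; (inj₂ (refl , refl)) → F∌ce m }

      P = label C

      -- Otherwise F, xy and two diagonals of the pentagon would be n + 1 pairwise non-crossing diagonals.
      too-many : ∀ {i j} → i < j → E T i j → ¬ E F i j → ¬ (i ∈ᵖ P × j ∈ᵖ P) → ⊥
      -- With truncated subtraction `n ≤ 2 + (n ∸ 2)` still holds, so `3 + (n ∸ 2) ≤ n` is absurd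
      -- for every n.
      too-many {i} {j} i<j ij ¬F ¬P = ℕP.<⇒≱ (s≤s (ℕP.m≤n+m∸n n 2))
          (subst (λ m → 3 ℕ.+ m ℕ.≤ n) (trans (positions-length F) F-size)
            (noncrossing-bound L unique (λ m → proj₁ (All.lookup good m)) (λ m m′ → InFan-nc t P inscribed (proj₂ (All.lookup good m)) (proj₂ (All.lookup good m′)))))
        where
        L : List (V n × V n)
        L = (i , j) ∷ (a , c) ∷ (a , d) ∷ positions F
        Good : V n × V n → Set
        Good (k , l) = (k < l × ¬ Adj k l) × InFan T P k l
        inF : ∀ {e} → e ∈ positions F → F ∋⟨ proj₁ e , proj₂ e ⟩
        inF = All.lookup (positions-true F)
        a<c : a < c
        a<c = v<v 0F 2F (s≤s z≤n)
        good : All Good L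
        good = ((i<j , ¬F ∘′ inj₁) , inj₁ ij , ¬P ∘′ inside-T t P inscribed ij isA isC , ¬P ∘′ inside-T t P inscribed ij isA isD)
             ∷ ((a<c , ac-diag) , ac∈Fan t P inscribed)
             ∷ ((v<v 0F 3F (s≤s z≤n) , ad-diag) , ad∈Fan t P inscribed)
             ∷ All.tabulate (λ m → diag t (F⊆T _ _ (inF m)) , F⇒InFan (inF m))
          where
          ac-diag : ¬ Adj a c
          ac-diag ad = Adj-¬X ad (solve (Inc′ ⇒′ X′ 0 2 1 3) 5 refl a (b ∷ c ∷ d ∷ e ∷ []) increasing)
          ad-diag : ¬ Adj a d
          ad-diag ad = Adj-¬X ad (solve (Inc′ ⇒′ X′ 0 3 1 4) 5 refl a (b ∷ c ∷ d ∷ e ∷ []) increasing)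
        unique : Unique L
        unique = ((λ { refl → ¬P (isA , isC) }) ∷ (λ { refl → ¬P (isA , isD) }) ∷ All.tabulate (λ { m refl → ¬F (inj₂ (inj₁ (inF m))) }))
               ∷ ((λ q → FinP.<⇒≢ (proj₁ (proj₂ (proj₂ increasing))) (cong proj₂ q)) ∷ All.tabulate (λ { m refl → F∌ac (inF m) }))
               ∷ All.tabulate (λ { m refl → F∌ad (inF m) })
               ∷ positions-unique F

    -- Says that the pentagon is the only region of the dissection left to choose; the reason is the
    -- count in `too-many`.
    chord-kinds : ∀ {x y} → E T x y → E F x y ⊎ (x ∈ᵖ P × y ∈ᵖ P)
    chord-kinds {x} {y} xy with E? F x y | ∈ᵖ? x P ×-dec ∈ᵖ? y P
    ... | yes f | _ = inj₁ f
    ... | no _ | yes i = inj₂ i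
    ... | no ¬f | no ¬i with sorted {x = x} {y} (λ { refl → ¬f (inj₁ Adj-refl) })
    ...   | i , j , s , i<j = ⊥-elim (too-many i<j (E-SameChord T s xy) (¬f ∘′ E-SameChord F (SameChord-sym s)) (λ ij → ¬i (unsort s ij)))
      where
      unsort : ∀ {i j x y} → SameChord i j x y → i ∈ᵖ P × j ∈ᵖ P → x ∈ᵖ P × y ∈ᵖ P
      unsort (inj₁ (refl , refl)) ij = ij
      unsort (inj₂ (refl , refl)) ij = swap ij

  module _ (C : Geodesic5 n) {T T′ : DSet n} (t : Tri T) (F⊆T : Geodesic5.F C ⊆D T)
           (t′ : Tri T′) (F⊆T′ : Geodesic5.F C ⊆D T′) where

    private
      P = label C
      F = Geodesic5.F C
      i′ = inscribed C t′ F⊆T′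
      open Pentagon P

      -- F and the pentagon account for all chords of T and T′, and inside the pentagon the two
      -- diagonals at one vertex leave no further choice.
      has-fan : ∀ k → let q = nextⁿ k P in E T′ (Pentagon.a q) (Pentagon.c q) → E T′ (Pentagon.a q) (Pentagon.d q) → T′ ≡ Fan T q
      has-fan k ac ad = Tri-ext t′ (Fan-Tri t q (Inscribed-nextⁿ k (inscribed C t F⊆T)))
        (λ z → ∈Fan T q (Sum.map (E-mono F T F⊆T) (λ (ix , iy) → ∈-nextⁿ k ix , ∈-nextⁿ k iy) (chord-kinds C t′ F⊆T′ z)
                        , nc t′ z ac , nc t′ z ad))
        (λ z → from (∈Fan⁻ T q z))
        where
        q = nextⁿ k P
        iq = Inscribed-nextⁿ k i′
        from : ∀ {x y} → InFan T q x y → E T′ x y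
        from {x} {y} (z , u , v) with [ chord-kinds C t F⊆T {x} {y} , (λ (ix , iy) → inj₂ (∈-nextⁿ⁻ k ix , ∈-nextⁿ⁻ k iy)) ]′ z
        ... | inj₁ f = E-mono F T′ F⊆T′ f
        ... | inj₂ (ix₀ , iy₀) = decidable-stable (E? T′ x y) λ ¬e →
          let ix = ∈-nextⁿ k ix₀
              iy = ∈-nextⁿ k iy₀
              g , h , w , cr = mx t′ ¬e
              ig , ih = inside-T t′ q iq w ix iy (X-sym {a = x} {y} {g} {h} cr)
          in both-in t′ q iq ix iy ig ih u v (nc t′ w ac) (nc t′ w ad) cr

      apex-ba : ∃ λ r → (r ≡ c ⊎ r ≡ d ⊎ r ≡ e) × E T′ b r × E T′ r a
      apex-ba =
        let r , bra , br , ra = apex t′ {b} {a} {c} (E-sym T′ (ab i′))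
               (solve (Cyc5′ 0 1 2 3 4 ⇒′ B′ 1 2 0) 5 refl a (b ∷ c ∷ d ∷ e ∷ []) (cyc i′))
        in r , solve (Cyc5′ 0 1 2 3 4 ⇒′ B′ 1 5 0 ⇒′ (X′ 5 0 1 2 ⇒′ ⊥′) ⇒′ (X′ 5 0 2 3 ⇒′ ⊥′) ⇒′ (X′ 5 0 3 4 ⇒′ ⊥′) ⇒′ (X′ 1 5 4 0 ⇒′ ⊥′)
                ⇒′ (5 ≡′ 2 ∨′ 5 ≡′ 3 ∨′ 5 ≡′ 4)) 6 refl a (b ∷ c ∷ d ∷ e ∷ r ∷ [])
               (cyc i′) bra (nc t′ ra (bc i′)) (nc t′ ra (cd i′)) (nc t′ ra (de i′)) (nc t′ br (ea i′)) , br , ra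

      apex-ca : E T′ c a → ∃ λ r → (r ≡ d ⊎ r ≡ e) × E T′ c r × E T′ r a
      apex-ca ca =
        let r , cra , cr , ra = apex t′ {c} {a} {d} ca
               (solve (Cyc5′ 0 1 2 3 4 ⇒′ B′ 2 3 0) 5 refl a (b ∷ c ∷ d ∷ e ∷ []) (cyc i′))
        in r , solve (Cyc5′ 0 1 2 3 4 ⇒′ B′ 2 5 0 ⇒′ (X′ 5 0 2 3 ⇒′ ⊥′) ⇒′ (X′ 5 0 3 4 ⇒′ ⊥′) ⇒′ (X′ 2 5 4 0 ⇒′ ⊥′)
                ⇒′ (5 ≡′ 3 ∨′ 5 ≡′ 4)) 6 refl a (b ∷ c ∷ d ∷ e ∷ r ∷ [])
               (cyc i′) cra (nc t′ ra (cd i′)) (nc t′ ra (de i′)) (nc t′ cr (ea i′)) , cr , ra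

      apex-be : E T′ b e → ∃ λ r → (r ≡ c ⊎ r ≡ d) × E T′ b r × E T′ r e
      apex-be be =
        let r , bre , br , re = apex t′ {b} {e} {c} be
               (solve (Cyc5′ 0 1 2 3 4 ⇒′ B′ 1 2 4) 5 refl a (b ∷ c ∷ d ∷ e ∷ []) (cyc i′))
        in r , solve (Cyc5′ 0 1 2 3 4 ⇒′ B′ 1 5 4 ⇒′ (X′ 5 4 1 2 ⇒′ ⊥′) ⇒′ (X′ 5 4 2 3 ⇒′ ⊥′) ⇒′ (X′ 1 5 3 4 ⇒′ ⊥′)
                ⇒′ (5 ≡′ 2 ∨′ 5 ≡′ 3)) 6 refl a (b ∷ c ∷ d ∷ e ∷ r ∷ [])
               (cyc i′) bre (nc t′ re (bc i′)) (nc t′ re (cd i′)) (nc t′ br (de i′)) , br , re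

    -- The triangle of T′ on the side ab has apex c, d or e. Apex d settles everything; c and e each
    -- leave a quadrilateral with two triangulations.
    enumerate : ∃ λ k → T′ ≡ orbit T P k
    enumerate with apex-ba
    ... | _ , inj₂ (inj₁ refl) , bd , da = 4F , has-fan 4 da (E-sym T′ bd)
    ... | _ , inj₁ refl , _ , ca = via-c (apex-ca ca)
      where
      via-c : (∃ λ r → (r ≡ d ⊎ r ≡ e) × E T′ c r × E T′ r a) → ∃ λ k → T′ ≡ orbit T P k
      via-c (_ , inj₁ refl , _ , da) = 0F , has-fan 0 (E-sym T′ ca) (E-sym T′ da)
      via-c (_ , inj₂ refl , ce , _) = 1F , has-fan 1 ce ca
    ... | _ , inj₂ (inj₂ refl) , be , _ = via-e (apex-be be)
      where
      via-e : (∃ λ r → (r ≡ c ⊎ r ≡ d) × E T′ b r × E T′ r e) → ∃ λ k → T′ ≡ orbit T P k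
      via-e (_ , inj₁ refl , _ , ce) = 2F , has-fan 2 (E-sym T′ be) (E-sym T′ ce)
      via-e (_ , inj₂ refl , bd , _) = 3F , has-fan 3 bd be

-- The chain of a geodesic 5-cycle

sum₅ : (Fin 5 → ℤ) → ℤ
sum₅ f = f 0F ℤ.+ (f 1F ℤ.+ (f 2F ℤ.+ (f 3F ℤ.+ (f 4F ℤ.+ + 0))))

cong₅ : ∀ {a b c d e a′ b′ c′ d′ e′ : ℤ} → a ≡ a′ → b ≡ b′ → c ≡ c′ → d ≡ d′ → e ≡ e′ →
  a ℤ.+ (b ℤ.+ (c ℤ.+ (d ℤ.+ (e ℤ.+ + 0)))) ≡ a′ ℤ.+ (b′ ℤ.+ (c′ ℤ.+ (d′ ℤ.+ (e′ ℤ.+ + 0))))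
cong₅ refl refl refl refl refl = refl

csuc⁵ : ∀ (k : Fin 5) → csuc (csuc (csuc (csuc (csuc k)))) ≡ k
csuc⁵ 0F = refl
csuc⁵ 1F = refl
csuc⁵ 2F = refl
csuc⁵ 3F = refl
csuc⁵ 4F = refl

csuc-injective : ∀ {k l : Fin 5} → csuc k ≡ csuc l → k ≡ l
csuc-injective {k} {l} e = trans (sym (csuc⁵ k)) (trans (cong (λ z → csuc (csuc (csuc (csuc z)))) e) (csuc⁵ l))

csuc²≢ : ∀ (k : Fin 5) → ¬ k ≡ csuc (csuc k)
csuc²≢ 0F ()
csuc²≢ 1F ()
csuc²≢ 2F ()
csuc²≢ 3F ()
csuc²≢ 4F ()

csuc-step : ∀ {P : Fin 5 → Set} → P 0F → (∀ k → P k → P (csuc k)) → ∀ k → P k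
csuc-step z s 0F = z
csuc-step z s 1F = s 0F z
csuc-step z s 2F = s 1F (s 0F z)
csuc-step z s 3F = s 2F (s 1F (s 0F z))
csuc-step z s 4F = s 3F (s 2F (s 1F (s 0F z)))

sum-around : ∀ (g : Fin 5 → ℤ) s →
  g s ℤ.+ (g (csuc s) ℤ.+ (g (csuc (csuc s)) ℤ.+ (g (csuc (csuc (csuc s))) ℤ.+ (g (csuc (csuc (csuc (csuc s)))) ℤ.+ + 0)))) ≡ sum₅ g
sum-around g = λ where
    0F → refl
    1F → lemma (g 0F) (g 1F) (g 2F) (g 3F) (g 4F)
    2F → trans (lemma (g 1F) (g 2F) (g 3F) (g 4F) (g 0F)) (lemma (g 0F) (g 1F) (g 2F) (g 3F) (g 4F))
    3F → trans (sym (lemma (g 3F) (g 4F) (g 0F) (g 1F) (g 2F))) (sym (lemma (g 4F) (g 0F) (g 1F) (g 2F) (g 3F)))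
    4F → sym (lemma (g 4F) (g 0F) (g 1F) (g 2F) (g 3F))
  where
  lemma : ∀ a b c d e → b ℤ.+ (c ℤ.+ (d ℤ.+ (e ℤ.+ (a ℤ.+ + 0)))) ≡ a ℤ.+ (b ℤ.+ (c ℤ.+ (d ℤ.+ (e ℤ.+ + 0))))
  lemma = ℤSolver.solve-∀

IsUnit : ℤ → Set
IsUnit k = k ≡ + 1 ⊎ k ≡ ℤ.- (+ 1)

-- A closed walk of length five without repetition on a pentagon winds around it once, in one of the two directions.
module _ (π : Fin 5 → Fin 5) (π-injective : ∀ {p q} → π p ≡ π q → p ≡ q)
         (π-adjacent : ∀ p → π (csuc p) ≡ csuc (π p) ⊎ π p ≡ csuc (π (csuc p))) where

  private
    direction : (∀ p → π (csuc p) ≡ csuc (π p)) ⊎ (∀ p → π p ≡ csuc (π (csuc p)))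
    direction with π-adjacent 0F
    ... | inj₁ e = inj₁ (csuc-step e λ p e′ →
            -- A change of direction would revisit the vertex of two steps before, against
            -- injectivity.
            [ (λ z → z) , (λ z → ⊥-elim (csuc²≢ p (π-injective (csuc-injective (trans (sym e′) z))))) ]′ (π-adjacent (csuc p)))
    ... | inj₂ e = inj₂ (csuc-step e λ p e′ →
            [ (λ z → ⊥-elim (csuc²≢ p (π-injective (trans e′ (sym z))))) , (λ z → z) ]′ (π-adjacent (csuc p)))

  module _ (ε : Fin 5 → Fin 5 → ℤ) where
    private
      g : Fin 5 → ℤ
      g k = ε k (csuc k)

    forward : (∀ p → π (csuc p) ≡ csuc (π p)) → sum₅ (λ p → ε (π p) (π (csuc p))) ≡ sum₅ g
    forward h = trans (cong₅ (term 0F) (term 1F) (term 2F) (term 3F) (term 4F))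
        (trans (cong₅ (refl {x = g (π 0F)}) (cong g e₁) (cong g e₂) (cong g e₃) (cong g e₄)) (sum-around g (π 0F)))
      where
      term : ∀ p → ε (π p) (π (csuc p)) ≡ g (π p)
      term p = cong (ε (π p)) (h p)
      e₁ : π 1F ≡ csuc (π 0F)
      e₁ = h 0F
      e₂ : π 2F ≡ csuc (csuc (π 0F))
      e₂ = trans (h 1F) (cong csuc e₁)
      e₃ : π 3F ≡ csuc (csuc (csuc (π 0F)))
      e₃ = trans (h 2F) (cong csuc e₂)
      e₄ : π 4F ≡ csuc (csuc (csuc (csuc (π 0F))))
      e₄ = trans (h 3F) (cong csuc e₃)

    backward : (∀ k → ε (csuc k) k ≡ ℤ.- ε k (csuc k)) → (∀ p → π p ≡ csuc (π (csuc p))) →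
      sum₅ (λ p → ε (π p) (π (csuc p))) ≡ ℤ.- sum₅ g
    backward ε-anti h = trans (cong₅ (term 0F) (term 1F) (term 2F) (term 3F) (term 4F))
        (trans (negate (g (π 1F)) (g (π 2F)) (g (π 3F)) (g (π 4F)) (g (π 0F)))
          (cong ℤ.-_ (trans (cong₅ (refl {x = g (π 0F)}) (cong g e₄) (cong g e₃) (cong g e₂) (cong g e₁)) (sum-around g (π 0F)))))
      where
      term : ∀ p → ε (π p) (π (csuc p)) ≡ ℤ.- g (π (csuc p))
      term p = trans (cong (λ z → ε z (π (csuc p))) (h p)) (ε-anti (π (csuc p)))
      negate : ∀ a b c d e → ℤ.- a ℤ.+ (ℤ.- b ℤ.+ (ℤ.- c ℤ.+ (ℤ.- d ℤ.+ (ℤ.- e ℤ.+ + 0)))) ≡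
        ℤ.- (e ℤ.+ (d ℤ.+ (c ℤ.+ (b ℤ.+ (a ℤ.+ + 0)))))
      negate = ℤSolver.solve-∀
      e₄ : π 4F ≡ csuc (π 0F)
      e₄ = h 4F
      e₃ : π 3F ≡ csuc (csuc (π 0F))
      e₃ = trans (h 3F) (cong csuc e₄)
      e₂ : π 2F ≡ csuc (csuc (csuc (π 0F)))
      e₂ = trans (h 2F) (cong csuc e₃)
      e₁ : π 1F ≡ csuc (csuc (csuc (csuc (π 0F))))
      e₁ = trans (h 1F) (cong csuc e₂)

  winding : ∃ λ k → IsUnit k × (∀ (ε : Fin 5 → Fin 5 → ℤ) → (∀ k → ε (csuc k) k ≡ ℤ.- ε k (csuc k)) →
    sum₅ (λ p → ε (π p) (π (csuc p))) ≡ k ℤ.* sum₅ (λ p → ε p (csuc p)))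
  winding with direction
  ... | inj₁ h = + 1 , inj₁ refl , λ ε _ → trans (forward ε h) (sym (ℤP.*-identityˡ _))
  ... | inj₂ h = ℤ.- (+ 1) , inj₂ refl , λ ε ε-anti → trans (backward ε ε-anti h) (sym (ℤP.-1*i≡-i _))

-- Distinctness matters: on a loop the first branch of `edge` wins in both directions, so the sign
-- would not change.
edge-anti : ∀ {n} {x y : DSet n} → ¬ x ≡ y → ∀ a b → edge y x a b (+ 1) ≡ ℤ.- edge x y a b (+ 1)
edge-anti {x = x} {y} ne a b with x ≟D a | y ≟D b | x ≟D b | y ≟D a
... | yes refl | yes refl | yes refl | _ = ⊥-elim (ne refl)
... | yes p | yes q | no r | yes s = refl
... | yes p | yes q | no r | no s = refl
... | yes p | no q | yes r | yes s = refl
... | yes p | no q | yes r | no s = refl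
... | yes p | no q | no r | yes s = refl
... | yes p | no q | no r | no s = refl
... | no p | yes q | yes r | yes s = refl
... | no p | yes q | yes r | no s = refl
... | no p | yes q | no r | yes s = refl
... | no p | yes q | no r | no s = refl
... | no p | no q | yes r | yes s = refl
... | no p | no q | yes r | no s = refl
... | no p | no q | no r | yes s = refl
... | no p | no q | no r | no s = refl

module _ {n : ℕ} where
  open Tri
  open FlipE
  open Inscribed

  flip-≢ : ∀ {S T : DSet n} → Tri S → SomeFlip S T → ¬ S ≡ T
  flip-≢ s f refl = no-loop s f

  orbitChain : DSet n → Pentagon n → Chain n
  orbitChain T p = map (λ k → (+ 1 , orbit T p k , orbit T p (csuc k))) (allFin 5)

  module _ {C : Geodesic5 n} (γ : Orientation C) where
    private
      open GCycle (Orientation.cyc γ)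
      P = label C

    vertex-Tri : ∀ p → Tri (w p)
    vertex-Tri p = toTri (w-tri p)

    base : DSet n
    base = w 0F

    base-inscribed : Inscribed base P
    base-inscribed = inscribed C (vertex-Tri 0F) (Orientation.⊇F γ 0F)

    private
      π : Fin 5 → Fin 5
      π p = proj₁ (enumerate C (vertex-Tri 0F) (Orientation.⊇F γ 0F) (vertex-Tri p) (Orientation.⊇F γ p))

      w≡ : ∀ p → w p ≡ orbit base P (π p)
      w≡ p = proj₂ (enumerate C (vertex-Tri 0F) (Orientation.⊇F γ 0F) (vertex-Tri p) (Orientation.⊇F γ p))

      winds = winding π
        (λ {p} {q} e → w-inj p q (trans (w≡ p) (trans (cong (orbit base P) e) (sym (w≡ q)))))
        (λ p → orbit-adjacent (vertex-Tri 0F) P base-inscribed (π p) (π (csuc p))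
          (subst₂ SomeFlip (w≡ p) (w≡ (csuc p)) (⇒FlipE (vertex-Tri p) (vertex-Tri (csuc p)) (w-adj p))))

    -- Each vertex of the given cycle is a fan over the first one, and successive fans are adjacent
    -- in Γ. Their positions form a walk to which `winding` applies; the unit is its direction.
    orientation-sign : ∃ λ k → IsUnit k × (∀ x y → coeff (orientedChain γ) x y ≡ k ℤ.* coeff (orbitChain base P) x y)
    orientation-sign = proj₁ winds , proj₁ (proj₂ winds) , λ x y →
      trans (along x y) (proj₂ (proj₂ winds) (λ k l → edge (orbit base P k) (orbit base P l) x y (+ 1))
        (λ k → edge-anti (flip-≢ (orbit-Tri (vertex-Tri 0F) P base-inscribed k) (orbit-flip (vertex-Tri 0F) P base-inscribed k)) x y))
      where
      along : ∀ x y → sum₅ (λ p → edge (w p) (w (csuc p)) x y (+ 1)) ≡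
        sum₅ (λ p → edge (orbit base P (π p)) (orbit base P (π (csuc p))) x y (+ 1))
      along x y = cong₅ (term 0F) (term 1F) (term 2F) (term 3F) (term 4F)
        where
        term : ∀ p → edge (w p) (w (csuc p)) x y (+ 1) ≡ edge (orbit base P (π p)) (orbit base P (π (csuc p))) x y (+ 1)
        term p = cong₂ (λ u v → edge u v x y (+ 1)) (w≡ p) (w≡ (csuc p))

-- Transport along flips, and the theorem

module _ {n : ℕ} where
  open Tri
  open FlipE
  open Inscribed

  coeff-∂₂ : ∀ k (σ : TwoCell n) β x y → coeff (∂₂ ((k , σ) ∷ β)) x y ≡ k ℤ.* coeff (cycleChain (TwoCell.cyc σ)) x y ℤ.+ coeff (∂₂ β) x y
  coeff-∂₂ k σ β x y = trans (coeff-++ (scale k (cycleChain (TwoCell.cyc σ))) (∂₂ β) x y)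
    (cong (ℤ._+ coeff (∂₂ β) x y) (coeff-scale k (cycleChain (TwoCell.cyc σ)) x y))

  coeff-∂₂-++ : ∀ (β β′ : List (ℤ × TwoCell n)) x y → coeff (∂₂ (β ++ β′)) x y ≡ coeff (∂₂ β) x y ℤ.+ coeff (∂₂ β′) x y
  coeff-∂₂-++ [] β′ x y = sym (ℤP.+-identityˡ _)
  coeff-∂₂-++ ((k , σ) ∷ β) β′ x y = trans (coeff-∂₂ k σ (β ++ β′) x y)
    (trans (cong (ℤ._+_ (k ℤ.* coeff (cycleChain (TwoCell.cyc σ)) x y)) (coeff-∂₂-++ β β′ x y))
      (trans (sym (ℤP.+-assoc (k ℤ.* coeff (cycleChain (TwoCell.cyc σ)) x y) (coeff (∂₂ β) x y) (coeff (∂₂ β′) x y)))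
        (cong (ℤ._+ coeff (∂₂ β′) x y) (sym (coeff-∂₂ k σ β x y)))))

  scaleCells : ℤ → List (ℤ × TwoCell n) → List (ℤ × TwoCell n)
  scaleCells k = map (λ (a , σ) → k ℤ.* a , σ)

  coeff-∂₂-scale : ∀ k (β : List (ℤ × TwoCell n)) x y → coeff (∂₂ (scaleCells k β)) x y ≡ k ℤ.* coeff (∂₂ β) x y
  coeff-∂₂-scale k [] x y = sym (ℤP.*-zeroʳ k)
  coeff-∂₂-scale k ((a , σ) ∷ β) x y = trans (coeff-∂₂ (k ℤ.* a) σ (scaleCells k β) x y)
    (trans (cong₂ ℤ._+_ (ℤP.*-assoc k a c) (coeff-∂₂-scale k β x y))
      (trans (sym (ℤP.*-distribˡ-+ k (a ℤ.* c) (coeff (∂₂ β) x y))) (cong (ℤ._*_ k) (sym (coeff-∂₂ a σ β x y)))))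
    where c = coeff (cycleChain (TwoCell.cyc σ)) x y

  Homologous-reflexive : ∀ {c c′ : Chain n} → c ≡ c′ → Homologous c c′
  Homologous-reflexive {c} refl = [] , λ x y → ℤP.+-inverseʳ (coeff c x y)

  Homologous-trans : ∀ {c d e : Chain n} → Homologous c d → Homologous d e → Homologous c e
  Homologous-trans {c} {d} {e} (β , h) (β′ , h′) = β ++ β′ , λ x y →
    trans (split (coeff c x y) (coeff d x y) (coeff e x y))
      (trans (cong₂ ℤ._+_ (h x y) (h′ x y)) (sym (coeff-∂₂-++ β β′ x y)))
    where split : ∀ a b c → a ℤ.- c ≡ (a ℤ.- b) ℤ.+ (b ℤ.- c)
          split = ℤSolver.solve-∀

  Homologous-scale : ∀ k {c c′ d d′ : Chain n} → (∀ x y → coeff c x y ≡ k ℤ.* coeff d x y) →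
    (∀ x y → coeff c′ x y ≡ k ℤ.* coeff d′ x y) → Homologous d d′ → Homologous c c′
  Homologous-scale k {c} {c′} {d} {d′} h h′ (β , b) = scaleCells k β , λ x y →
    trans (cong₂ ℤ._-_ (h x y) (h′ x y)) (trans (factor k (coeff d x y) (coeff d′ x y))
      (trans (cong (ℤ._*_ k) (b x y)) (sym (coeff-∂₂-scale k β x y))))
    where factor : ∀ k a b → k ℤ.* a ℤ.- k ℤ.* b ≡ k ℤ.* (a ℤ.- b)
          factor = ℤSolver.solve-∀

  module _ {T₀ T₁ T₂ T₃ : DSet n} (t₀ : Tri T₀) (t₁ : Tri T₁) (t₂ : Tri T₂) (t₃ : Tri T₃)
           (f₀₁ : SomeFlip T₀ T₁) (f₁₂ : SomeFlip T₁ T₂) (f₂₃ : SomeFlip T₂ T₃) (f₃₀ : SomeFlip T₃ T₀)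
           (ne₀₂ : ¬ T₀ ≡ T₂) (ne₁₃ : ¬ T₁ ≡ T₃) where

    private
      corner : Fin 4 → DSet n
      corner 0F = T₀
      corner 1F = T₁
      corner 2F = T₂
      corner 3F = T₃

      corner-Tri : ∀ p → Tri (corner p)
      corner-Tri 0F = t₀
      corner-Tri 1F = t₁
      corner-Tri 2F = t₂
      corner-Tri 3F = t₃

      corner-injective : ∀ p q → corner p ≡ corner q → p ≡ q
      corner-injective 0F 0F e = refl
      corner-injective 0F 1F e = ⊥-elim (flip-≢ t₀ f₀₁ e)
      corner-injective 0F 2F e = ⊥-elim (ne₀₂ e)
      corner-injective 0F 3F e = ⊥-elim (flip-≢ t₃ f₃₀ (sym e))
      corner-injective 1F 0F e = ⊥-elim (flip-≢ t₀ f₀₁ (sym e))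
      corner-injective 1F 1F e = refl
      corner-injective 1F 2F e = ⊥-elim (flip-≢ t₁ f₁₂ e)
      corner-injective 1F 3F e = ⊥-elim (ne₁₃ e)
      corner-injective 2F 0F e = ⊥-elim (ne₀₂ (sym e))
      corner-injective 2F 1F e = ⊥-elim (flip-≢ t₁ f₁₂ (sym e))
      corner-injective 2F 2F e = refl
      corner-injective 2F 3F e = ⊥-elim (flip-≢ t₂ f₂₃ e)
      corner-injective 3F 0F e = ⊥-elim (flip-≢ t₃ f₃₀ e)
      corner-injective 3F 1F e = ⊥-elim (ne₁₃ (sym e))
      corner-injective 3F 2F e = ⊥-elim (flip-≢ t₂ f₂₃ (sym e))
      corner-injective 3F 3F e = refl

      someFlip⇒ : ∀ {S T : DSet n} → Tri S → Tri T → SomeFlip S T → Flip S T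
      someFlip⇒ s t (_ , _ , _ , _ , f) = FlipE⇒ s t f

      corner-flip : ∀ p → Flip (corner p) (corner (csuc p))
      corner-flip 0F = someFlip⇒ t₀ t₁ f₀₁
      corner-flip 1F = someFlip⇒ t₁ t₂ f₁₂
      corner-flip 2F = someFlip⇒ t₂ t₃ f₂₃
      corner-flip 3F = someFlip⇒ t₃ t₀ f₃₀

      cell : TwoCell n
      cell = record { k = 3 ; k-ok = inj₂ refl ; cyc = record
        { w = corner ; w-tri = λ p → fromTri (corner-Tri p) ; w-inj = corner-injective ; w-adj = corner-flip } }

      coeff-square : ∀ x y → coeff (cycleChain (TwoCell.cyc cell)) x y ≡
        edge T₀ T₁ x y (+ 1) ℤ.- edge T₃ T₂ x y (+ 1) ℤ.+ (edge T₁ T₂ x y (+ 1) ℤ.- edge T₀ T₃ x y (+ 1))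
      coeff-square x y = trans (cong₂ (λ u v → edge T₀ T₁ x y (+ 1) ℤ.+ (edge T₁ T₂ x y (+ 1) ℤ.+ (u ℤ.+ (v ℤ.+ + 0))))
          (edge-anti {x = T₃} {T₂} (λ e → flip-≢ t₂ f₂₃ (sym e)) x y)
          (edge-anti {x = T₀} {T₃} (λ e → flip-≢ t₃ f₃₀ (sym e)) x y))
        (regroup (edge T₀ T₁ x y (+ 1)) (edge T₁ T₂ x y (+ 1)) (edge T₃ T₂ x y (+ 1)) (edge T₀ T₃ x y (+ 1)))
        where
        regroup : ∀ a b c d → a ℤ.+ (b ℤ.+ (ℤ.- c ℤ.+ (ℤ.- d ℤ.+ + 0))) ≡ a ℤ.- c ℤ.+ (b ℤ.- d)
        regroup = ℤSolver.solve-∀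

    -- The signs are grouped for summation around the prism: two opposite edges become parallel
    -- edges of the two 5-cycles, and the other two telescope.
    square : ∃ λ (σ : TwoCell n) → ∀ x y → coeff (cycleChain (TwoCell.cyc σ)) x y ≡
      edge T₀ T₁ x y (+ 1) ℤ.- edge T₃ T₂ x y (+ 1) ℤ.+ (edge T₁ T₂ x y (+ 1) ℤ.- edge T₀ T₃ x y (+ 1))
    square = cell , coeff-square

  -- Rules out coinciding opposite corners of a tile: one corner contains ad, the other ce, and
  -- these cross.
  Fan-distinct : ∀ {S S′ : DSet n} {p} → Tri S → Tri S′ → Inscribed S p → Inscribed S′ p → ¬ Fan S p ≡ Fan S′ (next p)
  Fan-distinct {S} {S′} {p} s s′ i i′ e = nc (Fan-Tri s′ (next p) (Inscribed-next i′))
    (subst (λ T → E T _ _) e (old (Fan-flip s p i))) (new (Fan-flip s′ p i′)) (cross (Fan-flip s p i))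

  orbit-distinct : ∀ {S S′ : DSet n} {p} → Tri S → Tri S′ → Inscribed S p → Inscribed S′ p →
    ∀ k → ¬ orbit S p k ≡ orbit S′ p (csuc k)
  orbit-distinct s s′ i i′ 0F = Fan-distinct s s′ i i′
  orbit-distinct s s′ i i′ 1F = Fan-distinct s s′ (Inscribed-nextⁿ 1 i) (Inscribed-nextⁿ 1 i′)
  orbit-distinct s s′ i i′ 2F = Fan-distinct s s′ (Inscribed-nextⁿ 2 i) (Inscribed-nextⁿ 2 i′)
  orbit-distinct s s′ i i′ 3F = Fan-distinct s s′ (Inscribed-nextⁿ 3 i) (Inscribed-nextⁿ 3 i′)
  orbit-distinct s s′ i i′ 4F = Fan-distinct s s′ (Inscribed-nextⁿ 4 i) (Inscribed-nextⁿ 4 i′)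

  module _ {S S′ : DSet n} {p : Pentagon n} (s : Tri S) (s′ : Tri S′) (i : Inscribed S p) (i′ : Inscribed S′ p)
           (vertical : ∀ k → SomeFlip (orbit S p k) (orbit S′ p k)) where

    private
      Q Q′ : Fin 5 → DSet n
      Q = orbit S p
      Q′ = orbit S′ p

      tiled : ∀ k → ∃ λ (σ : TwoCell n) → ∀ x y → coeff (cycleChain (TwoCell.cyc σ)) x y ≡
        edge (Q k) (Q (csuc k)) x y (+ 1) ℤ.- edge (Q′ k) (Q′ (csuc k)) x y (+ 1) ℤ.+
        (edge (Q (csuc k)) (Q′ (csuc k)) x y (+ 1) ℤ.- edge (Q k) (Q′ k) x y (+ 1))
      tiled k = square (orbit-Tri s p i k) (orbit-Tri s p i (csuc k)) (orbit-Tri s′ p i′ (csuc k)) (orbit-Tri s′ p i′ k)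
        (orbit-flip s p i k) (vertical (csuc k)) (SomeFlip-sym (orbit-flip s′ p i′ k)) (SomeFlip-sym (vertical k))
        (orbit-distinct s s′ i i′ k) (λ e → orbit-distinct s′ s i′ i k (sym e))

      tile : Fin 5 → TwoCell n
      tile k = proj₁ (tiled k)

      tiles : List (ℤ × TwoCell n)
      tiles = map (λ k → + 1 , tile k) (allFin 5)

    prism : Homologous (orbitChain S p) (orbitChain S′ p)
    prism = tiles , λ x y → sym (trans (boundary (allFin 5) x y) (telescope
        (A x y 0F) (A x y 1F) (A x y 2F) (A x y 3F) (A x y 4F) (A′ x y 0F) (A′ x y 1F) (A′ x y 2F) (A′ x y 3F) (A′ x y 4F)
        (D x y 0F) (D x y 1F) (D x y 2F) (D x y 3F) (D x y 4F)))
      where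
      A A′ D : DSet n → DSet n → Fin 5 → ℤ
      A x y k = edge (Q k) (Q (csuc k)) x y (+ 1)
      A′ x y k = edge (Q′ k) (Q′ (csuc k)) x y (+ 1)
      D x y k = edge (Q k) (Q′ k) x y (+ 1)
      R : DSet n → DSet n → Fin 5 → ℤ
      R x y k = A x y k ℤ.- A′ x y k ℤ.+ (D x y (csuc k) ℤ.- D x y k)
      boundary : ∀ ks x y → coeff (∂₂ (map (λ k → + 1 , tile k) ks)) x y ≡ foldr (λ k z → R x y k ℤ.+ z) (+ 0) ks
      boundary [] x y = refl
      boundary (k ∷ ks) x y = trans (coeff-∂₂ (+ 1) (tile k) (map (λ k → + 1 , tile k) ks) x y)
        (cong₂ ℤ._+_ (trans (ℤP.*-identityˡ (coeff (cycleChain (TwoCell.cyc (tile k))) x y)) (proj₂ (tiled k) x y)) (boundary ks x y))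
      telescope : ∀ a₀ a₁ a₂ a₃ a₄ b₀ b₁ b₂ b₃ b₄ d₀ d₁ d₂ d₃ d₄ →
        a₀ ℤ.- b₀ ℤ.+ (d₁ ℤ.- d₀) ℤ.+ (a₁ ℤ.- b₁ ℤ.+ (d₂ ℤ.- d₁) ℤ.+ (a₂ ℤ.- b₂ ℤ.+ (d₃ ℤ.- d₂) ℤ.+
          (a₃ ℤ.- b₃ ℤ.+ (d₄ ℤ.- d₃) ℤ.+ (a₄ ℤ.- b₄ ℤ.+ (d₀ ℤ.- d₄) ℤ.+ + 0)))) ≡
        (a₀ ℤ.+ (a₁ ℤ.+ (a₂ ℤ.+ (a₃ ℤ.+ (a₄ ℤ.+ + 0))))) ℤ.- (b₀ ℤ.+ (b₁ ℤ.+ (b₂ ℤ.+ (b₃ ℤ.+ (b₄ ℤ.+ + 0)))))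
      telescope = ℤSolver.solve-∀

  -- A flip inside the pentagon does not move the orbit; any other flip carries over to all five
  -- fans and gives the lateral edges of a prism.
  flip-homologous : ∀ {S S′ : DSet n} {p} → Tri S → Tri S′ → SomeFlip S S′ → Inscribed S p → Inscribed S′ p →
    Homologous (orbitChain S p) (orbitChain S′ p)
  flip-homologous {S} {S′} {p} s s′ (e₁ , e₂ , f₁ , f₂ , f) i i′ with ∈ᵖ? e₁ p ×-dec ∈ᵖ? e₂ p
  ... | yes (ie₁ , ie₂) = Homologous-reflexive (ListP.map-cong (λ k → cong₂ (λ u v → + 1 , u , v) (same k) (same (csuc k))) (allFin 5))
    where
    same : ∀ k → orbit S p k ≡ orbit S′ p k
    same k = Fan-same s s′ f _ (Inscribed-nextⁿ (toℕ k) i) (Inscribed-nextⁿ (toℕ k) i′) (∈-nextⁿ (toℕ k) ie₁) (∈-nextⁿ (toℕ k) ie₂)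
  ... | no ¬ie = prism s s′ i i′ λ k → _ , _ , _ , _ , Fan-step s s′ f _ (Inscribed-nextⁿ (toℕ k) i) (Inscribed-nextⁿ (toℕ k) i′)
          (λ (u , v) → ¬ie (∈-nextⁿ⁻ (toℕ k) u , ∈-nextⁿ⁻ (toℕ k) v))

  path-homologous : ∀ {K : V n → V n → Set} {S T : DSet n} {p} → Tri S → Inscribed S p →
    (let open Pentagon p in K a b × K b c × K c d × K d e × K e a) →
    Path K S T → Homologous (orbitChain S p) (orbitChain T p)
  path-homologous {S = S} {p = p} s i ks stop = Homologous-reflexive {orbitChain S p} refl
  path-homologous {S = S₀} {T} {p} s i ks@(k₁ , k₂ , k₃ , k₄ , k₅) (step {S = S} s′ f K⊆S path) =
    Homologous-trans {orbitChain S₀ p} {orbitChain S p} {orbitChain T p} (flip-homologous s s′ f i i′) (path-homologous s′ i′ ks path)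
    where
    i′ : Inscribed S p
    i′ = record { cyc = cyc i ; ab = K⊆S k₁ ; bc = K⊆S k₂ ; cd = K⊆S k₃ ; de = K⊆S k₄ ; ea = K⊆S k₅ }

  orbits-homologous : ∀ {T T′ : DSet n} {p} → Tri T → Tri T′ → Inscribed T p → Inscribed T′ p →
    Homologous (orbitChain T p) (orbitChain T′ p)
  orbits-homologous t t′ i i′ = path-homologous t i
    ((ab i , ab i′) , (bc i , bc i′) , (cd i , cd i′) , (de i , de i′) , (ea i , ea i′)) (connected t t′)

  orientation-homologous : ∀ {C C′ : Geodesic5 n} (γ : Orientation C) (γ′ : Orientation C′) → label C ≡ label C′ → EquivA γ γ′
  orientation-homologous {C} {C′} γ γ′ e = compare-signs (orientation-sign γ) (orientation-sign γ′)
    where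
    P = label C
    same : Homologous (orbitChain (base γ) P) (orbitChain (base γ′) (label C′))
    same = subst (λ q → Homologous (orbitChain (base γ) P) (orbitChain (base γ′) q)) e
      (orbits-homologous (vertex-Tri γ 0F) (vertex-Tri γ′ 0F) (base-inscribed γ) (subst (Inscribed (base γ′)) (sym e) (base-inscribed γ′)))
    compare-signs :
      (∃ λ k → IsUnit k × (∀ x y → coeff (orientedChain γ) x y ≡ k ℤ.* coeff (orbitChain (base γ) P) x y)) →
      (∃ λ k → IsUnit k × (∀ x y → coeff (orientedChain γ′) x y ≡ k ℤ.* coeff (orbitChain (base γ′) (label C′)) x y)) → EquivA γ γ′
    -- Equal units give the first alternative of `EquivA`; opposite ones are absorbed by reversing
    -- the second cycle.
    compare-signs (k , u , h) (k′ , u′ , h′) with k ℤ.≟ k′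
    ... | yes refl = inj₁ (Homologous-scale k {orientedChain γ} {orientedChain γ′} {orbitChain (base γ) P} {orbitChain (base γ′) (label C′)} h h′ same)
    ... | no ne = inj₂ (Homologous-scale k {orientedChain γ} {neg (orientedChain γ′)} {orbitChain (base γ) P} {orbitChain (base γ′) (label C′)} h
        (λ x y → trans (coeff-scale (ℤ.- (+ 1)) (orientedChain γ′) x y) (trans (cong (ℤ._*_ (ℤ.- (+ 1))) (h′ x y))
          (trans (sym (ℤP.*-assoc (ℤ.- (+ 1)) k′ (coeff (orbitChain (base γ′) (label C′)) x y)))
            (cong (ℤ._* coeff (orbitChain (base γ′) (label C′)) x y) (opposite u u′ ne))))) same)
      where
      opposite : ∀ {k k′} → IsUnit k → IsUnit k′ → ¬ k ≡ k′ → ℤ.- (+ 1) ℤ.* k′ ≡ k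
      opposite (inj₁ refl) (inj₁ refl) ne = ⊥-elim (ne refl)
      opposite (inj₁ refl) (inj₂ refl) ne = refl
      opposite (inj₂ refl) (inj₁ refl) ne = refl
      opposite (inj₂ refl) (inj₂ refl) ne = ⊥-elim (ne refl)

  private
    Increasing : (Fin 5 → V n) → Set
    Increasing v = ∀ p q → toℕ p ℕ.< toℕ q → toℕ (v p) ℕ.< toℕ (v q)

    -- Writing v = w ∘ f, the map f is strictly increasing on `Fin 5`, so f p ≥ p. Used both ways,
    -- it turns equal vertex sets into equal enumerations.
    increasing-≤ : ∀ {v w} → Increasing v → Increasing w → (∀ p → ∃ λ q → w q ≡ v p) → ∀ p → toℕ (w p) ℕ.≤ toℕ (v p)
    increasing-≤ {v} {w} v< w< sub p = subst (λ z → toℕ (w p) ℕ.≤ toℕ z) (proj₂ (sub p)) (w-mono (f-above p))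
      where
      f : Fin 5 → Fin 5
      f p = proj₁ (sub p)
      w-mono : ∀ {p q} → toℕ p ℕ.≤ toℕ q → toℕ (w p) ℕ.≤ toℕ (w q)
      w-mono {p} {q} le with ℕP.m≤n⇒m<n∨m≡n le
      ... | inj₁ lt = ℕP.<⇒≤ (w< p q lt)
      ... | inj₂ e = ℕP.≤-reflexive (cong (toℕ ∘′ w) (FinP.toℕ-injective e))
      f-mono : ∀ {p q} → toℕ p ℕ.< toℕ q → toℕ (f p) ℕ.< toℕ (f q)
      f-mono {p} {q} lt = ℕP.≰⇒> λ ge → ℕP.<⇒≱ (v< p q lt)
        (subst₂ (λ a b → toℕ a ℕ.≤ toℕ b) (proj₂ (sub q)) (proj₂ (sub p)) (w-mono ge))
      above₁ : 1 ℕ.≤ toℕ (f 1F)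
      above₁ = ℕP.≤-trans (s≤s z≤n) (f-mono {0F} {1F} (s≤s z≤n))
      above₂ : 2 ℕ.≤ toℕ (f 2F)
      above₂ = ℕP.≤-trans (s≤s above₁) (f-mono {1F} {2F} (s≤s (s≤s z≤n)))
      above₃ : 3 ℕ.≤ toℕ (f 3F)
      above₃ = ℕP.≤-trans (s≤s above₂) (f-mono {2F} {3F} (s≤s (s≤s (s≤s z≤n))))
      f-above : ∀ p → toℕ p ℕ.≤ toℕ (f p)
      f-above 0F = z≤n
      f-above 1F = above₁
      f-above 2F = above₂
      f-above 3F = above₃
      f-above 4F = ℕP.≤-trans (s≤s above₃) (f-mono {3F} {4F} (s≤s (s≤s (s≤s (s≤s z≤n)))))

  SameLabel⇒≡ : ∀ (C C′ : Geodesic5 n) → SameLabel C C′ → label C ≡ label C′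
  SameLabel⇒≡ C C′ same = pentagon-≡ (eq 0F) (eq 1F) (eq 2F) (eq 3F) (eq 4F)
    where
    v< = proj₁ (proj₂ (Geodesic5.pent-face C))
    v′< = proj₁ (proj₂ (Geodesic5.pent-face C′))
    eq : ∀ p → Geodesic5.pent C p ≡ Geodesic5.pent C′ p
    eq p = FinP.toℕ-injective (ℕP.≤-antisym
      (increasing-≤ v′< v< (λ q → Equivalence.from (same _) (q , refl)) p)
      (increasing-≤ v< v′< (λ q → Equivalence.to (same _) (q , refl)) p))
    pentagon-≡ : ∀ {a b c d e a′ b′ c′ d′ e′ : V n} → a ≡ a′ → b ≡ b′ → c ≡ c′ → d ≡ d′ → e ≡ e′ →
      pentagon a b c d e ≡ pentagon a′ b′ c′ d′ e′
    pentagon-≡ refl refl refl refl refl = refl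

  -- The cochain recovers the label

  module _ {T : DSet n} (t : Tri T) (p : Pentagon n) (i : Inscribed T p) where
    open Pentagon p

    ac×bd : X a c b d
    ac×bd = solve (Cyc5′ 0 1 2 3 4 ⇒′ X′ 0 2 1 3) 5 refl a (b ∷ c ∷ d ∷ e ∷ []) (cyc i)

    private
      φ : DSet n → DSet n → ℤ
      φ = swaps a c b d ac×bd

      Q : Fin 5 → DSet n
      Q = orbit T p

      Qt : ∀ k → Tri (Q k)
      Qt = orbit-Tri t p i

      first-diagonal : ∀ k → let q = nextⁿ (toℕ k) p in E (Q k) (Pentagon.a q) (Pentagon.c q)
      first-diagonal k = ∈Fan T _ (ac∈Fan t _ (Inscribed-nextⁿ (toℕ k) i))

      second-diagonal : ∀ k → let q = nextⁿ (toℕ k) p in E (Q k) (Pentagon.a q) (Pentagon.d q)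
      second-diagonal k = ∈Fan T _ (ad∈Fan t _ (Inscribed-nextⁿ (toℕ k) i))

      excluded : ∀ {k x y u v} → E (Q k) u v → X u v x y → ¬ E (Q k) x y
      excluded {k} z cr w = nc (Qt k) z w cr

      bd×ac : X b d a c
      bd×ac = X-sym {a = a} {c} {b} {d} ac×bd

      ac∈₀ : E (Q 0F) a c
      ac∈₀ = first-diagonal 0F
      bd∈₄ : E (Q 4F) b d
      bd∈₄ = E-sym (Q 4F) (second-diagonal 4F)
      bd∉₀ : ¬ E (Q 0F) b d
      bd∉₀ = excluded {0F} ac∈₀ ac×bd
      bd∉₁ : ¬ E (Q 1F) b d
      bd∉₁ = excluded {1F} (E-sym (Q 1F) (second-diagonal 1F)) ac×bd
      bd∉₂ : ¬ E (Q 2F) b d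
      bd∉₂ = excluded {2F} (second-diagonal 2F) (solve (Cyc5′ 0 1 2 3 4 ⇒′ X′ 4 2 1 3) 5 refl a (b ∷ c ∷ d ∷ e ∷ []) (cyc i))
      ac∉₂ : ¬ E (Q 2F) a c
      ac∉₂ = excluded {2F} (first-diagonal 2F) (solve (Cyc5′ 0 1 2 3 4 ⇒′ X′ 4 1 0 2) 5 refl a (b ∷ c ∷ d ∷ e ∷ []) (cyc i))
      ac∉₃ : ¬ E (Q 3F) a c
      ac∉₃ = excluded {3F} (first-diagonal 3F) bd×ac
      ac∉₄ : ¬ E (Q 4F) a c
      ac∉₄ = excluded {4F} bd∈₄ bd×ac

      vanish : ∀ {S S′ : DSet n} → ¬ (E S a c × E S′ b d) → ¬ (E S b d × E S′ a c) → φ S S′ ≡ + 0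
      vanish {S} {S′} f g = cong₂ ℤ._-_ (⟪⟫-false (E? S a c ×-dec E? S′ b d) f) (⟪⟫-false (E? S b d ×-dec E? S′ a c) g)

    -- Along the fans at a, c, e, b, d only the closing flip, from d back to a, involves both
    -- chords: it replaces bd by ac and counts -1.
    pairing-orbit : pairing φ (orbitChain T p) ≡ ℤ.- (+ 1)
    pairing-orbit = cong₅
      (cong (ℤ._*_ (+ 1)) (vanish (bd∉₁ ∘′ proj₂) (bd∉₀ ∘′ proj₁)))
      (cong (ℤ._*_ (+ 1)) (vanish (bd∉₂ ∘′ proj₂) (bd∉₁ ∘′ proj₁)))
      (cong (ℤ._*_ (+ 1)) (vanish (ac∉₂ ∘′ proj₁) (bd∉₂ ∘′ proj₁)))
      (cong (ℤ._*_ (+ 1)) (vanish (ac∉₃ ∘′ proj₁) (ac∉₄ ∘′ proj₂)))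
      (cong (ℤ._*_ (+ 1)) (cong₂ ℤ._-_ (⟪⟫-false (E? (Q 4F) a c ×-dec E? (Q 0F) b d) (ac∉₄ ∘′ proj₁))
                                       (⟪⟫-true (E? (Q 4F) b d ×-dec E? (Q 0F) a c) (bd∈₄ , ac∈₀))))

  -- Five applications of `next` are definitionally the identity, so the orbit of `next p` is that
  -- of p shifted by one place.
  pairing-next : ∀ φ T (p : Pentagon n) → pairing φ (orbitChain T (next p)) ≡ pairing φ (orbitChain T p)
  pairing-next φ T p = sum-around (λ k → + 1 ℤ.* φ (orbit T p k) (orbit T p (csuc k))) 1F

  module _ {α₁ α₂ β₁ β₂ : V n} (αβ : X α₁ α₂ β₁ β₂) where
    private
      φ = swaps α₁ α₂ β₁ β₂ αβ
      φ-anti = swaps-anti α₁ α₂ β₁ β₂ αβ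

    Detects : ∀ {C : Geodesic5 n} → Orientation C → Set
    Detects γ = ¬ pairing φ (orientedChain γ) ≡ + 0

    detects-unit : ∀ {C : Geodesic5 n} (γ : Orientation C) → pairing φ (orbitChain (base γ) (label C)) ≡ ℤ.- (+ 1) → Detects γ
    detects-unit {C} γ e z = unit-≢0 (proj₁ (proj₂ sign)) (trans (sym (trans
        (pairing-linear φ φ-anti (proj₁ sign) (orientedChain γ) (orbitChain (base γ) (label C)) (proj₂ (proj₂ sign)))
        (cong (ℤ._*_ (proj₁ sign)) e))) z)
      where
      sign = orientation-sign γ
      unit-≢0 : ∀ {k} → IsUnit k → ¬ k ℤ.* ℤ.- (+ 1) ≡ + 0
      unit-≢0 (inj₁ refl) ()
      unit-≢0 (inj₂ refl) ()

    EquivA⇒Detects : ∀ {C C′ : Geodesic5 n} (γ : Orientation C) (γ′ : Orientation C′) → EquivA γ γ′ →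
      (Detects γ → Detects γ′) × (Detects γ′ → Detects γ)
    EquivA⇒Detects γ γ′ (inj₁ h) = (λ d z → d (trans e z)) , (λ d z → d (trans (sym e) z))
      where
      e : pairing φ (orientedChain γ) ≡ pairing φ (orientedChain γ′)
      e = pairing-homologous φ φ-anti (swaps-∂₂ α₁ α₂ β₁ β₂ αβ) {orientedChain γ} {orientedChain γ′} h
    EquivA⇒Detects γ γ′ (inj₂ h) = (λ d z → d (trans e (cong ℤ.-_ z))) , (λ d z → d (ℤP.neg-injective (trans (sym e) z)))
      where
      e : pairing φ (orientedChain γ) ≡ ℤ.- pairing φ (orientedChain γ′)
      e = trans (pairing-homologous φ φ-anti (swaps-∂₂ α₁ α₂ β₁ β₂ αβ) {orientedChain γ} {neg (orientedChain γ′)} h)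
            (trans (pairing-scale φ (ℤ.- (+ 1)) (orientedChain γ′)) (ℤP.-1*i≡-i _))

    detects⇒∈ : ∀ {C : Geodesic5 n} (γ : Orientation C) → Detects γ →
      (α₁ ∈ᵖ label C × α₂ ∈ᵖ label C) × (β₁ ∈ᵖ label C × β₂ ∈ᵖ label C)
    detects⇒∈ {C} γ d with FinP.any? (λ p → ¬? (φ (w p) (w (csuc p)) ℤ.≟ + 0))
      where open GCycle (Orientation.cyc γ)
    ... | no none = ⊥-elim (d (cong₅ (z 0F) (z 1F) (z 2F) (z 3F) (z 4F)))
      where
      open GCycle (Orientation.cyc γ)
      z : ∀ p → + 1 ℤ.* φ (w p) (w (csuc p)) ≡ + 0
      z p = cong (ℤ._*_ (+ 1)) (decidable-stable (φ (w p) (w (csuc p)) ℤ.≟ + 0) λ ne → none (p , ne))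
    ... | yes (p , ne) = found (E? (w p) α₁ α₂ ×-dec E? (w (csuc p)) β₁ β₂) (E? (w p) β₁ β₂ ×-dec E? (w (csuc p)) α₁ α₂)
      where
      open GCycle (Orientation.cyc γ)
      F = Geodesic5.F C
      -- A chord of F lies in every vertex of the cycle, so it cannot cross a chord of another vertex.
      flipped : ∀ q r {x y u v} → E (w q) x y → E (w r) u v → X x y u v → x ∈ᵖ label C × y ∈ᵖ label C
      flipped q r xy uv cr with chord-kinds C (vertex-Tri γ q) (Orientation.⊇F γ q) xy
      ... | inj₂ r∈ = r∈
      ... | inj₁ f = ⊥-elim (nc (vertex-Tri γ r) (E-mono F (w r) (Orientation.⊇F γ r) f) uv cr)
      βα : X β₁ β₂ α₁ α₂
      βα = X-sym {a = α₁} {α₂} {β₁} {β₂} αβ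
      found : Dec (E (w p) α₁ α₂ × E (w (csuc p)) β₁ β₂) → Dec (E (w p) β₁ β₂ × E (w (csuc p)) α₁ α₂) →
        (α₁ ∈ᵖ label C × α₂ ∈ᵖ label C) × (β₁ ∈ᵖ label C × β₂ ∈ᵖ label C)
      found (yes (u , v)) _ = flipped p (csuc p) u v αβ , flipped (csuc p) p v u βα
      found (no _) (yes (u , v)) = flipped (csuc p) p v u αβ , flipped p (csuc p) u v βα
      found (no f) (no g) = ⊥-elim (ne (cong₂ ℤ._-_ (⟪⟫-false (E? (w p) α₁ α₂ ×-dec E? (w (csuc p)) β₁ β₂) f)
        (⟪⟫-false (E? (w p) β₁ β₂ ×-dec E? (w (csuc p)) α₁ α₂) g)))

  -- The pair ac, bd accounts for four vertices. The rotated pair ce, da, which is the same pair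
  -- taken at `next P`, supplies e.
  label-⊆ : ∀ {C C′ : Geodesic5 n} (γ : Orientation C) (γ′ : Orientation C′) →
    (∀ {α₁ α₂ β₁ β₂} (αβ : X α₁ α₂ β₁ β₂) → Detects αβ γ → Detects αβ γ′) → ∀ {x} → x ∈ᵖ label C → x ∈ᵖ label C′
  label-⊆ {C} {C′} γ γ′ transfer = member
    where
    P = label C
    open Pentagon P
    t = vertex-Tri γ 0F
    i = base-inscribed γ
    first-four = detects⇒∈ (ac×bd t P i) γ′ (transfer (ac×bd t P i) (detects-unit (ac×bd t P i) γ (pairing-orbit t P i)))
    i⁺ = Inscribed-next i
    last-four = detects⇒∈ (ac×bd t (next P) i⁺) γ′ (transfer (ac×bd t (next P) i⁺) (detects-unit (ac×bd t (next P) i⁺) γ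
      (trans (sym (pairing-next (swaps c e d a (ac×bd t (next P) i⁺)) (base γ) P)) (pairing-orbit t (next P) i⁺))))
    member : ∀ {x} → x ∈ᵖ P → x ∈ᵖ label C′
    member isA = proj₁ (proj₁ first-four)
    member isB = proj₁ (proj₂ first-four)
    member isC = proj₂ (proj₁ first-four)
    member isD = proj₂ (proj₂ first-four)
    member isE = proj₂ (proj₁ last-four)

  ∈label⇒ : ∀ (C : Geodesic5 n) {x} → x ∈ᵖ label C → ∃[ p ] Geodesic5.pent C p ≡ x
  ∈label⇒ C isA = 0F , refl
  ∈label⇒ C isB = 1F , refl
  ∈label⇒ C isC = 2F , refl
  ∈label⇒ C isD = 3F , refl
  ∈label⇒ C isE = 4F , refl

  ⇒∈label : ∀ (C : Geodesic5 n) {x} → ∃[ p ] Geodesic5.pent C p ≡ x → x ∈ᵖ label C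
  ⇒∈label C (0F , refl) = isA
  ⇒∈label C (1F , refl) = isB
  ⇒∈label C (2F , refl) = isC
  ⇒∈label C (3F , refl) = isD
  ⇒∈label C (4F , refl) = isE

theorem4p2 : (n : ℕ) (C C' : Geodesic5 n) (γ : Orientation C) (γ' : Orientation C') →
    EquivA γ γ' ⇔ SameLabel C C'
theorem4p2 n C C' γ γ' = mk⇔
  (λ h x → mk⇔
    (λ v → ∈label⇒ C' (label-⊆ γ γ' (λ αβ → proj₁ (EquivA⇒Detects αβ γ γ' h)) (⇒∈label C v)))
    (λ v → ∈label⇒ C (label-⊆ γ' γ (λ αβ → proj₂ (EquivA⇒Detects αβ γ γ' h)) (⇒∈label C' v))))
  (λ same → orientation-homologous γ γ' (SameLabel⇒≡ C C' same))
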